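{- Let $p$ be a prime with $p\equiv 1$ or $3 \pmod 8$, and let $\left(\frac{\cdot}{p}\right)$ denote the Legendre symbol. Put $$A=\frac12\sum_{x=0}^{p-1}\left(\frac{x^3+4x^2+2x}{p}\right).$$ (1) If $p\equiv 1\pmod 8$ and $n$ is a quadratic nonresidue modulo $p$, put $$B=\frac14\sum_{x=0}^{p-1}\left(\frac{x^5+nx}{p}\right).$$ (2) If $p\equiv 3\pmod 8$, put $$B=\frac14\left(1+\sum_{x=0}^{p-1}\left(\frac{x^6+4x^5+10x^4-20x^2-16x-8}{p}\right)\right).$$ Then $A$ and $B$ are integers and $A^2+2B^2=p$. -}

module Defs where

open import Data.Nat as ℕ using (ℕ; zero; suc; NonZero)
open import Data.Integer as ℤ using (ℤ; +_; -_; _+_; _*_)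
open import Data.Integer.DivMod using (_%ℕ_)
open import Data.List using (List; upTo; map; foldr)
open import Data.List.Relation.Unary.Any using (any?)
open import Relation.Nullary.Decidable using (does)
open import Data.Bool using (if_then_else_)
open import Data.Nat using (_≡ᵇ_)

legendre : (p : ℕ) .{{_ : NonZero p}} → ℤ → ℤ
legendre p a =
  let r = a %ℕ p in
  if r ≡ᵇ 0 then + 0
  else if does (any? (λ x → (x ℕ.* x) ℕ.% p ℕ.≟ r) (upTo p)) then + 1
  else - (+ 1)

legendreSum : (p : ℕ) .{{_ : NonZero p}} → (ℤ → ℤ) → ℤ
legendreSum p f = foldr _+_ (+ 0) (map (λ x → legendre p (f (+ x))) (upTo p))

{-# OPTIONS --safe #-}

-- Let R = 𝔽[i] with i² = -1 and Ψ(c) = Σ_{w ∈ R} χ(N w) χ(Re(c w⁴)), which is p - 1 times a character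
-- sum over the projective line.  Replacing w by u w gives Ψ(c) = χ(N u) Ψ(c u⁴), so F = Ψ² depends only
-- on the class of c modulo scalars and fourth powers.  If N d is a nonsquare, Hilbert 90 shows that the
-- units fall into the classes of 1, d, d², d³; moreover F(d²) = 0, F(d³) = F(d), and F vanishes on
-- nonunits.  On the other hand Σ F is computed from the orthogonality of χ: only the w / z with (w / z)⁴
-- real contribute, and since χ(-2) = 1 they contribute equally.  The comparison is
-- F(1) + 2 F(d) = 16 p (p - 1)².
-- Substitutions identify Ψ(1) with 4 A (p - 1) and, for suitable d, Ψ(d) with 4 B (p - 1) in both cases.
-- The identity (4A)² + 2 (4B)² = 16 p forces A and B to be integers.  The values of χ(-1) and χ(2) are read
-- off modulo 8 from the number p - χ(-1) of points on the circle x² + y² = 1.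

module Submission where

open import Defs
open import Data.Nat as ℕ using (ℕ; NonZero)
open import Data.Nat.Primality using (Prime; euclidsLemma; prime[2]; irreducible[2]; ¬prime[1])
open import Data.Integer as ℤ using (ℤ; +_; -_; _+_; _*_; _-_; _^_)
open import Data.Product using (Σ; _×_)
open import Relation.Binary.PropositionalEquality using (_≡_)
open import Data.Bool using (true; false; if_then_else_)
open import Data.Integer.DivMod using (_%ℕ_; _/ℕ_; n%ℕd<d; a≡a%ℕn+[a/ℕn]*n)
import Data.Integer.Divisibility.Signed as Signed
import Data.Integer.Properties as ℤₚ
open import Data.Integer.Tactic.RingSolver using (solve-∀)
open import Data.List using (List; []; _∷_; map; foldr; upTo; _++_; length; cartesianProduct)
import Data.List.Properties as Listₚ
open import Data.List.Membership.Propositional using (_∈_; find; lose)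
open import Data.List.Membership.Propositional.Properties using (∈-upTo⁺; ∈-map⁺; ∈-cartesianProduct⁺)
open import Data.List.Relation.Unary.Any using (any?; here; there)
open import Data.Nat.Coprimality using (coprime-Bézout; prime⇒coprime)
import Data.Nat.Divisibility as ∣
import Data.Nat.DivMod as ℕ
import Data.Nat.GCD as GCD
import Data.Nat.Properties as ℕₚ
open import Data.Product using (_,_; proj₁; proj₂; ∃)
open import Data.Sum using (_⊎_; inj₁; inj₂; [_,_]′)
open import Function using (_∘_; id)
open import Relation.Binary.PropositionalEquality
  using (refl; sym; trans; cong; cong₂; subst; subst₂; module ≡-Reasoning)
open import Relation.Nullary using (¬_; Dec; yes; no; contradiction)
open import Relation.Nullary.Decidable using (does; map′; dec-true; dec-false; from-no)

-- The form x² + 2 y² appears because conjugation exchanges the classes of d and d³: one value of F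
-- is counted twice. Squaring removes the sign χ (N u), which keeps Ψ itself from being a class
-- function. The same sign forces the zeros: where a u with χ (N u) = -1 carries c to itself, or to
-- its conjugate up to a square scalar, Ψ c equals its own negative. The condition on p enters as χ
-- (-2) = 1. The ratios 1 and i have norm 1 and fourth power 1, whereas 1 + i and 1 - i have norm 2
-- and fourth power -4, hence weight χ (-8) = χ (-2); with the opposite sign the four weights would
-- cancel. The factor -2 returns in the substitutions leading to the cubic and the sextic. For p = 1
-- mod 8 the ring R splits, for p = 3 mod 8 it is a field. Arguing with norms and conjugates treats
-- both at once; only the choice of d differs, built from a square root of -1 or of -2 in the prime
-- field. Sums run over the whole plane, where multiplication by a unit is a permutation; the price
-- is the factor p - 1, which cancels at the end together with the number of units.

-- Finite sums and their reindexing.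

∑ : {X : Set} → List X → (X → ℤ) → ℤ
∑ xs f = foldr _+_ (+ 0) (map f xs)

module _ {X : Set} where

  ∑-cong : (xs : List X) {f g : X → ℤ} → (∀ x → f x ≡ g x) → ∑ xs f ≡ ∑ xs g
  ∑-cong xs f≗g = cong (foldr _+_ (+ 0)) (Listₚ.map-cong f≗g xs)

  ∑-0 : (xs : List X) → ∑ xs (λ _ → + 0) ≡ + 0
  ∑-0 []       = refl
  ∑-0 (_ ∷ xs) = trans (ℤₚ.+-identityˡ _) (∑-0 xs)

  ∑-+ : (xs : List X) (f g : X → ℤ) → ∑ xs (λ x → f x + g x) ≡ ∑ xs f + ∑ xs g
  ∑-+ []       f g = refl
  ∑-+ (x ∷ xs) f g = trans (cong (ℤ._+_ (f x + g x)) (∑-+ xs f g)) (interchange (f x) (g x) _ _)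
    where
    interchange : ∀ a b c d → (a + b) + (c + d) ≡ (a + c) + (b + d)
    interchange = solve-∀

  ∑-*ˡ : (xs : List X) (k : ℤ) (f : X → ℤ) → ∑ xs (λ x → k * f x) ≡ k * ∑ xs f
  ∑-*ˡ []       k f = sym (ℤₚ.*-zeroʳ k)
  ∑-*ˡ (x ∷ xs) k f = trans (cong (ℤ._+_ (k * f x)) (∑-*ˡ xs k f)) (sym (ℤₚ.*-distribˡ-+ k (f x) _))

  ∑-*ʳ : (xs : List X) (k : ℤ) (f : X → ℤ) → ∑ xs (λ x → f x * k) ≡ ∑ xs f * k
  ∑-*ʳ xs k f = trans (∑-cong xs (λ x → ℤₚ.*-comm (f x) k)) (trans (∑-*ˡ xs k f) (ℤₚ.*-comm k _))

  ∑-++ : (xs ys : List X) (f : X → ℤ) → ∑ (xs ++ ys) f ≡ ∑ xs f + ∑ ys f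
  ∑-++ []       ys f = sym (ℤₚ.+-identityˡ _)
  ∑-++ (x ∷ xs) ys f = trans (cong (ℤ._+_ (f x)) (∑-++ xs ys f)) (sym (ℤₚ.+-assoc (f x) _ _))

  ∑-const : (xs : List X) (k : ℤ) → ∑ xs (λ _ → k) ≡ + length xs * k
  ∑-const []       k = refl
  ∑-const (_ ∷ xs) k = trans (cong (ℤ._+_ k) (∑-const xs k)) (sym (ℤₚ.suc-* (+ length xs) k))

  ∑-nonneg : (xs : List X) {f : X → ℤ} → (∀ x → + 0 ℤ.≤ f x) → + 0 ℤ.≤ ∑ xs f
  ∑-nonneg []       f≥0 = ℤₚ.≤-refl
  ∑-nonneg (x ∷ xs) f≥0 = ℤₚ.+-mono-≤ (f≥0 x) (∑-nonneg xs f≥0)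

  ∑-nonneg-zero : (xs : List X) {f : X → ℤ} → (∀ x → + 0 ℤ.≤ f x) → ∑ xs f ≡ + 0 →
                  ∀ {x} → x ∈ xs → f x ≡ + 0
  ∑-nonneg-zero (x ∷ xs) {f} f≥0 eq = λ where
      (here refl) → fx≡0
      (there x∈)  → ∑-nonneg-zero xs f≥0 rest≡0 x∈
    where
    rest≥0 : + 0 ℤ.≤ ∑ xs f
    rest≥0 = ∑-nonneg xs f≥0
    fx≡0 : f x ≡ + 0
    fx≡0 = ℤₚ.≤-antisym
      (subst₂ ℤ._≤_ (ℤₚ.+-identityʳ (f x)) eq (ℤₚ.+-monoʳ-≤ (f x) rest≥0)) (f≥0 x)
    rest≡0 : ∑ xs f ≡ + 0
    rest≡0 = trans (sym (ℤₚ.+-identityˡ _)) (trans (cong (_+ ∑ xs f) (sym fx≡0)) eq)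

∑-map : {X Y : Set} (xs : List X) (h : X → Y) (f : Y → ℤ) → ∑ (map h xs) f ≡ ∑ xs (f ∘ h)
∑-map xs h f = cong (foldr _+_ (+ 0)) (sym (Listₚ.map-∘ xs))

module _ {X Y : Set} where

  ∑-swap : (xs : List X) (ys : List Y) (f : X → Y → ℤ) →
           ∑ xs (λ x → ∑ ys (λ y → f x y)) ≡ ∑ ys (λ y → ∑ xs (λ x → f x y))
  ∑-swap []       ys f = sym (∑-0 ys)
  ∑-swap (x ∷ xs) ys f =
    trans (cong (ℤ._+_ (∑ ys (f x))) (∑-swap xs ys f)) (sym (∑-+ ys (f x) (λ y → ∑ xs (λ x → f x y))))

  ∑-× : (xs : List X) (ys : List Y) (f : X × Y → ℤ) →
        ∑ (cartesianProduct xs ys) f ≡ ∑ xs (λ x → ∑ ys (λ y → f (x , y)))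
  ∑-× []       ys f = refl
  ∑-× (x ∷ xs) ys f = trans (∑-++ (map (x ,_) ys) _ f) (cong₂ _+_ (∑-map ys (x ,_) f) (∑-× xs ys f))

  ∑-product : (xs : List X) (ys : List Y) (f : X → ℤ) (g : Y → ℤ) →
              ∑ xs f * ∑ ys g ≡ ∑ xs (λ x → ∑ ys (λ y → f x * g y))
  ∑-product xs ys f g = trans (sym (∑-*ʳ xs _ f)) (∑-cong xs (λ x → sym (∑-*ˡ ys (f x) g)))

-- Equality enters as a 0-1 valued kernel, which makes reindexing of sums an instance of ∑-swap.
record Finite (X : Set) : Set₁ where
  infix 4 _∼_
  field
    _∼_      : X → X → Set
    ∼-refl   : ∀ {x} → x ∼ x
    elements : List X
    kernel   : X → X → ℤ
    dirac    : (f : X → ℤ) → (∀ {x y} → x ∼ y → f x ≡ f y) →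
               ∀ x → ∑ elements (λ y → kernel x y * f y) ≡ f x

  Resp : (X → ℤ) → Set
  Resp f = ∀ {x y} → x ∼ y → f x ≡ f y

module _ {X Y : Set} (A : Finite X) (B : Finite Y) where
  private
    module A = Finite A
    module B = Finite B

  -- `adjoint` expresses through the kernels that σ x = y exactly when τ y = x. This single
  -- equivalence replaces the two statements that σ and τ are mutually inverse.
  ∑-reindex : (σ : X → Y) (τ : Y → X) → (∀ x y → B.kernel (σ x) y ≡ A.kernel (τ y) x) →
              (f : Y → ℤ) → B.Resp f → ∑ A.elements (f ∘ σ) ≡ ∑ B.elements f
  ∑-reindex σ τ adjoint f resp = begin
    ∑ A.elements (f ∘ σ)
      ≡⟨ ∑-cong A.elements (λ x → sym (B.dirac f resp (σ x))) ⟩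
    ∑ A.elements (λ x → ∑ B.elements (λ y → B.kernel (σ x) y * f y))
      ≡⟨ ∑-swap A.elements B.elements _ ⟩
    ∑ B.elements (λ y → ∑ A.elements (λ x → B.kernel (σ x) y * f y))
      ≡⟨ ∑-cong B.elements (λ y → ∑-cong A.elements (λ x → cong (_* f y) (adjoint x y))) ⟩
    ∑ B.elements (λ y → ∑ A.elements (λ x → A.kernel (τ y) x * f y))
      ≡⟨ ∑-cong B.elements (λ y → A.dirac (λ _ → f y) (λ _ → refl) (τ y)) ⟩
    ∑ B.elements f ∎
    where open ≡-Reasoning

  product : Finite (X × Y)
  product = record
    { _∼_      = λ (x , y) (x′ , y′) → x A.∼ x′ × y B.∼ y′
    ; ∼-refl   = A.∼-refl , B.∼-refl
    ; elements = cartesianProduct A.elements B.elements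
    ; kernel   = λ (x , y) (x′ , y′) → A.kernel x x′ * B.kernel y y′
    ; dirac    = λ f resp (x , y) → begin
        ∑ (cartesianProduct A.elements B.elements)
            (λ (x′ , y′) → A.kernel x x′ * B.kernel y y′ * f (x′ , y′))
          ≡⟨ ∑-× A.elements B.elements _ ⟩
        ∑ A.elements (λ x′ → ∑ B.elements (λ y′ → A.kernel x x′ * B.kernel y y′ * f (x′ , y′)))
          ≡⟨ ∑-cong A.elements (λ x′ → trans
               (∑-cong B.elements (λ y′ → ℤₚ.*-assoc (A.kernel x x′) _ _))
               (∑-*ˡ B.elements (A.kernel x x′) _)) ⟩
        ∑ A.elements (λ x′ → A.kernel x x′ * ∑ B.elements (λ y′ → B.kernel y y′ * f (x′ , y′)))
          ≡⟨ ∑-cong A.elements (λ x′ → cong (A.kernel x x′ *_)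
               (B.dirac (λ y′ → f (x′ , y′)) (λ e → resp (A.∼-refl , e)) y)) ⟩
        ∑ A.elements (λ x′ → A.kernel x x′ * f (x′ , y))
          ≡⟨ A.dirac (λ x′ → f (x′ , y)) (λ e → resp (e , B.∼-refl)) x ⟩
        f (x , y) ∎
    }
    where open ≡-Reasoning

-- Arithmetic modulo p on integer representatives.

module Congruence (p : ℕ) .{{_ : NonZero p}} where

  infix 4 _≈_ _≉_
  -- No quotient is formed: residue classes are represented by arbitrary integers, and a function on
  -- the field is a function on ℤ that respects this relation.
  data _≈_ (a b : ℤ) : Set where
    congr : ∀ k → a - b ≡ k * + p → a ≈ b

  _≉_ : ℤ → ℤ → Set
  a ≉ b = ¬ (a ≈ b)

  -- Congruences are derived from hypotheses by giving cofactors: the last argument is left to the ring solver.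
  from-≈ : ∀ {a b u v} k → u ≈ v → a - b ≡ k * (u - v) → a ≈ b
  from-≈ k (congr l e) eq =
    congr (k * l) (trans eq (trans (cong (k *_) e) (sym (ℤₚ.*-assoc k l (+ p)))))

  from-≈₂ : ∀ {a b u v u′ v′} k l → u ≈ v → u′ ≈ v′ →
            a - b ≡ k * (u - v) + l * (u′ - v′) → a ≈ b
  from-≈₂ k l (congr m e) (congr n e′) eq =
    congr (k * m + l * n)
      (trans eq (trans (cong₂ (λ s t → k * s + l * t) e e′) (collect k l m n (+ p))))
    where
    collect : ∀ k l m n q → k * (m * q) + l * (n * q) ≡ (k * m + l * n) * q
    collect = solve-∀

  ≈-refl : ∀ {a} → a ≈ a
  ≈-refl {a} = congr (+ 0) (ℤₚ.+-inverseʳ a)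

  ≡⇒≈ : ∀ {a b} → a ≡ b → a ≈ b
  ≡⇒≈ refl = ≈-refl

  ≈-sym : ∀ {a b} → a ≈ b → b ≈ a
  ≈-sym {a} {b} e = from-≈ (- (+ 1)) e (id′ a b)
    where
    id′ : ∀ a b → b - a ≡ - (+ 1) * (a - b)
    id′ = solve-∀

  ≈-trans : ∀ {a b c} → a ≈ b → b ≈ c → a ≈ c
  ≈-trans {a} {b} {c} e f = from-≈₂ (+ 1) (+ 1) e f (id′ a b c)
    where
    id′ : ∀ a b c → a - c ≡ + 1 * (a - b) + + 1 * (b - c)
    id′ = solve-∀

  +-cong : ∀ {a b c d} → a ≈ b → c ≈ d → a + c ≈ b + d
  +-cong {a} {b} {c} {d} e f = from-≈₂ (+ 1) (+ 1) e f (id′ a b c d)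
    where
    id′ : ∀ a b c d → (a + c) - (b + d) ≡ + 1 * (a - b) + + 1 * (c - d)
    id′ = solve-∀

  -‿cong : ∀ {a b} → a ≈ b → - a ≈ - b
  -‿cong {a} {b} e = from-≈ (- (+ 1)) e (id′ a b)
    where
    id′ : ∀ a b → - a - - b ≡ - (+ 1) * (a - b)
    id′ = solve-∀

  minus-cong : ∀ {a b c d} → a ≈ b → c ≈ d → a - c ≈ b - d
  minus-cong e f = +-cong e (-‿cong f)

  *-cong : ∀ {a b c d} → a ≈ b → c ≈ d → a * c ≈ b * d
  *-cong {a} {b} {c} {d} e f = from-≈₂ c b e f (id′ a b c d)
    where
    id′ : ∀ a b c d → a * c - b * d ≡ c * (a - b) + b * (c - d)
    id′ = solve-∀

  *-congˡ : ∀ k {a b} → a ≈ b → k * a ≈ k * b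
  *-congˡ k e = *-cong (≈-refl {k}) e

  *-congʳ : ∀ k {a b} → a ≈ b → a * k ≈ b * k
  *-congʳ k e = *-cong e (≈-refl {k})

  zero-* : ∀ {a} b → a ≈ + 0 → a * b ≈ + 0
  zero-* {a} b e = from-≈ b e (id′ a b)
    where
    id′ : ∀ a b → a * b - + 0 ≡ b * (a - + 0)
    id′ = solve-∀

  *-zero : ∀ a {b} → b ≈ + 0 → a * b ≈ + 0
  *-zero a {b} e = from-≈ a e (id′ a b)
    where
    id′ : ∀ a b → a * b - + 0 ≡ a * (b - + 0)
    id′ = solve-∀

  a-b≈0⇒a≈b : ∀ {a b} → a - b ≈ + 0 → a ≈ b
  a-b≈0⇒a≈b {a} {b} e = from-≈ (+ 1) e (id′ a b)
    where
    id′ : ∀ a b → a - b ≡ + 1 * ((a - b) - + 0)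
    id′ = solve-∀

  a≈b⇒a-b≈0 : ∀ {a b} → a ≈ b → a - b ≈ + 0
  a≈b⇒a-b≈0 {a} {b} e = from-≈ (+ 1) e (id′ a b)
    where
    id′ : ∀ a b → (a - b) - + 0 ≡ + 1 * (a - b)
    id′ = solve-∀

  a≈a%p : ∀ a → a ≈ + (a %ℕ p)
  a≈a%p a = congr (a /ℕ p)
    (trans (cong (_- + (a %ℕ p)) (a≡a%ℕn+[a/ℕn]*n a p)) (id′ (+ (a %ℕ p)) (a /ℕ p * + p)))
    where
    id′ : ∀ r s → (r + s) - r ≡ s
    id′ = solve-∀

  ≈-small : ∀ {m n} → m ℕ.< p → n ℕ.< p → + m ≈ + n → m ≡ n
  ≈-small {m} {n} m<p n<p (congr k e) = ℤₚ.+-injective (ℤₚ.i-j≡0⇒i≡j (+ m) (+ n) diff≡0)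
    where
    p∣diff : p ∣.∣ ℤ.∣ + m - + n ∣
    p∣diff = ∣.divides ℤ.∣ k ∣ (trans (cong ℤ.∣_∣ e) (ℤₚ.abs-* k (+ p)))
    diff<p : ℤ.∣ + m - + n ∣ ℕ.< p
    diff<p = subst (λ z → ℤ.∣ z ∣ ℕ.< p) (sym (ℤₚ.m-n≡m⊖n m n))
      (ℕₚ.≤-<-trans (ℤₚ.∣m⊝n∣≤m⊔n m n) (ℕₚ.⊔-pres-<m m<p n<p))
    diff≡0 : + m - + n ≡ + 0
    diff≡0 with ℤ.∣ + m - + n ∣ in eq
    ... | ℕ.zero  = ℤₚ.∣i∣≡0⇒i≡0 eq
    ... | ℕ.suc d = contradiction (∣.∣⇒≤ (subst (p ∣.∣_) eq p∣diff)) (ℕₚ.<⇒≱ (subst (ℕ._< p) eq diff<p))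

  ≈⇒%≡ : ∀ {a b} → a ≈ b → a %ℕ p ≡ b %ℕ p
  ≈⇒%≡ {a} {b} e = ≈-small (n%ℕd<d a p) (n%ℕd<d b p)
    (≈-trans (≈-sym (a≈a%p a)) (≈-trans e (a≈a%p b)))

  %≡⇒≈ : ∀ {a b} → a %ℕ p ≡ b %ℕ p → a ≈ b
  %≡⇒≈ {a} {b} eq = ≈-trans (a≈a%p a) (subst (λ r → + r ≈ b) (sym eq) (≈-sym (a≈a%p b)))

  0%p≡0 : + 0 %ℕ p ≡ 0
  0%p≡0 = ≈-small (n%ℕd<d (+ 0) p) (ℕ.>-nonZero⁻¹ p) (≈-sym (a≈a%p (+ 0)))

  infix 4 _≈?_
  _≈?_ : ∀ a b → Dec (a ≈ b)
  a ≈? b = map′ %≡⇒≈ ≈⇒%≡ (a %ℕ p ℕ.≟ b %ℕ p)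

  𝔽 : List ℤ
  𝔽 = map +_ (upTo p)

  𝔽-complete : ∀ a → ∃ λ b → b ∈ 𝔽 × a ≈ b
  𝔽-complete a = + (a %ℕ p) , ∈-map⁺ +_ (∈-upTo⁺ (n%ℕd<d a p)) , a≈a%p a

  Respects : (ℤ → ℤ) → Set
  Respects f = ∀ {a b} → a ≈ b → f a ≡ f b

  opaque
    δ : ℤ → ℤ
    δ a = if does (a ≈? + 0) then + 1 else + 0

    δ-0 : ∀ {a} → a ≈ + 0 → δ a ≡ + 1
    δ-0 {a} e = cong (λ b → if b then + 1 else + 0) (dec-true (a ≈? + 0) e)

    δ-≉0 : ∀ {a} → a ≉ + 0 → δ a ≡ + 0
    δ-≉0 {a} e = cong (λ b → if b then + 1 else + 0) (dec-false (a ≈? + 0) e)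

  δ-⇔ : ∀ {a b} → (a ≈ + 0 → b ≈ + 0) → (b ≈ + 0 → a ≈ + 0) → δ a ≡ δ b
  δ-⇔ {a} {b} f g with a ≈? + 0
  ... | yes e = trans (δ-0 e) (sym (δ-0 (f e)))
  ... | no ne = trans (δ-≉0 ne) (sym (δ-≉0 (ne ∘ g)))

  δ-resp : Respects δ
  δ-resp e = δ-⇔ (≈-trans (≈-sym e)) (≈-trans e)

  private
    ∑-upTo-suc : ∀ n (f : ℕ → ℤ) → ∑ (upTo (ℕ.suc n)) f ≡ f 0 + ∑ (upTo n) (f ∘ ℕ.suc)
    ∑-upTo-suc n f = cong (ℤ._+_ (f 0)) (trans
      (cong (λ xs → ∑ xs f) (sym (Listₚ.map-applyUpTo id ℕ.suc n)))
      (∑-map (upTo n) ℕ.suc f))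

    ∑-upTo-0 : ∀ n (f : ℕ → ℤ) → (∀ i → i ℕ.< n → f i ≡ + 0) → ∑ (upTo n) f ≡ + 0
    ∑-upTo-0 ℕ.zero    f f≡0 = refl
    ∑-upTo-0 (ℕ.suc n) f f≡0 = trans (∑-upTo-suc n f)
      (cong₂ _+_ (f≡0 0 ℕ.z<s) (∑-upTo-0 n (f ∘ ℕ.suc) (λ i i<n → f≡0 (ℕ.suc i) (ℕ.s<s i<n))))

    ∑-upTo-single : ∀ n {r} (f : ℕ → ℤ) → r ℕ.< n →
                    (∀ i → i ℕ.< n → ¬ (i ≡ r) → f i ≡ + 0) → ∑ (upTo n) f ≡ f r
    ∑-upTo-single (ℕ.suc n) {ℕ.zero} f r<n off = trans (∑-upTo-suc n f) (trans
      (cong (ℤ._+_ (f 0)) (∑-upTo-0 n (f ∘ ℕ.suc) (λ i i<n → off (ℕ.suc i) (ℕ.s<s i<n) (λ ()))))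
      (ℤₚ.+-identityʳ (f 0)))
    ∑-upTo-single (ℕ.suc n) {ℕ.suc r} f (ℕ.s<s r<n) off = trans (∑-upTo-suc n f) (trans
      (cong₂ _+_ (off 0 ℕ.z<s (λ ()))
        (∑-upTo-single n (f ∘ ℕ.suc) r<n
          (λ i i<n i≢r → off (ℕ.suc i) (ℕ.s<s i<n) (i≢r ∘ ℕₚ.suc-injective))))
      (ℤₚ.+-identityˡ (f (ℕ.suc r))))

  ∑-dirac : ∀ (f : ℤ → ℤ) → Respects f → ∀ a → ∑ 𝔽 (λ b → δ (a - b) * f b) ≡ f a
  ∑-dirac f resp a = begin
    ∑ 𝔽 (λ b → δ (a - b) * f b)
      ≡⟨ ∑-map (upTo p) +_ (λ b → δ (a - b) * f b) ⟩
    ∑ (upTo p) (λ i → δ (a - + i) * f (+ i))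
      ≡⟨ ∑-upTo-single p (λ i → δ (a - + i) * f (+ i)) (n%ℕd<d a p)
           (λ i i<p i≢r → cong (_* f (+ i)) (δ-≉0 (λ e → i≢r (sym (≈-small (n%ℕd<d a p) i<p
             (≈-trans (≈-sym (a≈a%p a)) (a-b≈0⇒a≈b e))))))) ⟩
    δ (a - + (a %ℕ p)) * f (+ (a %ℕ p))
      ≡⟨ cong₂ _*_ (δ-0 (a≈b⇒a-b≈0 (a≈a%p a))) (resp (≈-sym (a≈a%p a))) ⟩
    + 1 * f a
      ≡⟨ ℤₚ.*-identityˡ (f a) ⟩
    f a ∎
    where open ≡-Reasoning

  finite : Finite ℤ
  finite = record
    { _∼_      = _≈_
    ; ∼-refl   = ≈-refl
    ; elements = 𝔽
    ; kernel   = λ a b → δ (a - b)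
    ; dirac    = ∑-dirac
    }

  ∑-legendre : ∀ f → legendreSum p f ≡ ∑ 𝔽 (λ x → legendre p (f x))
  ∑-legendre f = sym (∑-map (upTo p) +_ (λ x → legendre p (f x)))

  length-𝔽 : length 𝔽 ≡ p
  length-𝔽 = trans (Listₚ.length-map +_ (upTo p)) (Listₚ.length-upTo p)

-- The field with p elements and the multiplicativity of its quadratic character.

module PrimeField (p : ℕ) .{{_ : NonZero p}} (p-prime : Prime p)
                  (2≉0 : Congruence._≉_ p (+ 2) (+ 0)) where
  open Congruence p

  1≉0 : + 1 ≉ + 0
  1≉0 e = 2≉0 (+-cong e e)

  private
    bézout⇒inverse : ∀ {r} → GCD.Bézout.Identity 1 p r → ∃ λ b → + r * b ≈ + 1
    bézout⇒inverse {r} (GCD.Bézout.+- x y eq) = - (+ y) , congr (- (+ x)) (begin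
      + r * - (+ y) - + 1          ≡⟨ id₁ (+ r) (+ y) ⟩
      - (+ 1 + + y * + r)          ≡⟨ cong (λ z → - (+ 1 + z)) (sym (ℤₚ.pos-* y r)) ⟩
      - (+ (1 ℕ.+ y ℕ.* r))        ≡⟨ cong (λ z → - (+ z)) eq ⟩
      - (+ (x ℕ.* p))              ≡⟨ cong -_ (ℤₚ.pos-* x p) ⟩
      - (+ x * + p)                ≡⟨ ℤₚ.neg-distribˡ-* (+ x) (+ p) ⟩
      - (+ x) * + p                ∎)
      where
      open ≡-Reasoning
      id₁ : ∀ r y → r * - y - + 1 ≡ - (+ 1 + y * r)
      id₁ = solve-∀
    bézout⇒inverse {r} (GCD.Bézout.-+ x y eq) = + y , congr (+ x) (begin
      + r * + y - + 1              ≡⟨ cong (_- + 1) (ℤₚ.*-comm (+ r) (+ y)) ⟩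
      + y * + r - + 1              ≡⟨ cong (_- + 1) (sym (ℤₚ.pos-* y r)) ⟩
      + (y ℕ.* r) - + 1            ≡⟨ cong (λ z → + z - + 1) (sym eq) ⟩
      + (1 ℕ.+ x ℕ.* p) - + 1      ≡⟨ id₂ (+ (x ℕ.* p)) ⟩
      + (x ℕ.* p)                  ≡⟨ ℤₚ.pos-* x p ⟩
      + x * + p                    ∎)
      where
      open ≡-Reasoning
      id₂ : ∀ z → + 1 + z - + 1 ≡ z
      id₂ = solve-∀

    -- The default value 0 at r = 0 makes `inv` a total involution of the field, so that inversion
    -- can reindex complete sums in `∑-inv`.
    inverse : ∀ r → r ℕ.< p → ∃ λ b → ¬ (r ≡ 0) → + r * b ≈ + 1
    inverse ℕ.zero    _   = + 0 , λ r≢0 → contradiction refl r≢0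
    inverse (ℕ.suc r) r<p =
      let (b , e) = bézout⇒inverse (coprime-Bézout (prime⇒coprime p-prime r<p)) in b , λ _ → e

  opaque
    inv : ℤ → ℤ
    inv a = proj₁ (inverse (a %ℕ p) (n%ℕd<d a p))

    inv-resp : Respects inv
    inv-resp e = cong-inverse (≈⇒%≡ e)
      where
      cong-inverse : ∀ {r s} {r<p : r ℕ.< p} {s<p : s ℕ.< p} → r ≡ s →
                     proj₁ (inverse r r<p) ≡ proj₁ (inverse s s<p)
      cong-inverse {r} refl = cong (λ q → proj₁ (inverse r q)) (ℕₚ.<-irrelevant _ _)

    inv-0 : inv (+ 0) ≡ + 0
    inv-0 = go 0%p≡0
      where
      go : ∀ {r} {r<p : r ℕ.< p} → r ≡ 0 → proj₁ (inverse r r<p) ≡ + 0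
      go refl = refl

    *-inv : ∀ {a} → a ≉ + 0 → a * inv a ≈ + 1
    *-inv {a} a≉0 = ≈-trans (*-congʳ (inv a) (a≈a%p a))
      (proj₂ (inverse (a %ℕ p) (n%ℕd<d a p)) (λ r≡0 → a≉0 (%≡⇒≈ (trans r≡0 (sym 0%p≡0)))))

  inv-cong : ∀ {a b} → a ≈ b → inv a ≈ inv b
  inv-cong e = ≡⇒≈ (inv-resp e)

  inv-≈0 : ∀ {a} → a ≈ + 0 → inv a ≈ + 0
  inv-≈0 e = ≡⇒≈ (trans (inv-resp e) inv-0)

  *-cancelˡ-0 : ∀ {a b} → a ≉ + 0 → a * b ≈ + 0 → b ≈ + 0
  *-cancelˡ-0 {a} {b} a≉0 e = from-≈₂ (inv a) (- b) e (*-inv a≉0) (id′ a b (inv a))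
    where
    id′ : ∀ a b i → b - + 0 ≡ i * (a * b - + 0) + - b * (a * i - + 1)
    id′ = solve-∀

  *-cancelˡ : ∀ {a b c} → a ≉ + 0 → a * b ≈ a * c → b ≈ c
  *-cancelˡ {a} {b} {c} a≉0 e = a-b≈0⇒a≈b (*-cancelˡ-0 a≉0 (from-≈ (+ 1) e (id′ a b c)))
    where
    id′ : ∀ a b c → a * (b - c) - + 0 ≡ + 1 * (a * b - a * c)
    id′ = solve-∀

  *-≉0 : ∀ {a b} → a ≉ + 0 → b ≉ + 0 → a * b ≉ + 0
  *-≉0 a≉0 b≉0 e = b≉0 (*-cancelˡ-0 a≉0 e)

  ≉0-*ˡ : ∀ {a b} → a * b ≉ + 0 → a ≉ + 0
  ≉0-*ˡ {b = b} ab≉0 e = ab≉0 (zero-* b e)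

  ≉0-*ʳ : ∀ {a b} → a * b ≉ + 0 → b ≉ + 0
  ≉0-*ʳ {a} ab≉0 e = ab≉0 (*-zero a e)

  ≈-≉0 : ∀ {a b} → a ≈ b → b ≉ + 0 → a ≉ + 0
  ≈-≉0 e b≉0 a≈0 = b≉0 (≈-trans (≈-sym e) a≈0)

  -‿≉0 : ∀ {a} → a ≉ + 0 → - a ≉ + 0
  -‿≉0 {a} a≉0 e = a≉0 (from-≈ (- (+ 1)) e (id′ a))
    where
    id′ : ∀ a → a - + 0 ≡ - (+ 1) * (- a - + 0)
    id′ = solve-∀

  inv-≉0 : ∀ {a} → a ≉ + 0 → inv a ≉ + 0
  inv-≉0 {a} a≉0 = ≉0-*ʳ {a} (≈-≉0 (*-inv a≉0) 1≉0)

  inv-unique : ∀ {a b} → a * b ≈ + 1 → b ≈ inv a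
  inv-unique {a} {b} e = *-cancelˡ a≉0 (≈-trans e (≈-sym (*-inv a≉0)))
    where
    a≉0 : a ≉ + 0
    a≉0 = ≉0-*ˡ {b = b} (≈-≉0 e 1≉0)

  inv-involutive : ∀ a → inv (inv a) ≈ a
  inv-involutive a with a ≈? + 0
  ... | yes e = ≈-trans (inv-≈0 (inv-≈0 e)) (≈-sym e)
  ... | no ne = ≈-sym (inv-unique (≈-trans (≡⇒≈ (ℤₚ.*-comm (inv a) a)) (*-inv ne)))

  4≉0 : + 4 ≉ + 0
  4≉0 = *-≉0 2≉0 2≉0

  a+a≈0⇒a≈0 : ∀ {a} → a + a ≈ + 0 → a ≈ + 0
  a+a≈0⇒a≈0 {a} e = *-cancelˡ-0 2≉0 (≈-trans (≡⇒≈ (id′ a)) e)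
    where
    id′ : ∀ a → + 2 * a ≡ a + a
    id′ = solve-∀

  -- Indexing by the value lets a match on `χ-view a` replace χ a by 0, 1 or -1 in the goal and
  -- supply the reason at the same time.
  data QuadraticCharacter (a : ℤ) : ℤ → Set where
    zero      : a ≈ + 0 → QuadraticCharacter a (+ 0)
    square    : ∀ x → a ≉ + 0 → x * x ≈ a → QuadraticCharacter a (+ 1)
    nonsquare : a ≉ + 0 → (∀ x → x * x ≉ a) → QuadraticCharacter a (- (+ 1))

  opaque
    χ : ℤ → ℤ
    χ = legendre p

    χ≡legendre : ∀ a → χ a ≡ legendre p a
    χ≡legendre a = refl

    χ-resp : Respects χ
    χ-resp e = cong (λ r →
      if r ℕ.≡ᵇ 0 then + 0
      else if does (any? (λ x → (x ℕ.* x) ℕ.% p ℕ.≟ r) (upTo p)) then + 1 else - (+ 1)) (≈⇒%≡ e)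

    χ-view : ∀ a → QuadraticCharacter a (χ a)
    χ-view a = view (a %ℕ p) refl
      where
      view : ∀ r → a %ℕ p ≡ r → QuadraticCharacter a
        (if r ℕ.≡ᵇ 0 then + 0
         else if does (any? (λ x → (x ℕ.* x) ℕ.% p ℕ.≟ r) (upTo p)) then + 1 else - (+ 1))
      view ℕ.zero    eq = zero (%≡⇒≈ (trans eq (sym 0%p≡0)))
      view (ℕ.suc r) eq with any? (λ x → (x ℕ.* x) ℕ.% p ℕ.≟ ℕ.suc r) (upTo p)
      ... | yes found = let (x , _ , xx≡) = find found in
        square (+ x) a≉0 (%≡⇒≈ (trans (cong (_%ℕ p) (sym (ℤₚ.pos-* x x))) (trans xx≡ (sym eq))))
        where
        a≉0 : a ≉ + 0
        a≉0 e = ℕₚ.0≢1+n (trans (sym 0%p≡0) (trans (sym (≈⇒%≡ e)) eq))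
      ... | no none = nonsquare a≉0 (λ x e → none (lose (∈-upTo⁺ (n%ℕd<d x p)) (found x e)))
        where
        a≉0 : a ≉ + 0
        a≉0 e = ℕₚ.0≢1+n (trans (sym 0%p≡0) (trans (sym (≈⇒%≡ e)) eq))
        found : ∀ x → x * x ≈ a → (x %ℕ p ℕ.* (x %ℕ p)) ℕ.% p ≡ ℕ.suc r
        found x e = trans (cong (_%ℕ p) (ℤₚ.pos-* (x %ℕ p) (x %ℕ p)))
          (trans (≈⇒%≡ (≈-trans (*-cong (≈-sym (a≈a%p x)) (≈-sym (a≈a%p x))) e)) eq)

  χ-zero : ∀ {a} → a ≈ + 0 → χ a ≡ + 0
  χ-zero {a} e with χ a | χ-view a
  ... | _ | zero _          = refl
  ... | _ | square _ ne _   = contradiction e ne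
  ... | _ | nonsquare ne _  = contradiction e ne

  χ-square : ∀ {a} x → a ≉ + 0 → x * x ≈ a → χ a ≡ + 1
  χ-square {a} x ne e with χ a | χ-view a
  ... | _ | zero e₀        = contradiction e₀ ne
  ... | _ | square _ _ _   = refl
  ... | _ | nonsquare _ ns = contradiction e (ns x)

  χ-nonsquare : ∀ {a} → a ≉ + 0 → (∀ x → x * x ≉ a) → χ a ≡ - (+ 1)
  χ-nonsquare {a} ne ns with χ a | χ-view a
  ... | _ | zero e₀        = contradiction e₀ ne
  ... | _ | square x _ e   = contradiction e (ns x)
  ... | _ | nonsquare _ _  = refl

  χ-1 : χ (+ 1) ≡ + 1
  χ-1 = χ-square (+ 1) 1≉0 ≈-refl

  ∑-affine : ∀ k b → k ≉ + 0 → (f : ℤ → ℤ) → Respects f → ∑ 𝔽 (λ x → f (k * x + b)) ≡ ∑ 𝔽 f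
  ∑-affine k b k≉0 = ∑-reindex finite finite (λ x → k * x + b) (λ y → inv k * (y - b)) adjoint
    where
    id₁ : ∀ k b i x y → (i * (y - b) - x) - + 0 ≡ - i * ((k * x + b - y) - + 0) + x * (k * i - + 1)
    id₁ = solve-∀
    id₂ : ∀ k b i x y → (k * x + b - y) - + 0 ≡ - k * ((i * (y - b) - x) - + 0) + (y - b) * (k * i - + 1)
    id₂ = solve-∀
    adjoint : ∀ x y → δ (k * x + b - y) ≡ δ (inv k * (y - b) - x)
    adjoint x y = δ-⇔
      (λ e → from-≈₂ (- inv k) x e (*-inv k≉0) (id₁ k b (inv k) x y))
      (λ e → from-≈₂ (- k) (y - b) e (*-inv k≉0) (id₂ k b (inv k) x y))

  ∑-scale : ∀ k → k ≉ + 0 → (f : ℤ → ℤ) → Respects f → ∑ 𝔽 (λ x → f (k * x)) ≡ ∑ 𝔽 f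
  ∑-scale k k≉0 f resp =
    trans (∑-cong 𝔽 (λ x → cong f (sym (ℤₚ.+-identityʳ (k * x))))) (∑-affine k (+ 0) k≉0 f resp)

  ∑-inv : (f : ℤ → ℤ) → Respects f → ∑ 𝔽 (λ x → f (inv x)) ≡ ∑ 𝔽 f
  ∑-inv = ∑-reindex finite finite inv inv (λ x y → δ-⇔ (flip x y) (flip y x))
    where
    flip : ∀ x y → inv x - y ≈ + 0 → inv y - x ≈ + 0
    flip x y e = a≈b⇒a-b≈0 (≈-trans (inv-cong (≈-sym (a-b≈0⇒a≈b e))) (inv-involutive x))

  ∑-δ : ∀ a → ∑ 𝔽 (λ x → δ (a - x)) ≡ + 1
  ∑-δ a = trans (∑-cong 𝔽 (λ x → sym (ℤₚ.*-identityʳ (δ (a - x))))) (∑-dirac (λ _ → + 1) (λ _ → refl) a)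

  count-roots : ∀ a → ∑ 𝔽 (λ x → δ (x * x - a)) ≡ + 1 + χ a
  count-roots a with χ a | χ-view a
  ... | _ | zero a≈0 = trans (∑-cong 𝔽 (λ x → δ-⇔ (to x) (from x))) (∑-δ (+ 0))
    where
    to : ∀ x → x * x - a ≈ + 0 → + 0 - x ≈ + 0
    to x e with x ≈? + 0
    ... | yes x≈0 = minus-cong {+ 0} {+ 0} ≈-refl x≈0
    ... | no  x≉0 = contradiction (≈-trans (a-b≈0⇒a≈b e) a≈0) (*-≉0 x≉0 x≉0)
    from : ∀ x → + 0 - x ≈ + 0 → x * x - a ≈ + 0
    from x e = minus-cong {x * x} {+ 0} (zero-* {x} x (≈-sym (a-b≈0⇒a≈b {+ 0} {x} e))) a≈0
  ... | _ | nonsquare _ ns = trans (∑-cong 𝔽 (λ x → δ-≉0 (λ e → ns x (a-b≈0⇒a≈b e)))) (∑-0 𝔽)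
  ... | _ | square s a≉0 ss≈a = begin
      ∑ 𝔽 (λ x → δ (x * x - a))                        ≡⟨ ∑-cong 𝔽 split ⟩
      ∑ 𝔽 (λ x → δ (s - x) + δ (- s - x))               ≡⟨ ∑-+ 𝔽 (λ x → δ (s - x)) (λ x → δ (- s - x)) ⟩
      ∑ 𝔽 (λ x → δ (s - x)) + ∑ 𝔽 (λ x → δ (- s - x))   ≡⟨ cong₂ _+_ (∑-δ s) (∑-δ (- s)) ⟩
      + 2 ∎
    where
    open ≡-Reasoning
    s≉0 : s ≉ + 0
    s≉0 e = a≉0 (≈-trans (≈-sym ss≈a) (zero-* s e))
    id₁ : ∀ s x → (s + s) - + 0 ≡ + 1 * (s - x - + 0) + - (+ 1) * (- s - x - + 0)
    id₁ = solve-∀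
    id₂ : ∀ a s x → x * x - a - + 0 ≡ - (s + x) * (s - x - + 0) + + 1 * (s * s - a)
    id₂ = solve-∀
    id₃ : ∀ a s x → x * x - a - + 0 ≡ (s - x) * (- s - x - + 0) + + 1 * (s * s - a)
    id₃ = solve-∀
    id₄ : ∀ a s x → (s - x) * (- s - x) - + 0 ≡ + 1 * (x * x - a - + 0) + - (+ 1) * (s * s - a)
    id₄ = solve-∀
    split : ∀ x → δ (x * x - a) ≡ δ (s - x) + δ (- s - x)
    split x with s - x ≈? + 0 | - s - x ≈? + 0
    ... | yes e | yes e′ = contradiction (a+a≈0⇒a≈0 (from-≈₂ (+ 1) (- (+ 1)) e e′ (id₁ s x))) s≉0
    ... | yes e | no ne  = trans (δ-0 (from-≈₂ (- (s + x)) (+ 1) e ss≈a (id₂ a s x)))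
                             (sym (cong₂ _+_ (δ-0 e) (δ-≉0 ne)))
    ... | no ne | yes e  = trans (δ-0 (from-≈₂ (s - x) (+ 1) e ss≈a (id₃ a s x)))
                             (sym (cong₂ _+_ (δ-≉0 ne) (δ-0 e)))
    ... | no n₁ | no n₂  = trans
      (δ-≉0 (λ e → *-≉0 n₁ n₂ (from-≈₂ (+ 1) (- (+ 1)) e ss≈a (id₄ a s x))))
      (sym (cong₂ _+_ (δ-≉0 n₁) (δ-≉0 n₂)))

  ∑-1 : ∑ 𝔽 (λ _ → + 1) ≡ + p
  ∑-1 = trans (∑-const 𝔽 (+ 1)) (trans (ℤₚ.*-identityʳ _) (cong +_ length-𝔽))

  -- Counting the pairs (x , x²) by their second entry.
  ∑-χ : ∑ 𝔽 χ ≡ + 0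
  ∑-χ = i+j≡i⇒j≡0 (+ p) (∑ 𝔽 χ) (begin
    + p + ∑ 𝔽 χ                              ≡⟨ cong (_+ ∑ 𝔽 χ) (sym ∑-1) ⟩
    ∑ 𝔽 (λ _ → + 1) + ∑ 𝔽 χ                  ≡⟨ sym (∑-+ 𝔽 (λ _ → + 1) χ) ⟩
    ∑ 𝔽 (λ a → + 1 + χ a)                    ≡⟨ ∑-cong 𝔽 (λ a → sym (count-roots a)) ⟩
    ∑ 𝔽 (λ a → ∑ 𝔽 (λ x → δ (x * x - a)))    ≡⟨ ∑-swap 𝔽 𝔽 (λ a x → δ (x * x - a)) ⟩
    ∑ 𝔽 (λ x → ∑ 𝔽 (λ a → δ (x * x - a)))    ≡⟨ ∑-cong 𝔽 (λ x → ∑-δ (x * x)) ⟩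
    ∑ 𝔽 (λ _ → + 1)                          ≡⟨ ∑-1 ⟩
    + p                                      ∎)
    where
    open ≡-Reasoning
    i+j≡i⇒j≡0 : ∀ i j → i + j ≡ i → j ≡ + 0
    i+j≡i⇒j≡0 i j e = trans (id′ i j) (trans (cong (_- i) e) (ℤₚ.+-inverseʳ i))
      where
      id′ : ∀ i j → j ≡ i + j - i
      id′ = solve-∀

  private
    χ-square-* : ∀ {a} s b → a ≉ + 0 → s * s ≈ a → χ (a * b) ≡ χ b
    χ-square-* {a} s b a≉0 ss≈a with χ b | χ-view b
    ... | _ | zero e       = χ-zero (*-zero a e)
    ... | _ | square t b≉0 tt≈b = χ-square (s * t) (*-≉0 a≉0 b≉0)
          (≈-trans (≡⇒≈ (id′ s t)) (*-cong ss≈a tt≈b))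
      where
      id′ : ∀ s t → s * t * (s * t) ≡ s * s * (t * t)
      id′ = solve-∀
    ... | _ | nonsquare b≉0 ns = χ-nonsquare (*-≉0 a≉0 b≉0) λ x xx≈ab → ns (inv s * x)
          (*-cancelˡ a≉0 (≈-trans (*-congʳ _ (≈-sym ss≈a)) (≈-trans (≡⇒≈ (id′ s (inv s) x))
            (≈-trans (*-congʳ (x * x) (*-cong s-inv s-inv)) (≈-trans (≡⇒≈ (ℤₚ.*-identityˡ (x * x))) xx≈ab)))))
      where
      s-inv : s * inv s ≈ + 1
      s-inv = *-inv {s} (λ e → a≉0 (≈-trans (≈-sym ss≈a) (zero-* {s} s e)))
      id′ : ∀ s i x → s * s * (i * x * (i * x)) ≡ s * i * (s * i) * (x * x)
      id′ = solve-∀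

    -- For a nonsquare b the summands of ∑ₐ (- χ (a b) - χ a) = 0 are nonnegative.
    χ-nonsquare-* : ∀ a b → b ≉ + 0 → (∀ x → x * x ≉ b) → χ (a * b) ≡ - χ a
    χ-nonsquare-* a b b≉0 ns = result (∑-nonneg-zero 𝔽 nonneg total (proj₁ (proj₂ (𝔽-complete a))))
      where
      h : ℤ → ℤ
      h a = - χ (b * a) + - χ a
      χb : χ b ≡ - (+ 1)
      χb = χ-nonsquare b≉0 ns
      nonneg : ∀ a → + 0 ℤ.≤ h a
      nonneg a with χ a | χ-view a
      ... | _ | zero e       = ℤₚ.≤-reflexive (sym (cong (λ z → - z + + 0) (χ-zero (*-zero b e))))
      ... | _ | square s a≉0 e = ℤₚ.≤-reflexive (sym (cong (λ z → - z + - (+ 1))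
            (trans (cong χ (ℤₚ.*-comm b a)) (trans (χ-square-* s b a≉0 e) χb))))
      -- Here - χ a is 1, so any value of χ (b a) will do. That a product of two nonsquares is a
      -- square comes out of the vanishing total.
      ... | _ | nonsquare _ _ with χ (b * a) | χ-view (b * a)
      ...   | _ | zero _        = ℤ.+≤+ ℕ.z≤n
      ...   | _ | square _ _ _  = ℤ.+≤+ ℕ.z≤n
      ...   | _ | nonsquare _ _ = ℤ.+≤+ ℕ.z≤n
      total : ∑ 𝔽 h ≡ + 0
      total = begin
        ∑ 𝔽 h                                             ≡⟨ ∑-+ 𝔽 (λ a → - χ (b * a)) (λ a → - χ a) ⟩
        ∑ 𝔽 (λ a → - χ (b * a)) + ∑ 𝔽 (λ a → - χ a)
          ≡⟨ cong (_+ ∑ 𝔽 (λ a → - χ a)) (∑-scale b b≉0 (λ a → - χ a) (λ e → cong -_ (χ-resp e))) ⟩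
        ∑ 𝔽 (λ a → - χ a) + ∑ 𝔽 (λ a → - χ a)
          ≡⟨ cong (λ z → z + z) (trans (∑-cong 𝔽 (λ a → sym (ℤₚ.-1*i≡-i (χ a)))) (∑-*ˡ 𝔽 (- (+ 1)) χ)) ⟩
        - (+ 1) * ∑ 𝔽 χ + - (+ 1) * ∑ 𝔽 χ                  ≡⟨ cong (λ z → - (+ 1) * z + - (+ 1) * z) ∑-χ ⟩
        + 0 ∎
        where open ≡-Reasoning
      solve′ : ∀ u v → - u + - v ≡ + 0 → u ≡ - v
      solve′ u v e = trans (id′ u v) (trans (cong (λ z → - z + - v) e) (ℤₚ.+-identityˡ (- v)))
        where
        id′ : ∀ u v → u ≡ - (- u + - v) + - v
        id′ = solve-∀
      a≈ : a ≈ proj₁ (𝔽-complete a)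
      a≈ = proj₂ (proj₂ (𝔽-complete a))
      result : h (proj₁ (𝔽-complete a)) ≡ + 0 → χ (a * b) ≡ - χ a
      result e = solve′ (χ (a * b)) (χ a) (trans
        (cong₂ (λ u v → - u + - v)
          (trans (cong χ (ℤₚ.*-comm a b)) (χ-resp (*-congˡ b a≈))) (χ-resp a≈)) e)

  χ-* : ∀ a b → χ (a * b) ≡ χ a * χ b
  χ-* a b with χ b | χ-view b
  ... | _ | zero e           = trans (χ-zero (*-zero a e)) (sym (ℤₚ.*-zeroʳ (χ a)))
  ... | _ | square t b≉0 e   =
    trans (cong χ (ℤₚ.*-comm a b)) (trans (χ-square-* t a b≉0 e) (sym (ℤₚ.*-identityʳ (χ a))))
  ... | _ | nonsquare b≉0 ns = trans (χ-nonsquare-* a b b≉0 ns) (id′ (χ a))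
    where
    id′ : ∀ z → - z ≡ z * - (+ 1)
    id′ = solve-∀

  χ-xx : ∀ {x} → x ≉ + 0 → χ (x * x) ≡ + 1
  χ-xx {x} x≉0 = χ-square x (*-≉0 x≉0 x≉0) ≈-refl

  χ²≡1 : ∀ {a} → a ≉ + 0 → χ a * χ a ≡ + 1
  χ²≡1 {a} a≉0 = trans (sym (χ-* a a)) (χ-xx a≉0)

  χ≡1⇒square : ∀ {a} → χ a ≡ + 1 → ∃ λ x → x * x ≈ a
  χ≡1⇒square {a} eq with χ a | χ-view a
  ... | _ | square x _ e = x , e

  χ-inv : ∀ a → χ (inv a) ≡ χ a
  χ-inv a with a ≈? + 0
  ... | yes e = trans (χ-zero (inv-≈0 e)) (sym (χ-zero e))
  ... | no ne = begin
      χ (inv a)                ≡⟨ sym (ℤₚ.*-identityˡ (χ (inv a))) ⟩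
      + 1 * χ (inv a)          ≡⟨ cong (_* χ (inv a)) (sym (χ²≡1 ne)) ⟩
      χ a * χ a * χ (inv a)    ≡⟨ ℤₚ.*-assoc (χ a) (χ a) (χ (inv a)) ⟩
      χ a * (χ a * χ (inv a))  ≡⟨ cong (χ a *_) (sym (χ-* a (inv a))) ⟩
      χ a * χ (a * inv a)      ≡⟨ cong (χ a *_) (trans (χ-resp (*-inv ne)) χ-1) ⟩
      χ a * + 1                ≡⟨ ℤₚ.*-identityʳ (χ a) ⟩
      χ a                      ∎
    where open ≡-Reasoning

  -- 1 + χ a is the number of square roots of a.
  ∑-squares : (f : ℤ → ℤ) → Respects f →
              ∑ 𝔽 (λ x → f (x * x)) ≡ ∑ 𝔽 f + ∑ 𝔽 (λ a → χ a * f a)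
  ∑-squares f resp = begin
    ∑ 𝔽 (λ x → f (x * x))
      ≡⟨ ∑-cong 𝔽 (λ x → sym (∑-dirac f resp (x * x))) ⟩
    ∑ 𝔽 (λ x → ∑ 𝔽 (λ a → δ (x * x - a) * f a))
      ≡⟨ ∑-swap 𝔽 𝔽 (λ x a → δ (x * x - a) * f a) ⟩
    ∑ 𝔽 (λ a → ∑ 𝔽 (λ x → δ (x * x - a) * f a))
      ≡⟨ ∑-cong 𝔽 (λ a → trans (∑-*ʳ 𝔽 (f a) (λ x → δ (x * x - a))) (trans
           (cong (_* f a) (count-roots a)) (id′ (χ a) (f a)))) ⟩
    ∑ 𝔽 (λ a → f a + χ a * f a)
      ≡⟨ ∑-+ 𝔽 f (λ a → χ a * f a) ⟩
    ∑ 𝔽 f + ∑ 𝔽 (λ a → χ a * f a) ∎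
    where
    open ≡-Reasoning
    id′ : ∀ c z → (+ 1 + c) * z ≡ z + c * z
    id′ = solve-∀

-- The values of χ at -1 and 2, from the points on the circle.

module SupplementaryLaws (p : ℕ) .{{_ : NonZero p}} (p-prime : Prime p)
                         (2≉0 : Congruence._≉_ p (+ 2) (+ 0)) where
  open Congruence p
  open PrimeField p p-prime 2≉0

  χ-±1 : ∀ {a} → a ≉ + 0 → χ a ≡ + 1 ⊎ χ a ≡ - (+ 1)
  χ-±1 {a} a≉0 with χ a | χ-view a
  ... | _ | zero e        = contradiction e a≉0
  ... | _ | square _ _ _  = inj₁ refl
  ... | _ | nonsquare _ _ = inj₂ refl

  ∑-reflect : (f : ℤ → ℤ) → Respects f → ∑ 𝔽 (λ t → f (+ 1 - t)) ≡ ∑ 𝔽 f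
  ∑-reflect f resp = trans
    (∑-cong 𝔽 (λ t → cong f (id′ t))) (∑-affine (- (+ 1)) (+ 1) (-‿≉0 1≉0) f resp)
    where
    id′ : ∀ t → + 1 - t ≡ - (+ 1) * t + + 1
    id′ = solve-∀

  -- k sums f over one member of each pair {t , 1 - t}, the one with the smaller residue.
  ∑-symmetric-even : (f : ℤ → ℤ) → Respects f → (∀ t → f (+ 1 - t) ≡ f t) →
                     (∀ t → t ≈ + 1 - t → f t ≡ + 0) → ∃ λ k → ∑ 𝔽 f ≡ + 2 * k
  ∑-symmetric-even f resp sym-f fixed = ∑ 𝔽 lower , (begin
    ∑ 𝔽 f                                      ≡⟨ ∑-cong 𝔽 split ⟩
    ∑ 𝔽 (λ t → lower t + lower (+ 1 - t))       ≡⟨ ∑-+ 𝔽 lower (λ t → lower (+ 1 - t)) ⟩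
    ∑ 𝔽 lower + ∑ 𝔽 (λ t → lower (+ 1 - t))
      ≡⟨ cong (ℤ._+_ (∑ 𝔽 lower)) (∑-reflect lower lower-resp) ⟩
    ∑ 𝔽 lower + ∑ 𝔽 lower                      ≡⟨ double (∑ 𝔽 lower) ⟩
    + 2 * ∑ 𝔽 lower                            ∎)
    where
    open ≡-Reasoning
    double : ∀ a → a + a ≡ + 2 * a
    double = solve-∀
    select : ∀ r s → ℤ → ℤ
    select r s z = if does (r ℕ.<? s) then z else + 0
    lower : ℤ → ℤ
    lower t = select (t %ℕ p) ((+ 1 - t) %ℕ p) (f t)
    lower-resp : Respects lower
    lower-resp {a} {b} e = trans
      (cong₂ (λ r s → select r s (f a)) (≈⇒%≡ e) (≈⇒%≡ {+ 1 - a} {+ 1 - b} (minus-cong {+ 1} ≈-refl e)))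
      (cong (select (b %ℕ p) ((+ 1 - b) %ℕ p)) (resp e))
    id′ : ∀ t → + 1 - (+ 1 - t) ≡ t
    id′ = solve-∀
    select-split : ∀ r s z → (r ≡ s → z ≡ + 0) → z ≡ select r s z + select s r z
    select-split r s z r≡s⇒z≡0 with r ℕ.<? s | s ℕ.<? r
    ... | yes r<s | yes s<r = contradiction s<r (ℕₚ.<-asym r<s)
    ... | yes r<s | no  s≮r = sym (trans
      (cong₂ choose (dec-true (r ℕ.<? s) r<s) (dec-false (s ℕ.<? r) s≮r)) (ℤₚ.+-identityʳ z))
      where
      choose : _ → _ → ℤ
      choose b c = (if b then z else + 0) + (if c then z else + 0)
    ... | no  r≮s | yes s<r = sym (trans
      (cong₂ choose (dec-false (r ℕ.<? s) r≮s) (dec-true (s ℕ.<? r) s<r)) (ℤₚ.+-identityˡ z))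
      where
      choose : _ → _ → ℤ
      choose b c = (if b then z else + 0) + (if c then z else + 0)
    ... | no  r≮s | no  s≮r = z≡ (r≡s⇒z≡0 (ℕₚ.≤-antisym (ℕₚ.≮⇒≥ s≮r) (ℕₚ.≮⇒≥ r≮s)))
      where
      if-0 : ∀ b → (if b then + 0 else + 0) ≡ + 0
      if-0 false = refl
      if-0 true  = refl
      z≡ : z ≡ + 0 → z ≡ select r s z + select s r z
      z≡ refl = sym (cong₂ _+_ (if-0 (does (r ℕ.<? s))) (if-0 (does (s ℕ.<? r))))
    split : ∀ t → f t ≡ lower t + lower (+ 1 - t)
    split t = trans
      (select-split (t %ℕ p) ((+ 1 - t) %ℕ p) (f t) (λ e → fixed t (%≡⇒≈ e)))
      (cong (ℤ._+_ (lower t)) (cong₂ (λ u z → select ((+ 1 - t) %ℕ p) (u %ℕ p) z) (sym (id′ t)) (sym (sym-f t))))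

  ∑-χ-shift : ∀ b → ∑ 𝔽 (λ t → χ (t - b)) ≡ + 0
  ∑-χ-shift b = trans
    (trans (∑-cong 𝔽 (λ t → cong χ (id′ t b))) (∑-affine (+ 1) (- b) 1≉0 χ χ-resp)) ∑-χ
    where
    id′ : ∀ t b → t - b ≡ + 1 * t + - b
    id′ = solve-∀

  -- On t ≠ 0 the summand equals χ (1 / t - 1).
  ∑-χχ : ∑ 𝔽 (λ t → χ t * χ (+ 1 - t)) ≡ - χ (- (+ 1))
  ∑-χχ = begin
    ∑ 𝔽 (λ t → χ t * χ (+ 1 - t))
      ≡⟨ ∑-cong 𝔽 substitute ⟩
    ∑ 𝔽 (λ t → χ (inv t - + 1) + δ (+ 0 - t) * - χ (- (+ 1)))
      ≡⟨ ∑-+ 𝔽 (λ t → χ (inv t - + 1)) (λ t → δ (+ 0 - t) * - χ (- (+ 1))) ⟩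
    ∑ 𝔽 (λ t → χ (inv t - + 1)) + ∑ 𝔽 (λ t → δ (+ 0 - t) * - χ (- (+ 1)))
      ≡⟨ cong₂ _+_
           (trans (∑-inv (λ t → χ (t - + 1)) (λ e → χ-resp (minus-cong e (≈-refl {+ 1})))) (∑-χ-shift (+ 1)))
           (∑-dirac (λ _ → - χ (- (+ 1))) (λ _ → refl) (+ 0)) ⟩
    + 0 + - χ (- (+ 1))
      ≡⟨ ℤₚ.+-identityˡ _ ⟩
    - χ (- (+ 1)) ∎
    where
    open ≡-Reasoning
    id₀ : ∀ z → z + + 1 * - z ≡ + 0
    id₀ = solve-∀
    id₁ : ∀ i t → i * (+ 1 - t) - (i - + 1) ≡ - (+ 1) * (t * i - + 1)
    id₁ = solve-∀
    id₂ : ∀ t → t - + 0 ≡ - (+ 1) * (+ 0 - t - + 0)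
    id₂ = solve-∀
    id₃ : ∀ z w → z ≡ z + + 0 * w
    id₃ = solve-∀
    substitute : ∀ t → χ t * χ (+ 1 - t) ≡ χ (inv t - + 1) + δ (+ 0 - t) * - χ (- (+ 1))
    substitute t with t ≈? + 0
    -- As `inv` sends 0 to 0, the first term on the right is χ (-1) at t = 0, and the δ term is
    -- there to cancel it.
    ... | yes e = trans (cong (_* χ (+ 1 - t)) (χ-zero e)) (sym (trans
      (cong₂ (λ u v → u + v * - χ (- (+ 1)))
        (χ-resp (minus-cong (inv-≈0 e) (≈-refl {+ 1}))) (δ-0 (minus-cong {+ 0} ≈-refl e)))
      (id₀ (χ (- (+ 1))))))
    ... | no ne = begin
      χ t * χ (+ 1 - t)         ≡⟨ cong (_* χ (+ 1 - t)) (sym (χ-inv t)) ⟩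
      χ (inv t) * χ (+ 1 - t)   ≡⟨ sym (χ-* (inv t) (+ 1 - t)) ⟩
      χ (inv t * (+ 1 - t))     ≡⟨ χ-resp (from-≈ (- (+ 1)) (*-inv ne) (id₁ (inv t) t)) ⟩
      χ (inv t - + 1)           ≡⟨ id₃ (χ (inv t - + 1)) (- χ (- (+ 1))) ⟩
      χ (inv t - + 1) + + 0 * - χ (- (+ 1))
        ≡⟨ cong (λ d → χ (inv t - + 1) + d * - χ (- (+ 1)))
             (sym (δ-≉0 (λ e → ne (from-≈ (- (+ 1)) e (id₂ t))))) ⟩
      χ (inv t - + 1) + δ (+ 0 - t) * - χ (- (+ 1)) ∎

  private
    half : ℤ
    half = inv (+ 2)

    2half≈1 : + 2 * half ≈ + 1
    2half≈1 = *-inv 2≉0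

    both : ℤ → ℤ → ℤ
    both (+ 1) (+ 1) = + 1
    both _     _     = + 0

    both-comm : ∀ {a b u v} → QuadraticCharacter a u → QuadraticCharacter b v → both u v ≡ both v u
    both-comm (zero _)        (zero _)        = refl
    both-comm (zero _)        (square _ _ _)  = refl
    both-comm (zero _)        (nonsquare _ _) = refl
    both-comm (square _ _ _)  (zero _)        = refl
    both-comm (square _ _ _)  (square _ _ _)  = refl
    both-comm (square _ _ _)  (nonsquare _ _) = refl
    both-comm (nonsquare _ _) (zero _)        = refl
    both-comm (nonsquare _ _) (square _ _ _)  = refl
    both-comm (nonsquare _ _) (nonsquare _ _) = refl

    -- The number of points over t = 1/2, where t and 1 - t coincide and have character χ (1/2) = χ
    -- 2.
    c₂ : ℤ
    c₂ = (+ 1 + χ (+ 2)) * (+ 1 + χ (+ 2))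

    -- Indicator of the t ≠ 1/2 for which t and 1 - t are both nonzero squares. Four points of the
    -- circle lie over each such t, and t ↦ 1 - t pairs these t without a fixed point, so together
    -- they contribute a multiple of 8.
    generic : ℤ → ℤ
    generic t = both (χ t) (χ (+ 1 - t)) * (+ 1 - δ (half - t))

    generic-resp : Respects generic
    generic-resp {a} {b} e = cong₂ _*_
      (cong₂ both (χ-resp e) (χ-resp (minus-cong {+ 1} ≈-refl e)))
      (cong (_-_ (+ 1)) (δ-resp (minus-cong {half} ≈-refl e)))

    1-t≈t⇒half : ∀ t → + 1 - t ≈ t → half - t ≈ + 0
    1-t≈t⇒half t e = *-cancelˡ-0 2≉0 (from-≈₂ (+ 1) (+ 1) 2half≈1 e (id′ half t))
      where
      id′ : ∀ h t → + 2 * (h - t) - + 0 ≡ + 1 * (+ 2 * h - + 1) + + 1 * (+ 1 - t - t)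
      id′ = solve-∀

    half-reflect : ∀ t → half - t ≈ + 0 → half - (+ 1 - t) ≈ + 0
    half-reflect t e = from-≈₂ (+ 1) (- (+ 1)) 2half≈1 e (id′ half t)
      where
      id′ : ∀ h t → h - (+ 1 - t) - + 0 ≡ + 1 * (+ 2 * h - + 1) + - (+ 1) * (h - t - + 0)
      id′ = solve-∀

    1-1-t : ∀ t → + 1 - (+ 1 - t) ≡ t
    1-1-t = solve-∀

    generic-even : ∃ λ k → ∑ 𝔽 generic ≡ + 2 * k
    generic-even = ∑-symmetric-even generic generic-resp symmetric fixed
      where
      symmetric : ∀ t → generic (+ 1 - t) ≡ generic t
      symmetric t = cong₂ _*_
        (trans (cong (λ u → both (χ (+ 1 - t)) (χ u)) (1-1-t t)) (both-comm (χ-view (+ 1 - t)) (χ-view t)))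
        (cong (_-_ (+ 1)) (δ-⇔
          (λ e → subst (λ u → half - u ≈ + 0) (1-1-t t) (half-reflect (+ 1 - t) e))
          (half-reflect t)))
      fixed : ∀ t → t ≈ + 1 - t → generic t ≡ + 0
      fixed t e = trans
        (cong (λ d → both (χ t) (χ (+ 1 - t)) * (+ 1 - d)) (δ-0 (1-t≈t⇒half t (≈-sym e))))
        (ℤₚ.*-zeroʳ (both (χ t) (χ (+ 1 - t))))

    -- The number of solutions of x² = t , y² = 1 - t.
    points : ℤ → ℤ
    points t = (+ 1 + χ t) * (+ 1 + χ (+ 1 - t))

    special : ℤ → ℤ
    special t = δ (+ 0 - t) * + 2 + δ (+ 1 - t) * + 2 + δ (half - t) * c₂

    0-t≉0 : ∀ {t} → t ≉ + 0 → δ (+ 0 - t) ≡ + 0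
    0-t≉0 {t} t≉0 = δ-≉0 (λ e → t≉0 (≈-sym (a-b≈0⇒a≈b {+ 0} {t} e)))

    -- Once the deltas and characters are replaced by numerals, the claim of `points-split` is
    -- decided by computation in every case except t = 1/2, where χ 2 remains unknown.
    evaluate : ∀ {t d₀ d₁ dₕ u v} → δ (+ 0 - t) ≡ d₀ → δ (+ 1 - t) ≡ d₁ → δ (half - t) ≡ dₕ →
               χ t ≡ u → χ (+ 1 - t) ≡ v →
               (+ 1 + u) * (+ 1 + v) ≡ d₀ * + 2 + d₁ * + 2 + dₕ * c₂ + + 4 * (both u v * (+ 1 - dₕ)) →
               points t ≡ special t + + 4 * generic t
    evaluate refl refl refl refl refl e = e

    points-split : ∀ t → points t ≡ special t + + 4 * generic t
    points-split t with half - t ≈? + 0 | t ≈? + 0 | + 1 - t ≈? + 0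
    ... | yes h | yes e | _     = contradiction (≈-trans (a-b≈0⇒a≈b h) e) (inv-≉0 2≉0)
    ... | yes h | no _  | yes e = contradiction (≈-trans (a-b≈0⇒a≈b (half-reflect t h)) e) (inv-≉0 2≉0)
    ... | yes h | no e  | no e′ = evaluate (0-t≉0 e) (δ-≉0 e′) (δ-0 h)
        (trans (χ-resp (≈-sym (a-b≈0⇒a≈b h))) (χ-inv (+ 2)))
        (trans (χ-resp (≈-sym (a-b≈0⇒a≈b (half-reflect t h)))) (χ-inv (+ 2)))
        (id′ c₂ (both (χ (+ 2)) (χ (+ 2))))
      where
      id′ : ∀ c b → c ≡ + 0 * + 2 + + 0 * + 2 + + 1 * c + + 4 * (b * (+ 1 - + 1))
      id′ = solve-∀
    ... | no h  | yes e | yes e′ = contradiction (from-≈₂ (+ 1) (+ 1) e e′ (id′ t)) 1≉0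
      where
      id′ : ∀ t → + 1 - + 0 ≡ + 1 * (t - + 0) + + 1 * (+ 1 - t - + 0)
      id′ = solve-∀
    ... | no h  | yes e | no e′ = evaluate (δ-0 (minus-cong {+ 0} ≈-refl e)) (δ-≉0 e′) (δ-≉0 h)
        (χ-zero e) (trans (χ-resp (minus-cong {+ 1} ≈-refl e)) χ-1) refl
    ... | no h  | no e  | yes e′ = evaluate (0-t≉0 e) (δ-0 e′) (δ-≉0 h)
        (trans (χ-resp (≈-sym (a-b≈0⇒a≈b {+ 1} {t} e′))) χ-1) (χ-zero e′) refl
    ... | no h  | no e  | no e′ with χ-±1 e | χ-±1 e′
    ...   | inj₁ u | inj₁ v = evaluate (0-t≉0 e) (δ-≉0 e′) (δ-≉0 h) u v refl
    ...   | inj₁ u | inj₂ v = evaluate (0-t≉0 e) (δ-≉0 e′) (δ-≉0 h) u v refl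
    ...   | inj₂ u | inj₁ v = evaluate (0-t≉0 e) (δ-≉0 e′) (δ-≉0 h) u v refl
    ...   | inj₂ u | inj₂ v = evaluate (0-t≉0 e) (δ-≉0 e′) (δ-≉0 h) u v refl

    points-total : ∑ 𝔽 points ≡ + p - χ (- (+ 1))
    points-total = begin
      ∑ 𝔽 points
        ≡⟨ ∑-cong 𝔽 (λ t → expand (χ t) (χ (+ 1 - t))) ⟩
      ∑ 𝔽 (λ t → (+ 1 + χ t) + (χ (+ 1 - t) + χ t * χ (+ 1 - t)))
        ≡⟨ ∑-+ 𝔽 (λ t → + 1 + χ t) (λ t → χ (+ 1 - t) + χ t * χ (+ 1 - t)) ⟩
      ∑ 𝔽 (λ t → + 1 + χ t) + ∑ 𝔽 (λ t → χ (+ 1 - t) + χ t * χ (+ 1 - t))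
        ≡⟨ cong₂ _+_ (∑-+ 𝔽 (λ _ → + 1) χ) (∑-+ 𝔽 (λ t → χ (+ 1 - t)) (λ t → χ t * χ (+ 1 - t))) ⟩
      (∑ 𝔽 (λ _ → + 1) + ∑ 𝔽 χ) + (∑ 𝔽 (λ t → χ (+ 1 - t)) + ∑ 𝔽 (λ t → χ t * χ (+ 1 - t)))
        ≡⟨ cong₂ _+_ (cong₂ _+_ ∑-1 ∑-χ) (cong₂ _+_ (trans (∑-reflect χ χ-resp) ∑-χ) ∑-χχ) ⟩
      (+ p + + 0) + (+ 0 + - χ (- (+ 1)))
        ≡⟨ cong₂ _+_ (ℤₚ.+-identityʳ (+ p)) (ℤₚ.+-identityˡ (- χ (- (+ 1)))) ⟩
      + p - χ (- (+ 1)) ∎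
      where
      open ≡-Reasoning
      expand : ∀ u v → (+ 1 + u) * (+ 1 + v) ≡ (+ 1 + u) + (v + u * v)
      expand = solve-∀

  -- Sign changes and the exchange of x and y move the points of x² + y² = 1 in orbits of eight. The
  -- exceptions are the four points on the axes and those on the diagonals x = ± y, where x² = 1/2;
  -- the latter number (1 + χ 2)².
  circle-count : ∃ λ k → + p - χ (- (+ 1)) ≡ + 4 + (+ 1 + χ (+ 2)) * (+ 1 + χ (+ 2)) + + 8 * k
  circle-count = let (k , e) = generic-even in k , (begin
    + p - χ (- (+ 1))
      ≡⟨ sym points-total ⟩
    ∑ 𝔽 points
      ≡⟨ trans (∑-cong 𝔽 points-split) (∑-+ 𝔽 special (λ t → + 4 * generic t)) ⟩
    ∑ 𝔽 special + ∑ 𝔽 (λ t → + 4 * generic t)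
      ≡⟨ cong₂ _+_ special-total (trans (∑-*ˡ 𝔽 (+ 4) generic) (cong (+ 4 *_) e)) ⟩
    + 4 + c₂ + + 4 * (+ 2 * k)
      ≡⟨ cong (ℤ._+_ (+ 4 + c₂)) (sym (ℤₚ.*-assoc (+ 4) (+ 2) k)) ⟩
    + 4 + c₂ + + 8 * k ∎)
    where
    open ≡-Reasoning
    weight : ∀ a k → ∑ 𝔽 (λ t → δ (a - t) * k) ≡ k
    weight a k = ∑-dirac (λ _ → k) (λ _ → refl) a
    special-total : ∑ 𝔽 special ≡ + 4 + c₂
    special-total = trans
      (∑-+ 𝔽 (λ t → δ (+ 0 - t) * + 2 + δ (+ 1 - t) * + 2) (λ t → δ (half - t) * c₂))
      (cong₂ _+_ (trans (∑-+ 𝔽 (λ t → δ (+ 0 - t) * + 2) (λ t → δ (+ 1 - t) * + 2))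
        (cong₂ _+_ (weight (+ 0) (+ 2)) (weight (+ 1) (+ 2)))) (weight half c₂))

  private
    p≡r+8q : ∀ {r} → p ℕ.% 8 ≡ r → + p ≡ + r + + (p ℕ./ 8) * + 8
    p≡r+8q {r} eq = trans (cong +_ (trans (ℕ.m≡m%n+[m/n]*n p 8) (cong (ℕ._+ p ℕ./ 8 ℕ.* 8) eq)))
      (trans (ℤₚ.pos-+ r (p ℕ./ 8 ℕ.* 8)) (cong (ℤ._+_ (+ r)) (ℤₚ.pos-* (p ℕ./ 8) 8)))

    residue : ∀ {r} → p ℕ.% 8 ≡ r → ∀ {u v} → χ (- (+ 1)) ≡ u → χ (+ 2) ≡ v →
              ∃ λ k → + r - u - (+ 4 + (+ 1 + v) * (+ 1 + v)) ≡ + 8 * k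
    residue {r} eq refl refl = let (k , e) = circle-count in k - + (p ℕ./ 8) ,
      rearrange (+ r) (+ (p ℕ./ 8)) (χ (- (+ 1))) (+ 4 + (+ 1 + χ (+ 2)) * (+ 1 + χ (+ 2))) k
        (trans (cong (_- χ (- (+ 1))) (sym (p≡r+8q eq))) e)
      where
      id₁ : ∀ r q u c → r - u - c ≡ (r + q * + 8 - u) - c - q * + 8
      id₁ = solve-∀
      id₂ : ∀ q c k → (c + + 8 * k) - c - q * + 8 ≡ + 8 * (k - q)
      id₂ = solve-∀
      rearrange : ∀ r q u c k → r + q * + 8 - u ≡ c + + 8 * k → r - u - c ≡ + 8 * (k - q)
      rearrange r q u c k e = trans (id₁ r q u c) (trans (cong (λ z → z - c - q * + 8) e) (id₂ q c k))

    -c≡8k⇒8∣c : ∀ c k → - (+ c) ≡ + 8 * k → 8 ∣.∣ c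
    -c≡8k⇒8∣c c k e = ∣.divides ℤ.∣ k ∣ (trans (sym (ℤₚ.∣-i∣≡∣i∣ (+ c)))
      (trans (cong ℤ.∣_∣ e) (trans (ℤₚ.abs-* (+ 8) k) (ℕₚ.*-comm 8 ℤ.∣ k ∣))))

    -1≉0 : - (+ 1) ≉ + 0
    -1≉0 = -‿≉0 1≉0

  -- Each of the three wrong pairs of signs leaves a defect of 2, 4 or 6 modulo 8 in the circle
  -- count.
  p≡1[8]⇒χ : p ℕ.% 8 ≡ 1 → χ (- (+ 1)) ≡ + 1 × χ (+ 2) ≡ + 1
  p≡1[8]⇒χ eq with χ-±1 -1≉0 | χ-±1 2≉0
  ... | inj₁ u | inj₁ v = u , v
  ... | inj₁ u | inj₂ v = let (k , e) = residue eq u v in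
    contradiction (-c≡8k⇒8∣c 4 k e) (from-no (8 ∣.∣? 4))
  ... | inj₂ u | inj₁ v = let (k , e) = residue eq u v in
    contradiction (-c≡8k⇒8∣c 6 k e) (from-no (8 ∣.∣? 6))
  ... | inj₂ u | inj₂ v = let (k , e) = residue eq u v in
    contradiction (-c≡8k⇒8∣c 2 k e) (from-no (8 ∣.∣? 2))

  p≡3[8]⇒χ : p ℕ.% 8 ≡ 3 → χ (- (+ 1)) ≡ - (+ 1) × χ (+ 2) ≡ - (+ 1)
  p≡3[8]⇒χ eq with χ-±1 -1≉0 | χ-±1 2≉0
  ... | inj₂ u | inj₂ v = u , v
  ... | inj₁ u | inj₁ v = let (k , e) = residue eq u v in
    contradiction (-c≡8k⇒8∣c 6 k e) (from-no (8 ∣.∣? 6))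
  ... | inj₁ u | inj₂ v = let (k , e) = residue eq u v in
    contradiction (-c≡8k⇒8∣c 2 k e) (from-no (8 ∣.∣? 2))
  ... | inj₂ u | inj₁ v = let (k , e) = residue eq u v in
    contradiction (-c≡8k⇒8∣c 4 k e) (from-no (8 ∣.∣? 4))

-- Algebra of the Gaussian integers.

-- A pair (a , b) stands for a + b i with i² = -1; modulo p this ring splits when -1 is a square.
infixl 7 _⊗_
infixr 8 _·_

Re Im : ℤ × ℤ → ℤ
Re = proj₁
Im = proj₂

opaque

  _⊗_ : ℤ × ℤ → ℤ × ℤ → ℤ × ℤ
  (a , b) ⊗ (c , d) = a * c - b * d , a * d + b * c

  _·_ : ℤ → ℤ × ℤ → ℤ × ℤ
  k · (a , b) = k * a , k * b

  conj : ℤ × ℤ → ℤ × ℤ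
  conj (a , b) = a , - b

  N : ℤ × ℤ → ℤ
  N (a , b) = a * a + b * b

  fourth : ℤ × ℤ → ℤ × ℤ
  fourth w = w ⊗ w ⊗ (w ⊗ w)

  1ᴳ : ℤ × ℤ
  1ᴳ = + 1 , + 0

  ⊗-comm : ∀ z w → z ⊗ w ≡ w ⊗ z
  ⊗-comm (a , b) (c , d) = cong₂ _,_ (re a b c d) (im a b c d)
    where
    re : ∀ a b c d → a * c - b * d ≡ c * a - d * b
    re = solve-∀
    im : ∀ a b c d → a * d + b * c ≡ c * b + d * a
    im = solve-∀

  ⊗-assoc : ∀ z w v → z ⊗ w ⊗ v ≡ z ⊗ (w ⊗ v)
  ⊗-assoc (a , b) (c , d) (e , f) = cong₂ _,_ (re a b c d e f) (im a b c d e f)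
    where
    re : ∀ a b c d e f → (a * c - b * d) * e - (a * d + b * c) * f ≡ a * (c * e - d * f) - b * (c * f + d * e)
    re = solve-∀
    im : ∀ a b c d e f → (a * c - b * d) * f + (a * d + b * c) * e ≡ a * (c * f + d * e) + b * (c * e - d * f)
    im = solve-∀

  ⊗-identityʳ : ∀ z → z ⊗ 1ᴳ ≡ z
  ⊗-identityʳ (a , b) = cong₂ _,_ (re a b) (im a b)
    where
    re : ∀ a b → a * + 1 - b * + 0 ≡ a
    re = solve-∀
    im : ∀ a b → a * + 0 + b * + 1 ≡ b
    im = solve-∀

  ⊗-identityˡ : ∀ z → 1ᴳ ⊗ z ≡ z
  ⊗-identityˡ z = trans (⊗-comm 1ᴳ z) (⊗-identityʳ z)

  ⊗-interchange : ∀ z w u v → (z ⊗ w) ⊗ (u ⊗ v) ≡ (z ⊗ u) ⊗ (w ⊗ v)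
  ⊗-interchange z w u v = trans (⊗-assoc z w (u ⊗ v)) (trans
    (cong (z ⊗_) (trans (sym (⊗-assoc w u v)) (trans (cong (_⊗ v) (⊗-comm w u)) (⊗-assoc u w v))))
    (sym (⊗-assoc z u (w ⊗ v))))

  fourth-⊗ : ∀ z w → fourth (z ⊗ w) ≡ fourth z ⊗ fourth w
  fourth-⊗ z w = trans (cong₂ _⊗_ (⊗-interchange z w z w) (⊗-interchange z w z w))
    (⊗-interchange (z ⊗ z) (w ⊗ w) (z ⊗ z) (w ⊗ w))

  N-⊗ : ∀ z w → N (z ⊗ w) ≡ N z * N w
  N-⊗ (a , b) (c , d) = id′ a b c d
    where
    id′ : ∀ a b c d → (a * c - b * d) * (a * c - b * d) + (a * d + b * c) * (a * d + b * c)
                    ≡ (a * a + b * b) * (c * c + d * d)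
    id′ = solve-∀

  N-conj : ∀ z → N (conj z) ≡ N z
  N-conj (a , b) = id′ a b
    where
    id′ : ∀ a b → a * a + - b * - b ≡ a * a + b * b
    id′ = solve-∀

  conj-⊗ : ∀ z w → conj (z ⊗ w) ≡ conj z ⊗ conj w
  conj-⊗ (a , b) (c , d) = cong₂ _,_ (re a b c d) (im a b c d)
    where
    re : ∀ a b c d → a * c - b * d ≡ a * c - - b * - d
    re = solve-∀
    im : ∀ a b c d → - (a * d + b * c) ≡ a * - d + - b * c
    im = solve-∀

  conj-fourth : ∀ w → conj (fourth w) ≡ fourth (conj w)
  conj-fourth w = trans (conj-⊗ (w ⊗ w) (w ⊗ w)) (cong₂ _⊗_ (conj-⊗ w w) (conj-⊗ w w))

  ⊗-conj : ∀ z → z ⊗ conj z ≡ (N z , + 0)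
  ⊗-conj (a , b) = cong₂ _,_ (re a b) (im a b)
    where
    re : ∀ a b → a * a - b * - b ≡ a * a + b * b
    re = solve-∀
    im : ∀ a b → a * - b + b * a ≡ + 0
    im = solve-∀

  ·-⊗ : ∀ k z w → (k · z) ⊗ w ≡ k · (z ⊗ w)
  ·-⊗ k (a , b) (c , d) = cong₂ _,_ (re k a b c d) (im k a b c d)
    where
    re : ∀ k a b c d → k * a * c - k * b * d ≡ k * (a * c - b * d)
    re = solve-∀
    im : ∀ k a b c d → k * a * d + k * b * c ≡ k * (a * d + b * c)
    im = solve-∀

  ⊗-· : ∀ k z w → z ⊗ (k · w) ≡ k · (z ⊗ w)
  ⊗-· k z w = trans (⊗-comm z (k · w)) (trans (·-⊗ k w z) (cong (k ·_) (⊗-comm w z)))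

  ·-· : ∀ k l z → k · (l · z) ≡ (k * l) · z
  ·-· k l (a , b) = cong₂ _,_ (sym (ℤₚ.*-assoc k l a)) (sym (ℤₚ.*-assoc k l b))

  scalar≡· : ∀ k → (k , + 0) ≡ k · 1ᴳ
  scalar≡· k = cong₂ _,_ (sym (ℤₚ.*-identityʳ k)) (sym (ℤₚ.*-zeroʳ k))

  conj-involutive : ∀ z → conj (conj z) ≡ z
  conj-involutive (a , b) = cong (a ,_) (ℤₚ.neg-involutive b)

  ·-identity : ∀ z → (+ 1) · z ≡ z
  ·-identity (a , b) = cong₂ _,_ (ℤₚ.*-identityˡ a) (ℤₚ.*-identityˡ b)

  Re-⊗ : ∀ z w → Re (z ⊗ w) ≡ Re z * Re w - Im z * Im w
  Re-⊗ z w = refl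

  ·-def : ∀ k a b → k · (a , b) ≡ (k * a , k * b)
  ·-def k a b = refl

  N-def : ∀ a b → N (a , b) ≡ a * a + b * b
  N-def a b = refl

  1ᴳ-def : 1ᴳ ≡ (+ 1 , + 0)
  1ᴳ-def = refl

  0≡0· : ∀ z → (+ 0 , + 0) ≡ (+ 0) · z
  0≡0· z = refl

  fourth-def : ∀ z → fourth z ≡ z ⊗ z ⊗ (z ⊗ z)
  fourth-def z = refl

  Re-conj : ∀ z → Re (conj z) ≡ Re z
  Re-conj z = refl

  Re-· : ∀ k z → Re (k · z) ≡ k * Re z
  Re-· k z = refl

-- The Gaussian integers modulo p, the sums Ψ and their squares F.

module GaussianPlane (p : ℕ) .{{_ : NonZero p}} (p-prime : Prime p)
                     (2≉0 : Congruence._≉_ p (+ 2) (+ 0)) where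
  open Congruence p
  open PrimeField p p-prime 2≉0

  plane : Finite (ℤ × ℤ)
  plane = product finite finite

  ℙ : List (ℤ × ℤ)
  ℙ = Finite.elements plane

  infix 4 _≋_
  record _≋_ (z w : ℤ × ℤ) : Set where
    constructor _∥_
    field
      re≈ : Re z ≈ Re w
      im≈ : Im z ≈ Im w
  open _≋_

  Respects² : (ℤ × ℤ → ℤ) → Set
  Respects² f = ∀ {z w} → z ≋ w → f z ≡ f w

  ≋-refl : ∀ {z} → z ≋ z
  ≋-refl = ≈-refl ∥ ≈-refl

  ≡⇒≋ : ∀ {z w} → z ≡ w → z ≋ w
  ≡⇒≋ refl = ≋-refl

  ≋-sym : ∀ {z w} → z ≋ w → w ≋ z
  ≋-sym (e ∥ f) = ≈-sym e ∥ ≈-sym f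

  ≋-trans : ∀ {z w v} → z ≋ w → w ≋ v → z ≋ v
  ≋-trans (e ∥ f) (e′ ∥ f′) = ≈-trans e e′ ∥ ≈-trans f f′

  opaque
    unfolding _⊗_ _·_ conj N fourth

    ⊗-cong : ∀ {z z′ w w′} → z ≋ z′ → w ≋ w′ → z ⊗ w ≋ z′ ⊗ w′
    ⊗-cong (a ∥ b) (c ∥ d) = minus-cong (*-cong a c) (*-cong b d) ∥ +-cong (*-cong a d) (*-cong b c)

    ·-cong : ∀ {k l z w} → k ≈ l → z ≋ w → k · z ≋ l · w
    ·-cong e (f ∥ g) = *-cong e f ∥ *-cong e g

    conj-cong : ∀ {z w} → z ≋ w → conj z ≋ conj w
    conj-cong (e ∥ f) = e ∥ -‿cong f

    N-cong : ∀ {z w} → z ≋ w → N z ≈ N w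
    N-cong (e ∥ f) = +-cong (*-cong e e) (*-cong f f)

    fourth-cong : ∀ {z w} → z ≋ w → fourth z ≋ fourth w
    fourth-cong e = ⊗-cong (⊗-cong e e) (⊗-cong e e)

  ⊗-congˡ : ∀ z {w w′} → w ≋ w′ → z ⊗ w ≋ z ⊗ w′
  ⊗-congˡ z = ⊗-cong (≋-refl {z})

  ⊗-congʳ : ∀ w {z z′} → z ≋ z′ → z ⊗ w ≋ z′ ⊗ w
  ⊗-congʳ w e = ⊗-cong e (≋-refl {w})

  ·-congˡ : ∀ k {z w} → z ≋ w → k · z ≋ k · w
  ·-congˡ k = ·-cong (≈-refl {k})

  private
    κ : ℤ × ℤ → ℤ × ℤ → ℤ
    κ = Finite.kernel plane

    κ-≋ : ∀ {z w} → z ≋ w → κ z w ≡ + 1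
    κ-≋ (e ∥ f) = cong₂ _*_ (δ-0 (a≈b⇒a-b≈0 e)) (δ-0 (a≈b⇒a-b≈0 f))

    κ-≢ : ∀ {z w} → ¬ (z ≋ w) → κ z w ≡ + 0
    κ-≢ {z} {w} ne with Re z - Re w ≈? + 0
    ... | yes e = trans (cong (δ (Re z - Re w) *_) (δ-≉0 (λ f → ne (a-b≈0⇒a≈b e ∥ a-b≈0⇒a≈b f))))
                    (ℤₚ.*-zeroʳ (δ (Re z - Re w)))
    ... | no e  = cong (_* δ (Im z - Im w)) (δ-≉0 e)

    _≋?_ : ∀ z w → Dec (z ≋ w)
    z ≋? w with Re z ≈? Re w | Im z ≈? Im w
    ... | yes e | yes f = yes (e ∥ f)
    ... | no ne | _     = no (ne ∘ re≈)
    ... | yes _ | no ne = no (ne ∘ im≈)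

    κ-⇔ : ∀ {z w z′ w′} → (z ≋ w → z′ ≋ w′) → (z′ ≋ w′ → z ≋ w) → κ z w ≡ κ z′ w′
    κ-⇔ {z} {w} to from with z ≋? w
    ... | yes e = trans (κ-≋ e) (sym (κ-≋ (to e)))
    ... | no ne = trans (κ-≢ ne) (sym (κ-≢ (ne ∘ from)))

  ∑-bijection : (σ τ : ℤ × ℤ → ℤ × ℤ) →
                (∀ {z w} → z ≋ w → σ z ≋ σ w) → (∀ {z w} → z ≋ w → τ z ≋ τ w) →
                (∀ z → σ (τ z) ≋ z) → (∀ z → τ (σ z) ≋ z) →
                (f : ℤ × ℤ → ℤ) → Respects² f → ∑ ℙ (λ z → f (σ z)) ≡ ∑ ℙ f
  ∑-bijection σ τ σ-cong τ-cong στ τσ f resp = ∑-reindex plane plane σ τ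
    (λ z w → κ-⇔
      (λ e → ≋-trans (τ-cong (≋-sym e)) (τσ z))
      (λ e → ≋-trans (σ-cong (≋-sym e)) (στ w)))
    f (λ (e , e′) → resp (e ∥ e′))

  ∑-plane : (f : ℤ × ℤ → ℤ) → ∑ ℙ f ≡ ∑ 𝔽 (λ x → ∑ 𝔽 (λ y → f (x , y)))
  ∑-plane = ∑-× 𝔽 𝔽

  infixl 9 _⁻¹
  _⁻¹ : ℤ × ℤ → ℤ × ℤ
  u ⁻¹ = inv (N u) · conj u

  ⊗-inverse : ∀ {u} → N u ≉ + 0 → u ⊗ u ⁻¹ ≋ 1ᴳ
  ⊗-inverse {u} Nu≉0 = ≋-trans
    (≡⇒≋ (trans (⊗-· (inv (N u)) u (conj u)) (cong (inv (N u) ·_) (⊗-conj u))))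
    (≋-trans (≡⇒≋ (cong (inv (N u) ·_) (scalar≡· (N u)))) (≋-trans (≡⇒≋ (·-· (inv (N u)) (N u) 1ᴳ))
      (≋-trans (·-cong (≈-trans (≡⇒≈ (ℤₚ.*-comm (inv (N u)) (N u))) (*-inv Nu≉0)) (≋-refl {1ᴳ}))
        (≡⇒≋ (·-identity 1ᴳ)))))

  ∑-⊗ : ∀ u → N u ≉ + 0 → (f : ℤ × ℤ → ℤ) → Respects² f → ∑ ℙ (λ z → f (u ⊗ z)) ≡ ∑ ℙ f
  ∑-⊗ u Nu≉0 = ∑-bijection (u ⊗_) (u ⁻¹ ⊗_) (⊗-congˡ u) (⊗-congˡ (u ⁻¹))
    (λ z → cancel u (u ⁻¹) (⊗-inverse {u} Nu≉0))
    (λ z → cancel (u ⁻¹) u (≋-trans (≡⇒≋ (⊗-comm (u ⁻¹) u)) (⊗-inverse {u} Nu≉0)))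
    where
    cancel : ∀ u v {z} → u ⊗ v ≋ 1ᴳ → u ⊗ (v ⊗ z) ≋ z
    cancel u v {z} e = ≋-trans (≡⇒≋ (sym (⊗-assoc u v z)))
      (≋-trans (⊗-congʳ z e) (≡⇒≋ (⊗-identityˡ z)))

  ∑-conj : (f : ℤ × ℤ → ℤ) → Respects² f → ∑ ℙ (λ z → f (conj z)) ≡ ∑ ℙ f
  ∑-conj = ∑-bijection conj conj conj-cong conj-cong conj-conj conj-conj
    where
    conj-conj : ∀ z → conj (conj z) ≋ z
    conj-conj z = ≡⇒≋ (conj-involutive z)

  ψ : ℤ × ℤ → ℤ × ℤ → ℤ
  ψ c w = χ (N w) * χ (Re (c ⊗ fourth w))

  ψ-resp : ∀ {c c′ w w′} → c ≋ c′ → w ≋ w′ → ψ c w ≡ ψ c′ w′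
  ψ-resp e f = cong₂ _*_ (χ-resp (N-cong f)) (χ-resp (re≈ (⊗-cong e (fourth-cong f))))

  χN-⊗ : ∀ z w → χ (N (z ⊗ w)) ≡ χ (N z) * χ (N w)
  χN-⊗ z w = trans (cong χ (N-⊗ z w)) (χ-* (N z) (N w))

  opaque

    Ψ : ℤ × ℤ → ℤ
    Ψ c = ∑ ℙ (ψ c)

    Ψ-∑ : ∀ c → Ψ c ≡ ∑ ℙ (ψ c)
    Ψ-∑ c = refl

    Ψ-resp : Respects² Ψ
    Ψ-resp e = ∑-cong ℙ (λ w → ψ-resp {w = w} e ≋-refl)

    Ψ-fourth : ∀ c u → N u ≉ + 0 → Ψ c ≡ χ (N u) * Ψ (c ⊗ fourth u)
    Ψ-fourth c u Nu≉0 = begin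
      ∑ ℙ (ψ c)                                   ≡⟨ sym (∑-⊗ u Nu≉0 (ψ c) (ψ-resp (≋-refl {c}))) ⟩
      ∑ ℙ (λ w → ψ c (u ⊗ w))                     ≡⟨ ∑-cong ℙ step ⟩
      ∑ ℙ (λ w → χ (N u) * ψ (c ⊗ fourth u) w)    ≡⟨ ∑-*ˡ ℙ (χ (N u)) (ψ (c ⊗ fourth u)) ⟩
      χ (N u) * Ψ (c ⊗ fourth u)                  ∎
      where
      open ≡-Reasoning
      step : ∀ w → ψ c (u ⊗ w) ≡ χ (N u) * ψ (c ⊗ fourth u) w
      step w = trans
        (cong₂ _*_ (χN-⊗ u w)
          (cong (χ ∘ Re) (trans (cong (c ⊗_) (fourth-⊗ u w)) (sym (⊗-assoc c (fourth u) (fourth w))))))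
        (ℤₚ.*-assoc (χ (N u)) (χ (N w)) _)

    Ψ-· : ∀ k c → Ψ (k · c) ≡ χ k * Ψ c
    Ψ-· k c = trans (∑-cong ℙ step) (∑-*ˡ ℙ (χ k) (ψ c))
      where
      swap : ∀ a b c → a * (b * c) ≡ b * (a * c)
      swap = solve-∀
      step : ∀ w → ψ (k · c) w ≡ χ k * ψ c w
      step w = trans
        (cong (χ (N w) *_) (trans
          (cong χ (trans (cong Re (·-⊗ k c (fourth w))) (Re-· k (c ⊗ fourth w))))
          (χ-* k (Re (c ⊗ fourth w)))))
        (swap (χ (N w)) (χ k) (χ (Re (c ⊗ fourth w))))

    -- Norms and real parts do not change under conjugation, so w may be replaced by its conjugate.
    -- This symmetry later annihilates Ψ on the class of d² and identifies the values of F at d and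
    -- at its conjugate, which represents the class of d³.
    Ψ-conj : ∀ c → Ψ (conj c) ≡ Ψ c
    Ψ-conj c = trans (∑-cong ℙ step) (∑-conj (ψ c) (ψ-resp (≋-refl {c})))
      where
      step : ∀ w → ψ (conj c) w ≡ ψ c (conj w)
      step w = cong₂ _*_ (cong χ (sym (N-conj w))) (cong χ (begin
        Re (conj c ⊗ fourth w)               ≡⟨ sym (Re-conj (conj c ⊗ fourth w)) ⟩
        Re (conj (conj c ⊗ fourth w))        ≡⟨ cong Re (conj-⊗ (conj c) (fourth w)) ⟩
        Re (conj (conj c) ⊗ conj (fourth w))
          ≡⟨ cong₂ (λ z v → Re (z ⊗ v)) (conj-involutive c) (conj-fourth w) ⟩
        Re (c ⊗ fourth (conj w))             ∎))
        where open ≡-Reasoning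

  opaque

    F : ℤ × ℤ → ℤ
    F c = Ψ c * Ψ c

    F-def : ∀ c → F c ≡ Ψ c * Ψ c
    F-def c = refl

    F-resp : Respects² F
    F-resp e = cong₂ _*_ (Ψ-resp e) (Ψ-resp e)

    private
      square-absorb : ∀ e z → e * e ≡ + 1 → (e * z) * (e * z) ≡ z * z
      square-absorb e z ee = trans (id′ e z) (trans (cong (_* (z * z)) ee) (ℤₚ.*-identityˡ (z * z)))
        where
        id′ : ∀ e z → (e * z) * (e * z) ≡ e * e * (z * z)
        id′ = solve-∀

    F-fourth : ∀ c u → N u ≉ + 0 → F (c ⊗ fourth u) ≡ F c
    F-fourth c u Nu≉0 = sym (trans (cong (λ z → z * z) (Ψ-fourth c u Nu≉0))
      (square-absorb (χ (N u)) (Ψ (c ⊗ fourth u)) (χ²≡1 Nu≉0)))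

    F-· : ∀ k c → k ≉ + 0 → F (k · c) ≡ F c
    F-· k c k≉0 = trans (cong (λ z → z * z) (Ψ-· k c)) (square-absorb (χ k) (Ψ c) (χ²≡1 k≉0))

    F-conj : ∀ c → F (conj c) ≡ F c
    F-conj c = cong (λ z → z * z) (Ψ-conj c)

-- The values of F on the four classes of units.

module TwistClasses (p : ℕ) .{{_ : NonZero p}} (p-prime : Prime p)
                    (2≉0 : Congruence._≉_ p (+ 2) (+ 0))
                    (d : ℤ × ℤ) (χNd : PrimeField.χ p p-prime 2≉0 (N d) ≡ - (+ 1)) where
  open Congruence p
  open PrimeField p p-prime 2≉0
  open GaussianPlane p p-prime 2≉0

  ≡1⇒≉0 : ∀ {a} → χ a ≡ + 1 → a ≉ + 0
  ≡1⇒≉0 eq e with trans (sym eq) (χ-zero e)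
  ... | ()

  ≡-1⇒≉0 : ∀ {a} → χ a ≡ - (+ 1) → a ≉ + 0
  ≡-1⇒≉0 eq e with trans (sym eq) (χ-zero e)
  ... | ()

  i≡-i⇒i≡0 : ∀ {i} → i ≡ - i → i ≡ + 0
  i≡-i⇒i≡0 {i} e = ℤₚ.*-cancelˡ-≡ (+ 2) i (+ 0) (begin
    + 2 * i      ≡⟨ id₁ i ⟩
    i - - i      ≡⟨ cong (_- - i) e ⟩
    - i - - i    ≡⟨ ℤₚ.+-inverseʳ (- i) ⟩
    + 0          ∎)
    where
    open ≡-Reasoning
    id₁ : ∀ i → + 2 * i ≡ i - - i
    id₁ = solve-∀

  Nd≉0 : N d ≉ + 0
  Nd≉0 = ≡-1⇒≉0 χNd

  opaque
    unfolding _⊗_ N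

    -- Take u = 1 + s conj c. Since c conj c = N c = 0, multiplying c by u leaves it unchanged, and
    -- N u = 1 + 2 s a + s² N c = 1 + 2 s a is linear in s. So s = (N d - 1) / (2 a) gives N u the
    -- prescribed value.
    N≈0⇒absorbs : ∀ c → N c ≈ + 0 → Re c ≉ + 0 → ∃ λ u → N u ≈ N d × c ⊗ u ≋ c
    N≈0⇒absorbs c@(a , b) Nc≈0 a≉0 = (+ 1 + s * a , - (s * b)) ,
      from-≈₂ (s * s) (N d - + 1) Nc≈0 (*-inv (*-≉0 2≉0 a≉0)) (id₁ a b (N d) i) ,
      (from-≈ s Nc≈0 (id₂ a b s) ∥ ≡⇒≈ (id₃ a b s))
      where
      i s : ℤ
      i = inv (+ 2 * a)
      s = (N d - + 1) * i
      id₁ : ∀ a b n i → (+ 1 + (n - + 1) * i * a) * (+ 1 + (n - + 1) * i * a)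
                          + - ((n - + 1) * i * b) * - ((n - + 1) * i * b) - n
                      ≡ (n - + 1) * i * ((n - + 1) * i) * (a * a + b * b - + 0) + (n - + 1) * (+ 2 * a * i - + 1)
      id₁ = solve-∀
      id₂ : ∀ a b s → a * (+ 1 + s * a) - b * - (s * b) - a ≡ s * (a * a + b * b - + 0)
      id₂ = solve-∀
      id₃ : ∀ a b s → a * - (s * b) + b * (+ 1 + s * a) ≡ b
      id₃ = solve-∀

    N≈0⇒≋0 : ∀ c → N c ≈ + 0 → Re c ≈ + 0 → c ≋ (+ 0 , + 0)
    N≈0⇒≋0 (a , b) Nc≈0 a≈0 with b ≈? + 0
    ... | yes b≈0 = a≈0 ∥ b≈0
    ... | no  b≉0 = contradiction (from-≈₂ (+ 1) (- a) Nc≈0 a≈0 (id′ a b)) (*-≉0 b≉0 b≉0)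
      where
      id′ : ∀ a b → b * b - + 0 ≡ + 1 * (a * a + b * b - + 0) + - a * (a - + 0)
      id′ = solve-∀

  -- A singular c ≠ 0 absorbs a factor u whose norm is a nonsquare.
  Ψ-singular : ∀ c → N c ≈ + 0 → Ψ c ≡ + 0
  Ψ-singular c Nc≈0 with Re c ≈? + 0
  ... | yes a≈0 = trans (Ψ-resp (≋-trans (N≈0⇒≋0 c Nc≈0 a≈0) (≡⇒≋ (0≡0· c))))
    (trans (Ψ-· (+ 0) c) (cong (_* Ψ c) (χ-zero ≈-refl)))
  ... | no  a≉0 = let (u , Nu≈Nd , c⊗u) = N≈0⇒absorbs c Nc≈0 a≉0 in absorbed u (trans (χ-resp Nu≈Nd) χNd) c⊗u
    where
    absorbed : ∀ u → χ (N u) ≡ - (+ 1) → c ⊗ u ≋ c → Ψ c ≡ + 0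
    absorbed u χNu c⊗u = i≡-i⇒i≡0 (begin
      Ψ c                             ≡⟨ Ψ-fourth c u (≡-1⇒≉0 χNu) ⟩
      χ (N u) * Ψ (c ⊗ fourth u)      ≡⟨ cong₂ _*_ χNu (Ψ-resp absorb) ⟩
      - (+ 1) * Ψ c                   ≡⟨ ℤₚ.-1*i≡-i (Ψ c) ⟩
      - Ψ c                           ∎)
      where
      open ≡-Reasoning
      c⊗uu : c ⊗ (u ⊗ u) ≋ c
      c⊗uu = ≋-trans (≡⇒≋ (sym (⊗-assoc c u u))) (≋-trans (⊗-congʳ u c⊗u) c⊗u)
      absorb : c ⊗ fourth u ≋ c
      absorb = ≋-trans (≡⇒≋ (trans (cong (c ⊗_) (fourth-def u)) (sym (⊗-assoc c (u ⊗ u) (u ⊗ u)))))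
        (≋-trans (⊗-congʳ (u ⊗ u) c⊗uu) c⊗uu)

  record ScaledSquare (c : ℤ × ℤ) : Set where
    constructor scaled
    field
      factor     : ℤ
      root       : ℤ × ℤ
      factor≉0   : factor ≉ + 0
      root-unit  : N root ≉ + 0
      ≋-square   : c ≋ factor · (root ⊗ root)

  opaque
    unfolding _⊗_ _·_ N

    -- Hilbert's Theorem 90: c / μ has norm 1, hence equals v / conj v = v² / N v for v = c + μ.
    norm-square⇒scaled : ∀ c μ → χ (N c) ≡ + 1 → μ * μ ≈ N c → Re c + μ ≉ + 0 → ScaledSquare c
    norm-square⇒scaled c@(a , b) μ χNc μμ≈N a+μ≉0 = scaled (μ * i) v (*-≉0 μ≉0 (inv-≉0 Nv≉0)) Nv≉0
      (divide (from-≈ (- (a + μ)) μμ≈N (id₂ a b μ)) ∥ divide (from-≈ (- b) μμ≈N (id₃ a b μ)))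
      where
      v : ℤ × ℤ
      v = a + μ , b
      i : ℤ
      i = inv (N v)
      μ≉0 : μ ≉ + 0
      μ≉0 = ≉0-*ˡ {μ} {μ} (≈-≉0 μμ≈N (≡1⇒≉0 χNc))
      id₁ : ∀ a b μ → ((a + μ) * (a + μ) + b * b) - + 2 * (μ * (a + μ)) ≡ - (+ 1) * (μ * μ - (a * a + b * b))
      id₁ = solve-∀
      -- With μ² = N c the norm of v collapses to 2 μ (a + μ), which is why the hypothesis concerns
      -- a + μ.
      Nv≉0 : N v ≉ + 0
      Nv≉0 = ≈-≉0 (from-≈ (- (+ 1)) μμ≈N (id₁ a b μ)) (*-≉0 2≉0 (*-≉0 μ≉0 a+μ≉0))
      id₂ : ∀ a b μ → ((a + μ) * (a + μ) + b * b) * a - μ * ((a + μ) * (a + μ) - b * b)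
                    ≡ - (a + μ) * (μ * μ - (a * a + b * b))
      id₂ = solve-∀
      id₃ : ∀ a b μ → ((a + μ) * (a + μ) + b * b) * b - μ * ((a + μ) * b + b * (a + μ))
                    ≡ - b * (μ * μ - (a * a + b * b))
      id₃ = solve-∀
      id₄ : ∀ n i x μ y → x - μ * i * y ≡ i * (n * x - μ * y) + - x * (n * i - + 1)
      id₄ = solve-∀
      divide : ∀ {x y} → N v * x ≈ μ * y → x ≈ μ * i * y
      divide {x} {y} e = from-≈₂ i (- x) e (*-inv Nv≉0) (id₄ (N v) i x μ y)

    -- If the root μ of N c has a + μ = 0, the other root - μ works: a + μ and a - μ cannot both
    -- vanish, as their difference 2 μ is nonzero.
    hilbert-90 : ∀ c → χ (N c) ≡ + 1 → ScaledSquare c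
    hilbert-90 c@(a , b) χNc with χ≡1⇒square χNc
    ... | μ , μμ≈N with a + μ ≈? + 0
    ...   | no a+μ≉0  = norm-square⇒scaled c μ χNc μμ≈N a+μ≉0
    ...   | yes a+μ≈0 = norm-square⇒scaled c (- μ) χNc (≈-trans (≡⇒≈ (id₁ μ)) μμ≈N)
        (λ a-μ≈0 → *-≉0 2≉0 μ≉0 (from-≈₂ (+ 1) (- (+ 1)) a+μ≈0 a-μ≈0 (id₂ a μ)))
      where
      id₁ : ∀ μ → - μ * - μ ≡ μ * μ
      id₁ = solve-∀
      id₂ : ∀ a μ → + 2 * μ - + 0 ≡ + 1 * (a + μ - + 0) + - (+ 1) * (a + - μ - + 0)
      id₂ = solve-∀
      μ≉0 : μ ≉ + 0
      μ≉0 = ≉0-*ˡ {μ} {μ} (≈-≉0 μμ≈N (≡1⇒≉0 χNc))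

  F-fourth-1 : ∀ j → N j ≉ + 0 → F (fourth j) ≡ F 1ᴳ
  F-fourth-1 j Nj≉0 = trans (F-resp (≡⇒≋ (sym (⊗-identityˡ (fourth j))))) (F-fourth 1ᴳ j Nj≉0)

  scaled-square : ∀ {k} ((scaled μ j _ _ _) : ScaledSquare k) → k ⊗ k ≋ (μ * μ) · fourth j
  scaled-square (scaled μ j _ _ e) = ≋-trans (⊗-cong e e) (≡⇒≋ (trans
    (·-⊗ μ (j ⊗ j) (μ · (j ⊗ j))) (trans (cong (μ ·_) (⊗-· μ (j ⊗ j) (j ⊗ j)))
    (trans (·-· μ μ (j ⊗ j ⊗ (j ⊗ j))) (cong ((μ * μ) ·_) (sym (fourth-def j)))))))

  -- Hilbert 90 gives k = μ j², so k² = μ² j⁴ is a scalar times a fourth power.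
  F-square-1 : ∀ k → χ (N k) ≡ + 1 → F (k ⊗ k) ≡ F 1ᴳ
  F-square-1 k χNk with hilbert-90 k χNk
  ... | h@(scaled μ j μ≉0 Nj≉0 _) = trans (F-resp (scaled-square h))
    (trans (F-· (μ * μ) (fourth j) (*-≉0 μ≉0 μ≉0)) (F-fourth-1 j Nj≉0))

  -- The product of conj (k²) with k⁴ is (N k)² k², so twisting by k carries the conjugate of k²
  -- back to k² up to a square scalar. Conjugation does not change Ψ, while the twist costs the sign
  -- χ (N k) = -1; hence the value is its own negative.
  Ψ-square-0 : ∀ k → χ (N k) ≡ - (+ 1) → Ψ (k ⊗ k) ≡ + 0
  Ψ-square-0 k χNk = i≡-i⇒i≡0 (begin
    Ψ (k ⊗ k)
      ≡⟨ sym (Ψ-conj (k ⊗ k)) ⟩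
    Ψ (conj (k ⊗ k))
      ≡⟨ Ψ-fourth (conj (k ⊗ k)) k Nk≉0 ⟩
    χ (N k) * Ψ (conj (k ⊗ k) ⊗ fourth k)
      ≡⟨ cong₂ _*_ χNk (Ψ-resp (≡⇒≋ conj-cancel)) ⟩
    - (+ 1) * Ψ ((N k * N k) · (k ⊗ k))
      ≡⟨ cong (- (+ 1) *_) (trans (Ψ-· (N k * N k) (k ⊗ k))
           (trans (cong (_* Ψ (k ⊗ k)) (χ-xx Nk≉0)) (ℤₚ.*-identityˡ (Ψ (k ⊗ k))))) ⟩
    - (+ 1) * Ψ (k ⊗ k)
      ≡⟨ ℤₚ.-1*i≡-i (Ψ (k ⊗ k)) ⟩
    - Ψ (k ⊗ k) ∎)
    where
    open ≡-Reasoning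
    Nk≉0 : N k ≉ + 0
    Nk≉0 = ≡-1⇒≉0 χNk
    conj⊗ : conj k ⊗ k ≡ N k · 1ᴳ
    conj⊗ = trans (⊗-comm (conj k) k) (trans (⊗-conj k) (scalar≡· (N k)))
    conj-cancel : conj (k ⊗ k) ⊗ fourth k ≡ (N k * N k) · (k ⊗ k)
    conj-cancel = begin
      conj (k ⊗ k) ⊗ fourth k                   ≡⟨ cong₂ _⊗_ (conj-⊗ k k) (fourth-def k) ⟩
      conj k ⊗ conj k ⊗ (k ⊗ k ⊗ (k ⊗ k))       ≡⟨ sym (⊗-assoc (conj k ⊗ conj k) (k ⊗ k) (k ⊗ k)) ⟩
      conj k ⊗ conj k ⊗ (k ⊗ k) ⊗ (k ⊗ k)
        ≡⟨ cong (_⊗ (k ⊗ k)) (trans (⊗-interchange (conj k) (conj k) k k) (cong₂ _⊗_ conj⊗ conj⊗)) ⟩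
      N k · 1ᴳ ⊗ N k · 1ᴳ ⊗ (k ⊗ k)
        ≡⟨ cong (_⊗ (k ⊗ k)) (trans (·-⊗ (N k) 1ᴳ (N k · 1ᴳ))
             (trans (cong (N k ·_) (⊗-identityˡ (N k · 1ᴳ))) (·-· (N k) (N k) 1ᴳ))) ⟩
      (N k * N k) · 1ᴳ ⊗ (k ⊗ k)                ≡⟨ ·-⊗ (N k * N k) 1ᴳ (k ⊗ k) ⟩
      (N k * N k) · (1ᴳ ⊗ (k ⊗ k))              ≡⟨ cong ((N k * N k) ·_) (⊗-identityˡ (k ⊗ k)) ⟩
      (N k * N k) · (k ⊗ k)                     ∎

  F-square-0 : ∀ k → χ (N k) ≡ - (+ 1) → F (k ⊗ k) ≡ + 0
  F-square-0 k χNk = trans (F-def (k ⊗ k)) (cong (λ z → z * z) (Ψ-square-0 k χNk))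

  χN-⊗d : ∀ k {u} → χ (N k) ≡ u → χ (N (k ⊗ d)) ≡ u * - (+ 1)
  χN-⊗d k eq = trans (χN-⊗ k d) (cong₂ _*_ eq χNd)

  χN-±1 : ∀ {k} → N k ≉ + 0 → χ (N k) ≡ + 1 ⊎ χ (N k) ≡ - (+ 1)
  χN-±1 = SupplementaryLaws.χ-±1 p p-prime 2≉0

  -- Writing c = l k² gives c d² = l (k d)². The norms of k and k d have opposite characters, so one
  -- of the two elements lies in the class of 1 and the other in that of d².
  F-pair : ∀ c → χ (N c) ≡ + 1 → F c + F (c ⊗ (d ⊗ d)) ≡ F 1ᴳ
  F-pair c χNc = trans (cong₂ _+_ Fc Fcdd) (classes (χN-±1 root-unit))
    where
    open ScaledSquare (hilbert-90 c χNc) renaming (factor to l; root to k)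
    Fc : F c ≡ F (k ⊗ k)
    Fc = trans (F-resp ≋-square) (F-· l (k ⊗ k) factor≉0)
    Fcdd : F (c ⊗ (d ⊗ d)) ≡ F (k ⊗ d ⊗ (k ⊗ d))
    Fcdd = trans
      (F-resp (≋-trans (⊗-congʳ (d ⊗ d) ≋-square) (≡⇒≋ (trans
        (·-⊗ l (k ⊗ k) (d ⊗ d)) (cong (l ·_) (⊗-interchange k k d d))))))
      (F-· l (k ⊗ d ⊗ (k ⊗ d)) factor≉0)
    classes : χ (N k) ≡ + 1 ⊎ χ (N k) ≡ - (+ 1) → F (k ⊗ k) + F (k ⊗ d ⊗ (k ⊗ d)) ≡ F 1ᴳ
    classes (inj₁ χNk) = trans
      (cong₂ _+_ (F-square-1 k χNk) (F-square-0 (k ⊗ d) (χN-⊗d k χNk))) (ℤₚ.+-identityʳ (F 1ᴳ))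
    classes (inj₂ χNk) = trans
      (cong₂ _+_ (F-square-0 k χNk) (F-square-1 (k ⊗ d) (χN-⊗d k χNk))) (ℤₚ.+-identityˡ (F 1ᴳ))

  private
    F-equivalent : ∀ {x y c e j} → x ≉ + 0 → y ≉ + 0 → N j ≉ + 0 → x · c ≋ y · (e ⊗ fourth j) → F c ≡ F e
    F-equivalent {x} {y} {c} {e} {j} x≉0 y≉0 Nj≉0 eq = begin
      F c                      ≡⟨ sym (F-· x c x≉0) ⟩
      F (x · c)                ≡⟨ F-resp eq ⟩
      F (y · (e ⊗ fourth j))   ≡⟨ F-· y (e ⊗ fourth j) y≉0 ⟩
      F (e ⊗ fourth j)         ≡⟨ F-fourth e j Nj≉0 ⟩
      F e                      ∎
      where open ≡-Reasoning

    norm-· : ∀ z → z ⊗ conj d ⊗ d ≡ N d · z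
    norm-· z = trans (⊗-assoc z (conj d) d) (trans
      (cong (z ⊗_) (trans (⊗-comm (conj d) d) (trans (⊗-conj d) (scalar≡· (N d)))))
      (trans (⊗-· (N d) z 1ᴳ) (cong (N d ·_) (⊗-identityʳ z))))

  -- Here c conj d has square norm, so it equals l k² and c is k² d up to scalars. If N k is a
  -- square, k² is a scalar times a fourth power and c lies in the class of d. Otherwise k d has
  -- square norm, and N(d) k² d = conj d (k d)² puts c into the class of conj d, where F takes the
  -- same value.
  F-nonsquare : ∀ c → χ (N c) ≡ - (+ 1) → F c ≡ F d
  F-nonsquare c χNc = classes (χN-±1 root-unit)
    where
    χNcd : χ (N (c ⊗ conj d)) ≡ + 1
    χNcd = trans (χN-⊗ c (conj d)) (cong₂ _*_ χNc (trans (cong χ (N-conj d)) χNd))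
    open ScaledSquare (hilbert-90 (c ⊗ conj d) χNcd) renaming (factor to l; root to k)
    base : N d · c ≋ l · (k ⊗ k ⊗ d)
    base = ≋-trans (≡⇒≋ (sym (norm-· c))) (≋-trans (⊗-congʳ d ≋-square) (≡⇒≋ (·-⊗ l (k ⊗ k) d)))
    classes : χ (N k) ≡ + 1 ⊎ χ (N k) ≡ - (+ 1) → F c ≡ F d
    classes (inj₁ χNk) with hilbert-90 k χNk
    ... | h@(scaled m j m≉0 Nj≉0 _) = F-equivalent Nd≉0 (*-≉0 factor≉0 (*-≉0 m≉0 m≉0)) Nj≉0
      (≋-trans base (≋-trans (·-congˡ l (⊗-congʳ d (scaled-square h))) (≡⇒≋ (begin
        l · ((m * m) · fourth j ⊗ d)    ≡⟨ cong (l ·_) (·-⊗ (m * m) (fourth j) d) ⟩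
        l · (m * m) · (fourth j ⊗ d)    ≡⟨ ·-· l (m * m) (fourth j ⊗ d) ⟩
        (l * (m * m)) · (fourth j ⊗ d)  ≡⟨ cong ((l * (m * m)) ·_) (⊗-comm (fourth j) d) ⟩
        (l * (m * m)) · (d ⊗ fourth j)  ∎))))
      where open ≡-Reasoning
    classes (inj₂ χNk) with hilbert-90 (k ⊗ d) (χN-⊗d k χNk)
    ... | h@(scaled m j m≉0 Nj≉0 _) = trans
      (F-equivalent (*-≉0 Nd≉0 Nd≉0) (*-≉0 factor≉0 (*-≉0 m≉0 m≉0)) Nj≉0
        (≋-trans (≡⇒≋ (sym (·-· (N d) (N d) c))) (≋-trans (·-congˡ (N d) base)
          (≋-trans (≡⇒≋ (begin
            N d · l · (k ⊗ k ⊗ d)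
              ≡⟨ trans (·-· (N d) l (k ⊗ k ⊗ d)) (cong (_· (k ⊗ k ⊗ d)) (ℤₚ.*-comm (N d) l)) ⟩
            (l * N d) · (k ⊗ k ⊗ d)           ≡⟨ sym (·-· l (N d) (k ⊗ k ⊗ d)) ⟩
            l · N d · (k ⊗ k ⊗ d)             ≡⟨ cong (l ·_) (sym (norm-· (k ⊗ k ⊗ d))) ⟩
            l · (k ⊗ k ⊗ d ⊗ conj d ⊗ d)      ≡⟨ cong (l ·_) (regroup k d (conj d)) ⟩
            l · (conj d ⊗ (k ⊗ d ⊗ (k ⊗ d)))  ∎))
          (≋-trans (·-congˡ l (⊗-congˡ (conj d) (scaled-square h))) (≡⇒≋ (trans
            (cong (l ·_) (⊗-· (m * m) (conj d) (fourth j))) (·-· l (m * m) (conj d ⊗ fourth j)))))))))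
      (F-conj d)
      where
      open ≡-Reasoning
      regroup : ∀ k d e → k ⊗ k ⊗ d ⊗ e ⊗ d ≡ e ⊗ (k ⊗ d ⊗ (k ⊗ d))
      regroup k d e = begin
        k ⊗ k ⊗ d ⊗ e ⊗ d        ≡⟨ cong (_⊗ d) (⊗-comm (k ⊗ k ⊗ d) e) ⟩
        e ⊗ (k ⊗ k ⊗ d) ⊗ d      ≡⟨ ⊗-assoc e (k ⊗ k ⊗ d) d ⟩
        e ⊗ (k ⊗ k ⊗ d ⊗ d)      ≡⟨ cong (e ⊗_) (trans (⊗-assoc (k ⊗ k) d d) (⊗-interchange k k d d)) ⟩
        e ⊗ (k ⊗ d ⊗ (k ⊗ d))    ∎

  opaque
    -- The indicator of the units, in the form in which the second moment produces it, so that its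
    -- sum can be cancelled between the two evaluations of the sum of F.
    unit : ℤ × ℤ → ℤ
    unit c = χ (N c) * χ (N c)

    unit-def : ∀ c → unit c ≡ χ (N c) * χ (N c)
    unit-def c = refl

  unit-0 : ∀ c → N c ≈ + 0 → unit c ≡ + 0
  unit-0 c e = trans (unit-def c) (cong (λ z → z * z) (χ-zero e))

  unit-1 : ∀ c → N c ≉ + 0 → unit c ≡ + 1
  unit-1 c ne = trans (unit-def c) (χ²≡1 ne)

  F-unit : ∀ c → unit c * F c ≡ F c
  F-unit c with N c ≈? + 0
  ... | yes e = trans (cong (unit c *_) Fc≡0) (trans (ℤₚ.*-zeroʳ (unit c)) (sym Fc≡0))
    where
    Fc≡0 : F c ≡ + 0
    Fc≡0 = trans (F-def c) (cong (λ z → z * z) (Ψ-singular c e))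
  ... | no ne = trans (cong (_* F c) (unit-1 c ne)) (ℤₚ.*-identityˡ (F c))

  -- The four classes of units modulo scalars and fourth powers are 1, d, d², d³.
  F-cycle : ∀ c → unit c * ((F c + F (c ⊗ (d ⊗ d))) + (F (c ⊗ d) + F (c ⊗ d ⊗ (d ⊗ d))))
                ≡ unit c * (F 1ᴳ + + 2 * F d)
  F-cycle c with N c ≈? + 0
  ... | yes e = trans (cong (_* ((F c + F (c ⊗ (d ⊗ d))) + (F (c ⊗ d) + F (c ⊗ d ⊗ (d ⊗ d))))) (unit-0 c e))
    (sym (cong (_* (F 1ᴳ + + 2 * F d)) (unit-0 c e)))
  ... | no ne = cong (unit c *_) (classes (χN-±1 ne))
    where
    double : ∀ a → a + a ≡ + 2 * a
    double = solve-∀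
    χN-⊗dd : ∀ e {u} → χ (N e) ≡ u → χ (N (e ⊗ (d ⊗ d))) ≡ u * - (+ 1) * - (+ 1)
    χN-⊗dd e eq = trans (cong (χ ∘ N) (sym (⊗-assoc e d d))) (χN-⊗d (e ⊗ d) (χN-⊗d e eq))
    classes : χ (N c) ≡ + 1 ⊎ χ (N c) ≡ - (+ 1) →
              (F c + F (c ⊗ (d ⊗ d))) + (F (c ⊗ d) + F (c ⊗ d ⊗ (d ⊗ d))) ≡ F 1ᴳ + + 2 * F d
    classes (inj₁ χNc) = cong₂ _+_ (F-pair c χNc) (trans
      (cong₂ _+_ (F-nonsquare (c ⊗ d) (χN-⊗d c χNc))
        (F-nonsquare (c ⊗ d ⊗ (d ⊗ d)) (χN-⊗dd (c ⊗ d) (χN-⊗d c χNc))))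
      (double (F d)))
    classes (inj₂ χNc) = trans
      (cong₂ _+_
        (trans (cong₂ _+_ (F-nonsquare c χNc) (F-nonsquare (c ⊗ (d ⊗ d)) (χN-⊗dd c χNc))) (double (F d)))
        (F-pair (c ⊗ d) (χN-⊗d c χNc)))
      (ℤₚ.+-comm (+ 2 * F d) (F 1ᴳ))

  ∑-F-⊗ : ∀ v → N v ≉ + 0 → ∑ ℙ (λ c → unit c * F (c ⊗ v)) ≡ ∑ ℙ F
  ∑-F-⊗ v Nv≉0 = trans (∑-cong ℙ step) (∑-⊗ v Nv≉0 F F-resp)
    where
    unit-⊗ : ∀ c → unit c ≡ unit (c ⊗ v)
    unit-⊗ c with N c ≈? + 0
    ... | yes e = trans (unit-0 c e) (sym (unit-0 (c ⊗ v) (≈-trans (≡⇒≈ (N-⊗ c v)) (zero-* (N v) e))))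
    ... | no ne = trans (unit-1 c ne) (sym (unit-1 (c ⊗ v) (≈-≉0 (≡⇒≈ (N-⊗ c v)) (*-≉0 ne Nv≉0))))
    step : ∀ c → unit c * F (c ⊗ v) ≡ F (v ⊗ c)
    step c = trans (cong (_* F (c ⊗ v)) (unit-⊗ c)) (trans (F-unit (c ⊗ v)) (cong F (⊗-comm c v)))

  -- Multiplication by d permutes the units and F vanishes off them, so c, c d, c d² and c d³ give
  -- the same sum of F, while pointwise their values add up to F 1 + 2 F d. Averaging over this
  -- cycle avoids computing the sizes of the classes.
  ∑-F-classes : + 4 * ∑ ℙ F ≡ ∑ ℙ unit * (F 1ᴳ + + 2 * F d)
  ∑-F-classes = sym (begin
    ∑ ℙ unit * (F 1ᴳ + + 2 * F d)
      ≡⟨ sym (∑-*ʳ ℙ (F 1ᴳ + + 2 * F d) unit) ⟩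
    ∑ ℙ (λ c → unit c * (F 1ᴳ + + 2 * F d))
      ≡⟨ ∑-cong ℙ (λ c → trans (sym (F-cycle c))
           (distribute (unit c) (F c) (F (c ⊗ (d ⊗ d))) (F (c ⊗ d)) (F (c ⊗ d ⊗ (d ⊗ d))))) ⟩
    ∑ ℙ (λ c → (f₀ c + f₂ c) + (f₁ c + f₃ c))
      ≡⟨ trans (∑-+ ℙ (λ c → f₀ c + f₂ c) (λ c → f₁ c + f₃ c)) (cong₂ _+_ (∑-+ ℙ f₀ f₂) (∑-+ ℙ f₁ f₃)) ⟩
    (∑ ℙ f₀ + ∑ ℙ f₂) + (∑ ℙ f₁ + ∑ ℙ f₃)
      ≡⟨ cong₂ _+_ (cong₂ _+_ (∑-cong ℙ F-unit) (∑-F-⊗ (d ⊗ d) Ndd≉0)) (cong₂ _+_ (∑-F-⊗ d Nd≉0) third) ⟩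
    (∑ ℙ F + ∑ ℙ F) + (∑ ℙ F + ∑ ℙ F)
      ≡⟨ quadruple (∑ ℙ F) ⟩
    + 4 * ∑ ℙ F ∎)
    where
    open ≡-Reasoning
    f₀ f₁ f₂ f₃ : ℤ × ℤ → ℤ
    f₀ c = unit c * F c
    f₁ c = unit c * F (c ⊗ d)
    f₂ c = unit c * F (c ⊗ (d ⊗ d))
    f₃ c = unit c * F (c ⊗ d ⊗ (d ⊗ d))
    distribute : ∀ u a b c e → u * ((a + b) + (c + e)) ≡ (u * a + u * b) + (u * c + u * e)
    distribute = solve-∀
    quadruple : ∀ a → (a + a) + (a + a) ≡ + 4 * a
    quadruple = solve-∀
    Ndd≉0 : N (d ⊗ d) ≉ + 0
    Ndd≉0 = ≈-≉0 (≡⇒≈ (N-⊗ d d)) (*-≉0 Nd≉0 Nd≉0)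
    third : ∑ ℙ f₃ ≡ ∑ ℙ F
    third = trans (∑-cong ℙ (λ c → cong (λ z → unit c * F z) (⊗-assoc c d (d ⊗ d))))
      (∑-F-⊗ (d ⊗ (d ⊗ d)) (≈-≉0 (≡⇒≈ (N-⊗ d (d ⊗ d))) (*-≉0 Nd≉0 Ndd≉0)))

-- The second moment of Ψ from the orthogonality of χ.

module SecondMoment (p : ℕ) .{{_ : NonZero p}} (p-prime : Prime p)
                    (2≉0 : Congruence._≉_ p (+ 2) (+ 0)) where
  open Congruence p
  open PrimeField p p-prime 2≉0
  open GaussianPlane p p-prime 2≉0

  p-1 : ℤ
  p-1 = + p - + 1

  δ-pos : ∀ {a x} → x ≈ a → δ (a - x) ≡ + 1
  δ-pos e = δ-0 (a≈b⇒a-b≈0 (≈-sym e))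

  δ-neg : ∀ {a x} → x ≉ a → δ (a - x) ≡ + 0
  δ-neg ne = δ-≉0 (λ e → ne (≈-sym (a-b≈0⇒a≈b e)))

  ∑-1-δ : ∑ 𝔽 (λ x → + 1 - δ (+ 0 - x)) ≡ p-1
  ∑-1-δ = begin
    ∑ 𝔽 (λ x → + 1 - δ (+ 0 - x))
      ≡⟨ ∑-cong 𝔽 (λ x → cong (ℤ._+_ (+ 1)) (sym (ℤₚ.-1*i≡-i (δ (+ 0 - x))))) ⟩
    ∑ 𝔽 (λ x → + 1 + - (+ 1) * δ (+ 0 - x))
      ≡⟨ ∑-+ 𝔽 (λ _ → + 1) (λ x → - (+ 1) * δ (+ 0 - x)) ⟩
    ∑ 𝔽 (λ _ → + 1) + ∑ 𝔽 (λ x → - (+ 1) * δ (+ 0 - x))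
      ≡⟨ cong₂ _+_ ∑-1 (trans (∑-*ˡ 𝔽 (- (+ 1)) (λ x → δ (+ 0 - x))) (cong (- (+ 1) *_) (∑-δ (+ 0)))) ⟩
    p-1 ∎
    where open ≡-Reasoning

  χ² : ∀ x → χ x * χ x ≡ + 1 - δ (+ 0 - x)
  χ² x with x ≈? + 0
  ... | yes e = trans (cong (λ z → z * z) (χ-zero e)) (cong (_-_ (+ 1)) (sym (δ-pos e)))
  ... | no ne = trans (χ²≡1 ne) (cong (_-_ (+ 1)) (sym (δ-neg ne)))

  ∑-away-from-0 : (f : ℤ → ℤ) (A B : ℤ) → (∀ {x} → x ≈ + 0 → f x ≡ A) → (∀ {x} → x ≉ + 0 → f x ≡ B) →
                  ∑ 𝔽 f ≡ A + p-1 * B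
  ∑-away-from-0 f A B at-0 away = begin
    ∑ 𝔽 f
      ≡⟨ ∑-cong 𝔽 split ⟩
    ∑ 𝔽 (λ x → δ (+ 0 - x) * A + (+ 1 - δ (+ 0 - x)) * B)
      ≡⟨ ∑-+ 𝔽 (λ x → δ (+ 0 - x) * A) (λ x → (+ 1 - δ (+ 0 - x)) * B) ⟩
    ∑ 𝔽 (λ x → δ (+ 0 - x) * A) + ∑ 𝔽 (λ x → (+ 1 - δ (+ 0 - x)) * B)
      ≡⟨ cong₂ _+_ (∑-dirac (λ _ → A) (λ _ → refl) (+ 0))
           (trans (∑-*ʳ 𝔽 B (λ x → + 1 - δ (+ 0 - x))) (cong (_* B) ∑-1-δ)) ⟩
    A + p-1 * B ∎
    where
    open ≡-Reasoning
    id₁ : ∀ a b → a ≡ + 1 * a + (+ 1 - + 1) * b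
    id₁ = solve-∀
    id₂ : ∀ a b → b ≡ + 0 * a + (+ 1 - + 0) * b
    id₂ = solve-∀
    split : ∀ x → f x ≡ δ (+ 0 - x) * A + (+ 1 - δ (+ 0 - x)) * B
    split x with x ≈? + 0
    ... | yes e = trans (at-0 e) (trans (id₁ A B) (cong (λ d → d * A + (+ 1 - d) * B) (sym (δ-pos e))))
    ... | no ne = trans (away ne) (trans (id₂ A B) (cong (λ d → d * A + (+ 1 - d) * B) (sym (δ-neg ne))))

  -- A scale invariant function on the plane is summed over the projective line.
  ∑-homogeneous : (h : ℤ × ℤ → ℤ) → Respects² h → h (+ 0 , + 0) ≡ + 0 →
                  (∀ k z → k ≉ + 0 → h (k · z) ≡ h z) →
                  ∑ ℙ h ≡ p-1 * (h (+ 1 , + 0) + ∑ 𝔽 (λ x → h (x , + 1)))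
  ∑-homogeneous h resp h-0 h-· = begin
    ∑ ℙ h
      ≡⟨ trans (∑-plane h) (∑-swap 𝔽 𝔽 (λ x y → h (x , y))) ⟩
    ∑ 𝔽 (λ y → ∑ 𝔽 (λ x → h (x , y)))
      ≡⟨ ∑-away-from-0 _ _ _ row-0 row ⟩
    p-1 * h (+ 1 , + 0) + p-1 * ∑ 𝔽 (λ x → h (x , + 1))
      ≡⟨ sym (ℤₚ.*-distribˡ-+ p-1 (h (+ 1 , + 0)) _) ⟩
    p-1 * (h (+ 1 , + 0) + ∑ 𝔽 (λ x → h (x , + 1))) ∎
    where
    open ≡-Reasoning
    h-cong : ∀ {a b c d} → a ≈ c → b ≈ d → h (a , b) ≡ h (c , d)
    h-cong e f = resp (e ∥ f)
    h-scale : ∀ k a b → k ≉ + 0 → h (k * a , k * b) ≡ h (a , b)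
    h-scale k a b k≉0 = trans (cong h (sym (·-def k a b))) (h-· k (a , b) k≉0)
    row-0 : ∀ {y} → y ≈ + 0 → ∑ 𝔽 (λ x → h (x , y)) ≡ p-1 * h (+ 1 , + 0)
    row-0 {y} e = trans
      (∑-away-from-0 _ (+ 0) (h (+ 1 , + 0)) (λ x≈0 → trans (h-cong x≈0 e) h-0) (λ {x} x≉0 → trans
        (h-cong (≡⇒≈ (sym (ℤₚ.*-identityʳ x))) (≈-trans e (≡⇒≈ (sym (ℤₚ.*-zeroʳ x)))))
        (h-scale x (+ 1) (+ 0) x≉0)))
      (ℤₚ.+-identityˡ (p-1 * h (+ 1 , + 0)))
    row : ∀ {y} → y ≉ + 0 → ∑ 𝔽 (λ x → h (x , y)) ≡ ∑ 𝔽 (λ x → h (x , + 1))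
    row {y} ne = trans
      (sym (∑-scale y ne (λ x → h (x , y)) (λ e → h-cong e ≈-refl)))
      (∑-cong 𝔽 (λ x → trans (h-cong ≈-refl (≡⇒≈ (sym (ℤₚ.*-identityʳ y)))) (h-scale y x (+ 1) ne)))

  J : ℤ × ℤ → ℤ
  J s = ∑ ℙ (λ c → χ (Re c) * χ (Re (c ⊗ s)))

  -- For fixed a = Re c, the linear form a s₀ - b s₁ runs through the whole field with b unless s₁ =
  -- 0, and then its χ-sum vanishes. For real s the sum over b gives the factor p and the sum of
  -- χ(a)² the factor p - 1.
  J-value : ∀ s → J s ≡ δ (Im s) * χ (Re s) * (+ p * p-1)
  J-value s@(s₀ , s₁) = begin
    J s
      ≡⟨ ∑-plane (λ c → χ (Re c) * χ (Re (c ⊗ s))) ⟩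
    ∑ 𝔽 (λ a → ∑ 𝔽 (λ b → χ a * χ (Re ((a , b) ⊗ s))))
      ≡⟨ ∑-cong 𝔽 (λ a → trans
           (∑-cong 𝔽 (λ b → cong (λ z → χ a * χ z) (Re-⊗ (a , b) s)))
           (∑-*ˡ 𝔽 (χ a) (λ b → χ (a * s₀ - b * s₁)))) ⟩
    ∑ 𝔽 (λ a → χ a * ∑ 𝔽 (λ b → χ (a * s₀ - b * s₁)))
      ≡⟨ ∑-cong 𝔽 (λ a → trans (cong (χ a *_) (inner a)) (id₁ (χ a) (δ s₁) (χ s₀) (+ p))) ⟩
    ∑ 𝔽 (λ a → χ a * χ a * (δ s₁ * χ s₀ * + p))
      ≡⟨ ∑-*ʳ 𝔽 (δ s₁ * χ s₀ * + p) (λ a → χ a * χ a) ⟩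
    ∑ 𝔽 (λ a → χ a * χ a) * (δ s₁ * χ s₀ * + p)
      ≡⟨ cong (_* (δ s₁ * χ s₀ * + p)) (trans (∑-cong 𝔽 χ²) ∑-1-δ) ⟩
    p-1 * (δ s₁ * χ s₀ * + p)
      ≡⟨ id₂ p-1 (δ s₁ * χ s₀) (+ p) ⟩
    δ s₁ * χ s₀ * (+ p * p-1) ∎
    where
    open ≡-Reasoning
    id₁ : ∀ a d s q → a * (a * (d * s * q)) ≡ a * a * (d * s * q)
    id₁ = solve-∀
    id₂ : ∀ r a q → r * (a * q) ≡ a * (q * r)
    id₂ = solve-∀
    id₃ : ∀ a s₀ s₁ b → a * s₀ - b * s₁ - a * s₀ ≡ - b * (s₁ - + 0)
    id₃ = solve-∀
    id₄ : ∀ a s₀ s₁ b → a * s₀ - b * s₁ ≡ - s₁ * b + a * s₀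
    id₄ = solve-∀
    id₅ : ∀ q a s → q * (a * s) ≡ a * (+ 1 * s * q)
    id₅ = solve-∀
    inner : ∀ a → ∑ 𝔽 (λ b → χ (a * s₀ - b * s₁)) ≡ χ a * (δ s₁ * χ s₀ * + p)
    inner a with s₁ ≈? + 0
    ... | yes e = begin
      ∑ 𝔽 (λ b → χ (a * s₀ - b * s₁))
        ≡⟨ ∑-cong 𝔽 (λ b → trans (χ-resp (from-≈ (- b) e (id₃ a s₀ s₁ b))) (χ-* a s₀)) ⟩
      ∑ 𝔽 (λ _ → χ a * χ s₀)
        ≡⟨ trans (∑-const 𝔽 (χ a * χ s₀)) (cong (λ n → + n * (χ a * χ s₀)) length-𝔽) ⟩
      + p * (χ a * χ s₀)
        ≡⟨ trans (id₅ (+ p) (χ a) (χ s₀)) (cong (λ d → χ a * (d * χ s₀ * + p)) (sym (δ-0 e))) ⟩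
      χ a * (δ s₁ * χ s₀ * + p) ∎
    ... | no ne = begin
      ∑ 𝔽 (λ b → χ (a * s₀ - b * s₁))
        ≡⟨ ∑-cong 𝔽 (λ b → cong χ (id₄ a s₀ s₁ b)) ⟩
      ∑ 𝔽 (λ b → χ (- s₁ * b + a * s₀))
        ≡⟨ trans (∑-affine (- s₁) (a * s₀) (-‿≉0 ne) χ χ-resp) ∑-χ ⟩
      + 0
        ≡⟨ sym (ℤₚ.*-zeroʳ (χ a)) ⟩
      χ a * + 0
        ≡⟨ cong (λ d → χ a * (d * χ s₀ * + p)) (sym (δ-≉0 ne)) ⟩
      χ a * (δ s₁ * χ s₀ * + p) ∎

  -- Here t stands for the ratio z / w of two summation variables; the correlation of ψ at w and at
  -- z depends on w only through the indicator that w is a unit.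
  K : ℤ
  K = ∑ ℙ (λ t → χ (N t) * J (fourth t))

  opaque
    unfolding F Ψ

    ∑-F-expand : ∑ ℙ F ≡ ∑ ℙ (λ w → ∑ ℙ (λ z → ∑ ℙ (λ c → ψ c w * ψ c z)))
    ∑-F-expand = begin
      ∑ ℙ F
        ≡⟨ ∑-cong ℙ (λ c → ∑-product ℙ ℙ (ψ c) (ψ c)) ⟩
      ∑ ℙ (λ c → ∑ ℙ (λ w → ∑ ℙ (λ z → ψ c w * ψ c z)))
        ≡⟨ ∑-swap ℙ ℙ (λ c w → ∑ ℙ (λ z → ψ c w * ψ c z)) ⟩
      ∑ ℙ (λ w → ∑ ℙ (λ c → ∑ ℙ (λ z → ψ c w * ψ c z)))
        ≡⟨ ∑-cong ℙ (λ w → ∑-swap ℙ ℙ (λ c z → ψ c w * ψ c z)) ⟩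
      ∑ ℙ (λ w → ∑ ℙ (λ z → ∑ ℙ (λ c → ψ c w * ψ c z))) ∎
      where open ≡-Reasoning

  N-fourth-unit : ∀ w → N w ≉ + 0 → N (fourth w) ≉ + 0
  N-fourth-unit w ne = ≈-≉0 (≡⇒≈ (trans (cong N (fourth-def w)) (trans (N-⊗ (w ⊗ w) (w ⊗ w))
    (cong (λ z → z * z) (N-⊗ w w))))) (*-≉0 (*-≉0 ne ne) (*-≉0 ne ne))

  -- For a unit w, replace z by w t and c by c / w⁴.
  moment-row : ∀ w → ∑ ℙ (λ z → ∑ ℙ (λ c → ψ c w * ψ c z)) ≡ χ (N w) * χ (N w) * K
  moment-row w with N w ≈? + 0
  ... | yes e = begin
    ∑ ℙ (λ z → ∑ ℙ (λ c → ψ c w * ψ c z))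
      ≡⟨ ∑-cong ℙ (λ z → ∑-cong ℙ (λ c →
           cong (λ u → u * χ (Re (c ⊗ fourth w)) * ψ c z) (χ-zero e))) ⟩
    ∑ ℙ (λ z → ∑ ℙ (λ c → + 0))
      ≡⟨ trans (∑-cong ℙ (λ _ → ∑-0 ℙ)) (∑-0 ℙ) ⟩
    + 0
      ≡⟨ cong (λ u → u * u * K) (sym (χ-zero e)) ⟩
    χ (N w) * χ (N w) * K ∎
    where open ≡-Reasoning
  ... | no ne = begin
    ∑ ℙ (λ z → ∑ ℙ (λ c → ψ c w * ψ c z))
      ≡⟨ sym (∑-⊗ w ne (λ z → ∑ ℙ (λ c → ψ c w * ψ c z))
           (λ e → ∑-cong ℙ (λ c → cong (ψ c w *_) (ψ-resp (≋-refl {c}) e)))) ⟩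
    ∑ ℙ (λ t → ∑ ℙ (λ c → ψ c w * ψ c (w ⊗ t)))
      ≡⟨ ∑-cong ℙ column ⟩
    ∑ ℙ (λ t → χ (N w) * χ (N w) * (χ (N t) * J (fourth t)))
      ≡⟨ ∑-*ˡ ℙ (χ (N w) * χ (N w)) (λ t → χ (N t) * J (fourth t)) ⟩
    χ (N w) * χ (N w) * K ∎
    where
    open ≡-Reasoning
    jj : ℤ × ℤ → ℤ × ℤ → ℤ
    jj t c = χ (Re c) * χ (Re (c ⊗ fourth t))
    jj-resp : ∀ t → Respects² (jj t)
    jj-resp t (e ∥ f) = cong₂ _*_ (χ-resp e) (χ-resp (_≋_.re≈ (⊗-congʳ (fourth t) (e ∥ f))))
    id₁ : ∀ n t a b → n * a * (n * t * b) ≡ n * n * t * (a * b)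
    id₁ = solve-∀
    term : ∀ t c → ψ c w * ψ c (w ⊗ t) ≡ χ (N w) * χ (N w) * χ (N t) * jj t (fourth w ⊗ c)
    term t c = trans
      (cong₂ (λ n z → χ (N w) * χ (Re (c ⊗ fourth w)) * (n * χ (Re z))) (χN-⊗ w t)
        (trans (cong (c ⊗_) (fourth-⊗ w t)) (sym (⊗-assoc c (fourth w) (fourth t)))))
      (trans (id₁ (χ (N w)) (χ (N t)) (χ (Re (c ⊗ fourth w))) (χ (Re (c ⊗ fourth w ⊗ fourth t))))
        (cong (λ z → χ (N w) * χ (N w) * χ (N t) * jj t z) (⊗-comm c (fourth w))))
    column : ∀ t → ∑ ℙ (λ c → ψ c w * ψ c (w ⊗ t)) ≡ χ (N w) * χ (N w) * (χ (N t) * J (fourth t))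
    column t = begin
      ∑ ℙ (λ c → ψ c w * ψ c (w ⊗ t))
        ≡⟨ trans (∑-cong ℙ (term t)) (∑-*ˡ ℙ (χ (N w) * χ (N w) * χ (N t)) (λ c → jj t (fourth w ⊗ c))) ⟩
      χ (N w) * χ (N w) * χ (N t) * ∑ ℙ (λ c → jj t (fourth w ⊗ c))
        ≡⟨ cong (χ (N w) * χ (N w) * χ (N t) *_)
             (∑-⊗ (fourth w) (N-fourth-unit w ne) (jj t) (jj-resp t)) ⟩
      χ (N w) * χ (N w) * χ (N t) * J (fourth t)
        ≡⟨ ℤₚ.*-assoc (χ (N w) * χ (N w)) (χ (N t)) (J (fourth t)) ⟩
      χ (N w) * χ (N w) * (χ (N t) * J (fourth t)) ∎

  ∑-F : ∑ ℙ F ≡ ∑ ℙ (λ w → χ (N w) * χ (N w)) * K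
  ∑-F = trans ∑-F-expand (trans (∑-cong ℙ moment-row) (∑-*ʳ ℙ K (λ w → χ (N w) * χ (N w))))

  -- The contribution of t to K, up to the factor p (p - 1).
  ℓ : ℤ × ℤ → ℤ
  ℓ t = χ (N t) * (δ (Im (fourth t)) * χ (Re (fourth t)))

  K-ℓ : K ≡ ∑ ℙ ℓ * (+ p * p-1)
  K-ℓ = trans
    (∑-cong ℙ (λ t → trans (cong (χ (N t) *_) (J-value (fourth t)))
      (sym (ℤₚ.*-assoc (χ (N t)) (δ (Im (fourth t)) * χ (Re (fourth t))) (+ p * p-1)))))
    (∑-*ʳ ℙ (+ p * p-1) ℓ)

  ℓ-resp : Respects² ℓ
  ℓ-resp e = cong₂ _*_ (χ-resp (N-cong e))
    (cong₂ _*_ (δ-resp (_≋_.im≈ (fourth-cong e))) (χ-resp (_≋_.re≈ (fourth-cong e))))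

  χ-xx* : ∀ {x} y → x ≉ + 0 → χ (x * x * y) ≡ χ y
  χ-xx* {x} y x≉0 = trans (χ-* (x * x) y) (trans (cong (_* χ y) (χ-xx x≉0)) (ℤₚ.*-identityˡ (χ y)))

  δ-* : ∀ {x} y → x ≉ + 0 → δ (x * y) ≡ δ y
  δ-* {x} y x≉0 = δ-⇔ (*-cancelˡ-0 x≉0) (*-zero x)

  opaque
    unfolding _⊗_ _·_ N fourth

    N-· : ∀ k z → N (k · z) ≡ k * k * N z
    N-· k (a , b) = id′ k a b
      where
      id′ : ∀ k a b → k * a * (k * a) + k * b * (k * b) ≡ k * k * (a * a + b * b)
      id′ = solve-∀

    Im-· : ∀ k z → Im (k · z) ≡ k * Im z
    Im-· k z = refl

    fourth-· : ∀ k z → fourth (k · z) ≡ (k * k * (k * k)) · fourth z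
    fourth-· k z = trans (cong (λ w → w ⊗ w) ·-square)
      (trans (·-⊗ (k * k) (z ⊗ z) ((k * k) · (z ⊗ z))) (trans (cong ((k * k) ·_) (⊗-· (k * k) (z ⊗ z) (z ⊗ z)))
        (·-· (k * k) (k * k) (z ⊗ z ⊗ (z ⊗ z)))))
      where
      ·-square : k · z ⊗ k · z ≡ (k * k) · (z ⊗ z)
      ·-square = trans (·-⊗ k z (k · z)) (trans (cong (k ·_) (⊗-· k z z)) (·-· k k (z ⊗ z)))

    Im-fourth : ∀ x → Im (fourth (x , + 1)) ≡ + 4 * (x * ((x - + 1) * (x + + 1)))
    Im-fourth x = id′ x
      where
      id′ : ∀ x → (x * x - + 1 * + 1) * (x * + 1 + + 1 * x) + (x * + 1 + + 1 * x) * (x * x - + 1 * + 1)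
                ≡ + 4 * (x * ((x - + 1) * (x + + 1)))
      id′ = solve-∀

    ℓ-1-0 : ℓ (+ 1 , + 0) ≡ + 1
    ℓ-1-0 = cong₂ _*_ χ-1 (cong₂ _*_ (δ-0 ≈-refl) χ-1)

    ℓ-0-1 : ℓ (+ 0 , + 1) ≡ + 1
    ℓ-0-1 = cong₂ _*_ χ-1 (cong₂ _*_ (δ-0 ≈-refl) χ-1)

    ℓ-0-0 : ℓ (+ 0 , + 0) ≡ + 0
    ℓ-0-0 = cong (_* (δ (+ 0) * χ (+ 0))) (χ-zero ≈-refl)

    -- Both 1 + i and -1 + i have norm 2 and fourth power -4, so their weight is χ 2 χ (-4) = χ (4
    -- (-2)). This is where the sign χ (-2) enters the moment.
    ℓ-±1 : ∀ {x} → x ≡ + 1 ⊎ x ≡ - (+ 1) → ℓ (x , + 1) ≡ χ (- (+ 2))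
    ℓ-±1 {x} x=±1 = trans (value x=±1) (trans (cong (χ (+ 2) *_) (trans (cong (_* χ (- (+ 4))) (δ-0 ≈-refl))
        (ℤₚ.*-identityˡ (χ (- (+ 4))))))
      (trans (sym (χ-* (+ 2) (- (+ 4)))) (χ-xx* (- (+ 2)) 2≉0)))
      where
      value : x ≡ + 1 ⊎ x ≡ - (+ 1) → ℓ (x , + 1) ≡ χ (+ 2) * (δ (+ 0) * χ (- (+ 4)))
      value (inj₁ refl) = refl
      value (inj₂ refl) = refl

  ℓ-· : ∀ k z → k ≉ + 0 → ℓ (k · z) ≡ ℓ z
  ℓ-· k z k≉0 = cong₂ _*_ (trans (cong χ (N-· k z)) (χ-xx* (N z) k≉0)) (cong₂ _*_
    (trans (cong δ (trans (cong Im (fourth-· k z)) (Im-· (k * k * (k * k)) (fourth z))))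
      (δ-* (Im (fourth z)) (*-≉0 kk≉0 kk≉0)))
    (trans (cong χ (trans (cong Re (fourth-· k z)) (Re-· (k * k * (k * k)) (fourth z))))
      (χ-xx* (Re (fourth z)) kk≉0)))
    where
    kk≉0 : k * k ≉ + 0
    kk≉0 = *-≉0 k≉0 k≉0

  module _ (χ-2 : χ (- (+ 2)) ≡ + 1) where

    1≉-1 : + 1 ≉ - (+ 1)
    1≉-1 (congr k e) = 2≉0 (congr k e)

    -- t⁴ is real for t = x + i only if x = 0, 1 or -1.
    ℓ-x-1 : ∀ x → ℓ (x , + 1) ≡ δ (+ 0 - x) + (δ (+ 1 - x) + δ (- (+ 1) - x))
    ℓ-x-1 x with x ≈? + 0 | x ≈? + 1 | x ≈? - (+ 1)
    ... | yes e | yes e′ | _      = contradiction (≈-trans (≈-sym e′) e) 1≉0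
    ... | yes e | no _   | yes e′ = contradiction (≈-trans (≈-sym e′) e) (-‿≉0 1≉0)
    ... | no _  | yes e  | yes e′ = contradiction (≈-trans (≈-sym e) e′) 1≉-1
    ... | yes e | no n₁  | no n₂  = trans (trans (ℓ-resp (e ∥ ≈-refl)) ℓ-0-1)
          (sym (cong₂ _+_ (δ-pos e) (cong₂ _+_ (δ-neg n₁) (δ-neg n₂))))
    ... | no n₁ | yes e  | no n₂  = trans (trans (ℓ-resp (e ∥ ≈-refl)) (trans (ℓ-±1 (inj₁ refl)) χ-2))
          (sym (cong₂ _+_ (δ-neg n₁) (cong₂ _+_ (δ-pos e) (δ-neg n₂))))
    ... | no n₁ | no n₂  | yes e  = trans (trans (ℓ-resp (e ∥ ≈-refl)) (trans (ℓ-±1 (inj₂ refl)) χ-2))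
          (sym (cong₂ _+_ (δ-neg n₁) (cong₂ _+_ (δ-neg n₂) (δ-pos e))))
    ... | no n₁ | no n₂  | no n₃  = trans
          (trans (cong (λ d → χ (N (x , + 1)) * (d * χ (Re (fourth (x , + 1)))))
            (trans (cong δ (Im-fourth x)) (δ-≉0 (*-≉0 4≉0 (*-≉0 n₁ (*-≉0
              (λ e → n₂ (a-b≈0⇒a≈b e)) (λ e → n₃ (a-b≈0⇒a≈b {x} { - (+ 1)} e))))))))
            (ℤₚ.*-zeroʳ (χ (N (x , + 1)))))
          (sym (cong₂ _+_ (δ-neg n₁) (cong₂ _+_ (δ-neg n₂) (δ-neg n₃))))

    ∑-ℓ : ∑ ℙ ℓ ≡ p-1 * + 4
    ∑-ℓ = trans (∑-homogeneous ℓ ℓ-resp ℓ-0-0 ℓ-·) (cong (p-1 *_) (cong₂ _+_ ℓ-1-0 (begin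
      ∑ 𝔽 (λ x → ℓ (x , + 1))
        ≡⟨ ∑-cong 𝔽 ℓ-x-1 ⟩
      ∑ 𝔽 (λ x → δ (+ 0 - x) + (δ (+ 1 - x) + δ (- (+ 1) - x)))
        ≡⟨ ∑-+ 𝔽 (λ x → δ (+ 0 - x)) (λ x → δ (+ 1 - x) + δ (- (+ 1) - x)) ⟩
      ∑ 𝔽 (λ x → δ (+ 0 - x)) + ∑ 𝔽 (λ x → δ (+ 1 - x) + δ (- (+ 1) - x))
        ≡⟨ cong₂ _+_ (∑-δ (+ 0)) (trans (∑-+ 𝔽 (λ x → δ (+ 1 - x)) (λ x → δ (- (+ 1) - x)))
             (cong₂ _+_ (∑-δ (+ 1)) (∑-δ (- (+ 1))))) ⟩
      + 3 ∎)))
      where open ≡-Reasoning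

    ∑-F-value : ∑ ℙ F ≡ ∑ ℙ (λ w → χ (N w) * χ (N w)) * (p-1 * + 4 * (+ p * p-1))
    ∑-F-value = trans ∑-F (cong (∑ ℙ (λ w → χ (N w) * χ (N w)) *_)
      (trans K-ℓ (cong (_* (+ p * p-1)) ∑-ℓ)))

-- Integrality of A and B by repeated halving.

private
  2∣z*z⇒2∣z : ∀ z k → z * z ≡ + 2 * k → ∃ λ m → z ≡ + 2 * m
  2∣z*z⇒2∣z z k e = quotient , trans equality (ℤₚ.*-comm quotient (+ 2))
    where
    2∣∣z∣∣z∣ : 2 ∣.∣ ℤ.∣ z ∣ ℕ.* ℤ.∣ z ∣
    2∣∣z∣∣z∣ = ∣.divides ℤ.∣ k ∣ (trans (sym (ℤₚ.abs-* z z)) (trans (cong ℤ.∣_∣ e)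
      (trans (ℤₚ.abs-* (+ 2) k) (ℕₚ.*-comm 2 ℤ.∣ k ∣))))
    2∣∣z∣ : 2 ∣.∣ ℤ.∣ z ∣
    2∣∣z∣ = [ id , id ]′ (euclidsLemma ℤ.∣ z ∣ ℤ.∣ z ∣ prime[2] 2∣∣z∣∣z∣)
    open Signed._∣_ (Signed.∣ᵤ⇒∣ {+ 2} {z} 2∣∣z∣)

  scale-eq : ∀ k {a b u v} .{{_ : ℤ.NonZero k}} → u ≡ v → u ≡ k * a → v ≡ k * b → a ≡ b
  scale-eq k {a} {b} e e₁ e₂ = ℤₚ.*-cancelˡ-≡ k a b (trans (sym e₁) (trans e e₂))

-- Dividing the identity by 2 shows that T² is even. Substituting T = 2 T′ and dividing by 4 shows
-- the same for S², and substituting S = 2 A and dividing by 8 shows it for T′². So S = 2 A and T =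
-- 4 B are consequences of the identity itself.
integrality : ∀ S T {q} → + 2 * S * (+ 2 * S) + + 2 * (T * T) ≡ + 16 * q →
              ∃ λ A → ∃ λ B → + 2 * A ≡ S × + 4 * B ≡ T × A * A + + 2 * (B * B) ≡ q
integrality S T {q} e =
  let (T′ , T≡2T′)  = 2∣z*z⇒2∣z T (+ 4 * q - S * S)
                        (scale-eq (+ 2) (cong (_- + 4 * (S * S)) e) (id₁ S T) (id₂ S q))
      (A , S≡2A)    = 2∣z*z⇒2∣z S (+ 2 * q - T′ * T′)
                        (scale-eq (+ 4) (cong (_- + 8 * (T′ * T′)) (at refl T≡2T′)) (id₃ S T′) (id₄ T′ q))
      (B , T′≡2B)   = 2∣z*z⇒2∣z T′ (q - A * A)
                        (scale-eq (+ 8) (cong (_- + 16 * (A * A)) (at S≡2A T≡2T′)) (id₅ A T′) (id₆ A q))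
      T≡2[2B]       = trans T≡2T′ (cong (+ 2 *_) T′≡2B)
  in A , B , sym S≡2A , trans (ℤₚ.*-assoc (+ 2) (+ 2) B) (sym T≡2[2B]) ,
     scale-eq (+ 16) (at S≡2A T≡2[2B]) (id₇ A B) refl
  where
  at : ∀ {S′ T′} → S ≡ S′ → T ≡ T′ → + 2 * S′ * (+ 2 * S′) + + 2 * (T′ * T′) ≡ + 16 * q
  at S≡ T≡ = trans (cong₂ (λ s t → + 2 * s * (+ 2 * s) + + 2 * (t * t)) (sym S≡) (sym T≡)) e
  id₁ : ∀ S T → + 2 * S * (+ 2 * S) + + 2 * (T * T) - + 4 * (S * S) ≡ + 2 * (T * T)
  id₁ = solve-∀
  id₂ : ∀ S q → + 16 * q - + 4 * (S * S) ≡ + 2 * (+ 2 * (+ 4 * q - S * S))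
  id₂ = solve-∀
  id₃ : ∀ S T → + 2 * S * (+ 2 * S) + + 2 * (+ 2 * T * (+ 2 * T)) - + 8 * (T * T) ≡ + 4 * (S * S)
  id₃ = solve-∀
  id₄ : ∀ T q → + 16 * q - + 8 * (T * T) ≡ + 4 * (+ 2 * (+ 2 * q - T * T))
  id₄ = solve-∀
  id₅ : ∀ A T → + 2 * (+ 2 * A) * (+ 2 * (+ 2 * A)) + + 2 * (+ 2 * T * (+ 2 * T)) - + 16 * (A * A) ≡ + 8 * (T * T)
  id₅ = solve-∀
  id₆ : ∀ A q → + 16 * q - + 16 * (A * A) ≡ + 8 * (+ 2 * (q - A * A))
  id₆ = solve-∀
  id₇ : ∀ A B → + 2 * (+ 2 * A) * (+ 2 * (+ 2 * A)) + + 2 * (+ 2 * (+ 2 * B) * (+ 2 * (+ 2 * B)))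
              ≡ + 16 * (A * A + + 2 * (B * B))
  id₇ = solve-∀

-- Comparison of the two evaluations, and Ψ as a sum over the affine line.

module NormIdentity (p : ℕ) .{{_ : NonZero p}} (p-prime : Prime p)
                    (2≉0 : Congruence._≉_ p (+ 2) (+ 0))
                    (χ-2 : PrimeField.χ p p-prime 2≉0 (- (+ 2)) ≡ + 1) where
  open Congruence p
  open PrimeField p p-prime 2≉0
  open GaussianPlane p p-prime 2≉0
  open SecondMoment p p-prime 2≉0

  private
    p-1≢0 : ¬ (p-1 ≡ + 0)
    p-1≢0 e = 1≉0 (≈-trans (≡⇒≈ (trans (sym (id′ (+ p))) (trans (cong (λ z → + p - z) e) (ℤₚ.+-identityʳ (+ p)))))
      (congr (+ 1) (trans (ℤₚ.+-identityʳ (+ p)) (sym (ℤₚ.*-identityˡ (+ p))))))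
      where
      id′ : ∀ z → z - (z - + 1) ≡ + 1
      id′ = solve-∀

  -- Both evaluations of the sum of F contain the number U of units, which is therefore cancelled
  -- rather than computed; it is nonzero because 1 is a unit. The square of p - 1 is cancelled
  -- likewise.
  norm-identity : ∀ d → χ (N d) ≡ - (+ 1) → ∀ P Q → Ψ 1ᴳ ≡ p-1 * P → Ψ d ≡ p-1 * Q →
                  P * P + + 2 * (Q * Q) ≡ + 16 * + p
  norm-identity d χNd P Q ΨP ΨQ = ℤₚ.*-cancelˡ-≡ (p-1 * p-1) _ _ (ℤₚ.*-cancelˡ-≡ U _ _ (begin
    U * (p-1 * p-1 * (P * P + + 2 * (Q * Q)))
      ≡⟨ cong (U *_) (trans (id₁ p-1 P Q) (cong₂ (λ a b → a + + 2 * b) (sym (F-value ΨP)) (sym (F-value ΨQ)))) ⟩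
    U * (F 1ᴳ + + 2 * F d)
      ≡⟨ sym ∑-F-classes ⟩
    + 4 * ∑ ℙ F
      ≡⟨ cong (+ 4 *_) (trans (∑-F-value χ-2)
           (cong (_* (p-1 * + 4 * (+ p * p-1))) (∑-cong ℙ (λ w → sym (unit-def w))))) ⟩
    + 4 * (U * (p-1 * + 4 * (+ p * p-1)))
      ≡⟨ id₂ U p-1 (+ p) ⟩
    U * (p-1 * p-1 * (+ 16 * + p)) ∎))
    where
    open ≡-Reasoning
    open TwistClasses p p-prime 2≉0 d χNd
    U : ℤ
    U = ∑ ℙ unit
    F-value : ∀ {c X} → Ψ c ≡ p-1 * X → F c ≡ p-1 * X * (p-1 * X)
    F-value {c} e = trans (F-def c) (cong (λ z → z * z) e)
    id₁ : ∀ q P Q → q * q * (P * P + + 2 * (Q * Q)) ≡ q * P * (q * P) + + 2 * (q * Q * (q * Q))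
    id₁ = solve-∀
    id₂ : ∀ U q r → + 4 * (U * (q * + 4 * (r * q))) ≡ U * (q * q * (+ 16 * r))
    id₂ = solve-∀
    unit-nonneg : ∀ c → + 0 ℤ.≤ unit c
    unit-nonneg c with N c ≈? + 0
    ... | yes e = ℤₚ.≤-reflexive (sym (unit-0 c e))
    ... | no ne = subst (+ 0 ℤ.≤_) (sym (unit-1 c ne)) (ℤ.+≤+ ℕ.z≤n)
    U≢0 : ¬ (U ≡ + 0)
    U≢0 U≡0 = contradiction (trans (sym (unit-1 c Nc≉0)) (∑-nonneg-zero ℙ unit-nonneg U≡0 c∈ℙ)) (λ ())
      where
      -- `∑-nonneg-zero` speaks only of listed elements, so the unit 1 is replaced by its
      -- representative in ℙ.
      a b : ∃ λ z → z ∈ 𝔽 × _ ≈ z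
      a = 𝔽-complete (+ 1)
      b = 𝔽-complete (+ 0)
      c : ℤ × ℤ
      c = proj₁ a , proj₁ b
      c∈ℙ : c ∈ ℙ
      c∈ℙ = ∈-cartesianProduct⁺ (proj₁ (proj₂ a)) (proj₁ (proj₂ b))
      Nc≉0 : N c ≉ + 0
      Nc≉0 = ≈-≉0 (≈-sym (N-cong (proj₂ (proj₂ a) ∥ proj₂ (proj₂ b)))) (≈-≉0 (≡⇒≈ (N-def (+ 1) (+ 0))) 1≉0)
    instance
      U-nonZero : ℤ.NonZero U
      U-nonZero = ℤ.≢-nonZero U≢0
      q-nonZero : ℤ.NonZero (p-1 * p-1)
      q-nonZero = ℤ.≢-nonZero λ e → [ p-1≢0 , p-1≢0 ]′ (ℤₚ.i*j≡0⇒i≡0∨j≡0 p-1 e)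

  -- The real and imaginary parts of (x + i)⁴.
  quartic-re quartic-im : ℤ → ℤ
  quartic-re x = x * x * (x * x) - + 6 * (x * x) + + 1
  quartic-im x = + 4 * (x * x * x) - + 4 * x

  opaque
    unfolding _⊗_ _·_ N fourth

    Re-⊗-fourth : ∀ c x y → Re (c ⊗ fourth (x , y)) ≡
      Re c * (x * x * (x * x) - + 6 * (x * x * (y * y)) + y * y * (y * y))
      - Im c * (+ 4 * (x * x * x * y) - + 4 * (x * (y * y * y)))
    Re-⊗-fourth (a , b) x y = cong₂ (λ u v → a * u - b * v) (re x y) (im x y)
      where
      re : ∀ x y → (x * x - y * y) * (x * x - y * y) - (x * y + y * x) * (x * y + y * x)
                 ≡ x * x * (x * x) - + 6 * (x * x * (y * y)) + y * y * (y * y)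
      re = solve-∀
      im : ∀ x y → (x * x - y * y) * (x * y + y * x) + (x * y + y * x) * (x * x - y * y)
                 ≡ + 4 * (x * x * x * y) - + 4 * (x * (y * y * y))
      im = solve-∀

  Re-⊗-1-0 : ∀ c → Re (c ⊗ fourth (+ 1 , + 0)) ≡ Re c
  Re-⊗-1-0 c = trans (Re-⊗-fourth c (+ 1) (+ 0)) (id′ (Re c) (Im c))
    where
    id′ : ∀ a b → a * + 1 - b * + 0 ≡ a
    id′ = solve-∀

  Re-⊗-x-1 : ∀ c x → Re (c ⊗ fourth (x , + 1)) ≡ Re c * quartic-re x - Im c * quartic-im x
  Re-⊗-x-1 c x = trans (Re-⊗-fourth c x (+ 1)) (id′ (Re c) (Im c) x)
    where
    id′ : ∀ a b x → a * (x * x * (x * x) - + 6 * (x * x * + 1) + + 1) - b * (+ 4 * (x * x * x * + 1) - + 4 * (x * + 1))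
                  ≡ a * (x * x * (x * x) - + 6 * (x * x) + + 1) - b * (+ 4 * (x * x * x) - + 4 * x)
    id′ = solve-∀

  -- Scaling w by k multiplies N w by k² and w⁴ by k⁴, so ψ c lives on the projective line. The term
  -- χ (Re c) is the contribution of the point at infinity w = 1.
  Ψ-affine : ∀ c → Ψ c ≡ p-1 * (χ (Re c) +
    ∑ 𝔽 (λ x → χ ((x * x + + 1) * (Re c * quartic-re x - Im c * quartic-im x))))
  Ψ-affine c = trans (Ψ-∑ c) (trans (∑-homogeneous (ψ c) (ψ-resp (≋-refl {c})) ψ-0 ψ-·)
    (cong (p-1 *_) (cong₂ _+_ ψ-1-0 (∑-cong 𝔽 ψ-x-1))))
    where
    ψ-0 : ψ c (+ 0 , + 0) ≡ + 0
    ψ-0 = cong (_* χ (Re (c ⊗ fourth (+ 0 , + 0)))) (χ-zero (≡⇒≈ (N-def (+ 0) (+ 0))))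
    ψ-1-0 : ψ c (+ 1 , + 0) ≡ χ (Re c)
    ψ-1-0 = trans (cong₂ _*_ (trans (cong χ (N-def (+ 1) (+ 0))) χ-1) (cong χ (Re-⊗-1-0 c)))
      (ℤₚ.*-identityˡ (χ (Re c)))
    ψ-x-1 : ∀ x → ψ c (x , + 1) ≡ χ ((x * x + + 1) * (Re c * quartic-re x - Im c * quartic-im x))
    ψ-x-1 x = trans (cong₂ (λ u v → χ u * χ v) (N-def x (+ 1)) (Re-⊗-x-1 c x))
      (sym (χ-* (x * x + + 1) (Re c * quartic-re x - Im c * quartic-im x)))
    ψ-· : ∀ k z → k ≉ + 0 → ψ c (k · z) ≡ ψ c z
    ψ-· k z k≉0 = cong₂ _*_ (trans (cong χ (N-· k z)) (χ-xx* (N z) k≉0))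
      (trans (cong χ (trans (cong Re (trans (cong (c ⊗_) (fourth-· k z)) (⊗-· (k * k * (k * k)) c (fourth z))))
        (Re-· (k * k * (k * k)) (c ⊗ fourth z)))) (χ-xx* (Re (c ⊗ fourth z)) (*-≉0 k≉0 k≉0)))

-- Identification of the three polynomial sums with values of Ψ.

module CharacterSums (p : ℕ) .{{_ : NonZero p}} (p-prime : Prime p)
                     (2≉0 : Congruence._≉_ p (+ 2) (+ 0))
                     (χ-2 : PrimeField.χ p p-prime 2≉0 (- (+ 2)) ≡ + 1) where
  open Congruence p
  open PrimeField p p-prime 2≉0
  open GaussianPlane p p-prime 2≉0
  open SecondMoment p p-prime 2≉0
  open NormIdentity p p-prime 2≉0 χ-2

  χ-xx*-2* : ∀ {x} y → x ≉ + 0 → χ (x * x * (- (+ 2) * y)) ≡ χ y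
  χ-xx*-2* y x≉0 = trans (χ-xx* (- (+ 2) * y) x≉0)
    (trans (χ-* (- (+ 2)) y) (trans (cong (_* χ y) χ-2) (ℤₚ.*-identityˡ (χ y))))

  cubic : ℤ → ℤ
  cubic x = x * x * x + + 4 * (x * x) + + 2 * x

  S : ℤ
  S = ∑ 𝔽 (λ x → χ (cubic x))

  private
    -- N (x + i) Re (x + i)⁴ as a polynomial in t = x².
    g : ℤ → ℤ
    g t = (t + + 1) * (t * t - + 6 * t + + 1)

    g-cong : ∀ {a b} → a ≈ b → g a ≈ g b
    g-cong e = *-cong (+-cong e (≈-refl {+ 1})) (+-cong (minus-cong (*-cong e e) (*-congˡ (+ 6) e)) (≈-refl {+ 1}))

    -- The substitution t = -2 w - 1 moves the root -1 of g to 0 and turns g into 4 (-2) w (w² + 4 w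
    -- + 2); the factor -2 is harmless as χ (-2) = 1.
    ∑-g : ∑ 𝔽 (λ t → χ (g t)) ≡ S
    ∑-g = trans
      (sym (∑-affine (- (+ 2)) (- (+ 1)) (-‿≉0 2≉0) (λ t → χ (g t)) (λ e → χ-resp (g-cong e))))
      (∑-cong 𝔽 (λ w → trans (cong χ (id′ w)) (χ-xx*-2* (cubic w) 2≉0)))
      where
      id′ : ∀ w → (- (+ 2) * w + - (+ 1) + + 1)
                    * ((- (+ 2) * w + - (+ 1)) * (- (+ 2) * w + - (+ 1)) - + 6 * (- (+ 2) * w + - (+ 1)) + + 1)
                ≡ + 2 * + 2 * (- (+ 2) * (w * w * w + + 4 * (w * w) + + 2 * w))
      id′ = solve-∀

    k : ℤ → ℤ
    k t = χ (t * g t)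

    k-resp : Respects k
    k-resp e = χ-resp (*-cong e (g-cong e))

    t-of : ℤ → ℤ
    t-of y = + 4 * inv (+ 1 * y + + 4) + - (+ 1)

    k-substitute : ∀ y → k (t-of y) ≡ χ (cubic y) + - (+ 1) * δ (- (+ 4) - y)
    k-substitute y with y ≈? - (+ 4)
    -- At y = -4 the default `inv` 0 = 0 gives t = -1, a root of g, whereas the cubic takes the
    -- value -8 with χ (-8) = 1. Hence the correction by -1.
    ... | yes e = trans
      (trans (k-resp (≈-trans (+-cong (*-congˡ (+ 4) (inv-≈0 y+4≈0)) (≈-refl { - (+ 1)})) ≈-refl)) (χ-zero ≈-refl))
      (sym (cong₂ (λ u v → u + - (+ 1) * v) χ-cubic (δ-pos e)))
      where
      id₁ : ∀ y → + 1 * y + + 4 - + 0 ≡ + 1 * (y - - (+ 4))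
      id₁ = solve-∀
      y+4≈0 : + 1 * y + + 4 ≈ + 0
      y+4≈0 = from-≈ (+ 1) e (id₁ y)
      χ-cubic : χ (cubic y) ≡ + 1
      χ-cubic = trans
        (χ-resp (+-cong (+-cong (*-cong (*-cong e e) e) (*-congˡ (+ 4) (*-cong e e))) (*-congˡ (+ 2) e)))
        (trans (χ-xx*-2* (+ 1) 2≉0) χ-1)
    ... | no ne = trans
      (trans (χ-resp (≈-trans (*-cong t≈ (*-congˡ (t + + 1) q≈)) (≡⇒≈ (id₄ m y))))
        (χ-xx*-2* (cubic y) (*-≉0 (*-≉0 4≉0 m≉0) m≉0)))
      (trans (sym (ℤₚ.+-identityʳ (χ (cubic y)))) (cong (λ d → χ (cubic y) + - (+ 1) * d) (sym (δ-neg ne))))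
      where
      m t : ℤ
      m = inv (+ 1 * y + + 4)
      t = t-of y
      id₁ : ∀ y → y - - (+ 4) ≡ + 1 * (+ 1 * y + + 4 - + 0)
      id₁ = solve-∀
      y+4≉0 : + 1 * y + + 4 ≉ + 0
      y+4≉0 e = ne (from-≈ (+ 1) e (id₁ y))
      m≉0 : m ≉ + 0
      m≉0 = inv-≉0 y+4≉0
      id₂ : ∀ m y → + 4 * m + - (+ 1) - - (m * y) ≡ + 1 * ((+ 1 * y + + 4) * m - + 1)
      id₂ = solve-∀
      t≈ : t ≈ - (m * y)
      t≈ = from-≈ (+ 1) (*-inv y+4≉0) (id₂ m y)
      id₃ : ∀ m y → (+ 4 * m + - (+ 1)) * (+ 4 * m + - (+ 1)) - + 6 * (+ 4 * m + - (+ 1)) + + 1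
                      - + 8 * (m * m) * (y * y + + 4 * y + + 2)
                  ≡ - (+ 8) * (+ 1 + m * y) * ((+ 1 * y + + 4) * m - + 1)
      id₃ = solve-∀
      q≈ : t * t - + 6 * t + + 1 ≈ + 8 * (m * m) * (y * y + + 4 * y + + 2)
      q≈ = from-≈ (- (+ 8) * (+ 1 + m * y)) (*-inv y+4≉0) (id₃ m y)
      id₄ : ∀ m y → - (m * y) * ((+ 4 * m + - (+ 1) + + 1) * (+ 8 * (m * m) * (y * y + + 4 * y + + 2)))
                  ≡ + 4 * m * m * (+ 4 * m * m) * (- (+ 2) * (y * y * y + + 4 * (y * y) + + 2 * y))
      id₄ = solve-∀

    -- The substitution t = 4 / (y + 4) - 1 moves the root t = -1 to infinity.
    ∑-k : ∑ 𝔽 k ≡ S + - (+ 1)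
    ∑-k = begin
      ∑ 𝔽 k
        ≡⟨ sym (∑-affine (+ 4) (- (+ 1)) 4≉0 k k-resp) ⟩
      ∑ 𝔽 (λ v → k (+ 4 * v + - (+ 1)))
        ≡⟨ sym (∑-inv (λ v → k (+ 4 * v + - (+ 1))) k₁-resp) ⟩
      ∑ 𝔽 (λ v → k (+ 4 * inv v + - (+ 1)))
        ≡⟨ sym (∑-affine (+ 1) (+ 4) 1≉0 (λ v → k (+ 4 * inv v + - (+ 1))) (λ e → k₁-resp (inv-cong e))) ⟩
      ∑ 𝔽 (λ y → k (t-of y))
        ≡⟨ trans (∑-cong 𝔽 k-substitute) (∑-+ 𝔽 (λ y → χ (cubic y)) (λ y → - (+ 1) * δ (- (+ 4) - y))) ⟩
      S + ∑ 𝔽 (λ y → - (+ 1) * δ (- (+ 4) - y))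
        ≡⟨ cong (ℤ._+_ S) (trans (∑-*ˡ 𝔽 (- (+ 1)) (λ y → δ (- (+ 4) - y)))
             (cong (- (+ 1) *_) (∑-δ (- (+ 4))))) ⟩
      S + - (+ 1) ∎
      where
      open ≡-Reasoning
      k₁-resp : Respects (λ v → k (+ 4 * v + - (+ 1)))
      k₁-resp e = k-resp (+-cong (*-congˡ (+ 4) e) (≈-refl { - (+ 1)}))

  -- For c = 1 the variable x occurs only through x², so the sum splits into one over g t and one
  -- over t g t. Each gives S, and the 1 from infinity cancels the -1 in `∑-k`.
  Ψ-1ᴳ : Ψ 1ᴳ ≡ p-1 * (+ 2 * S)
  Ψ-1ᴳ = trans (cong Ψ 1ᴳ-def) (trans (Ψ-affine (+ 1 , + 0)) (cong (p-1 *_) (begin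
    χ (+ 1) + ∑ 𝔽 (λ x → χ ((x * x + + 1) * (+ 1 * quartic-re x - + 0 * quartic-im x)))
      ≡⟨ cong₂ _+_ χ-1 (∑-cong 𝔽 (λ x → cong χ (id₁ x (quartic-im x)))) ⟩
    + 1 + ∑ 𝔽 (λ x → χ (g (x * x)))
      ≡⟨ cong (ℤ._+_ (+ 1)) (∑-squares (λ t → χ (g t)) (λ e → χ-resp (g-cong e))) ⟩
    + 1 + (∑ 𝔽 (λ t → χ (g t)) + ∑ 𝔽 (λ t → χ t * χ (g t)))
      ≡⟨ cong₂ (λ u v → + 1 + (u + v)) ∑-g (trans (∑-cong 𝔽 (λ t → sym (χ-* t (g t)))) ∑-k) ⟩
    + 1 + (S + (S + - (+ 1)))
      ≡⟨ id₂ S ⟩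
    + 2 * S ∎)))
    where
    open ≡-Reasoning
    id₁ : ∀ x j → (x * x + + 1) * (+ 1 * (x * x * (x * x) - + 6 * (x * x) + + 1) - + 0 * j)
                ≡ (x * x + + 1) * (x * x * (x * x) - + 6 * (x * x) + + 1)
    id₁ = solve-∀
    id₂ : ∀ s → + 1 + (s + (s + - (+ 1))) ≡ + 2 * s
    id₂ = solve-∀

  -- It factors as (x² - 2)(x⁴ + 4 x³ + 12 x² + 8 x + 4): the first factor will become the norm, the
  -- second the real part of a twisted fourth power.
  sextic : ℤ → ℤ
  sextic x = x * x * x * (x * x * x) + + 4 * (x * x * (x * x * x)) + + 10 * (x * x * (x * x))
             - + 20 * (x * x) - + 16 * x - + 8

  -- With s² = -2, the substitution x = s y turns x² - 2 into -2 (y² + 1).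
  sextic-identity : χ (+ 2) ≡ - (+ 1) → let T = + 1 + ∑ 𝔽 (λ x → χ (sextic x)) in
                    + 2 * S * (+ 2 * S) + + 2 * (T * T) ≡ + 16 * + p
  sextic-identity χ2 with χ≡1⇒square χ-2
  ... | s , ss≈-2 = norm-identity (+ 1 , h) χNd (+ 2 * S) _ Ψ-1ᴳ (trans (Ψ-affine (+ 1 , h))
      (cong (p-1 *_) (cong₂ _+_ χ-1 (sym ∑-sextic))))
    where
    -- With h = s / 2 the quartic factor of the sextic at s y is 4 Re ((1 + h i)(y + i)⁴), where i
    -- is the imaginary unit of R. Moreover h² = -1/2, so 1 + h i has norm 1/2, a nonsquare because
    -- χ 2 = -1.
    h : ℤ
    h = s * inv (+ 2)
    s≉0 : s ≉ + 0
    s≉0 = ≉0-*ˡ {s} {s} (≈-≉0 ss≈-2 (-‿≉0 2≉0))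
    id₀ : ∀ s i → + 2 * (s * i) - s ≡ s * (+ 2 * i - + 1)
    id₀ = solve-∀
    2h≈s : + 2 * h ≈ s
    2h≈s = from-≈ s (*-inv 2≉0) (id₀ s (inv (+ 2)))
    id₁ : ∀ s h → + 2 * + 2 * (+ 1 * + 1 + h * h) - + 2 ≡ (+ 2 * h + s) * (+ 2 * h - s) + + 1 * (s * s - - (+ 2))
    id₁ = solve-∀
    χNd : χ (N (+ 1 , h)) ≡ - (+ 1)
    χNd = trans (cong χ (N-def (+ 1) h)) (trans (sym (χ-xx* (+ 1 * + 1 + h * h) 2≉0))
      (trans (χ-resp (from-≈₂ (+ 2 * h + s) (+ 1) 2h≈s ss≈-2 (id₁ s h))) χ2))
    sextic-cong : ∀ {a b} → a ≈ b → sextic a ≈ sextic b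
    sextic-cong e = minus-cong (minus-cong (minus-cong (+-cong (+-cong
      (*-cong eee eee) (*-congˡ (+ 4) (*-cong ee eee))) (*-congˡ (+ 10) (*-cong ee ee)))
      (*-congˡ (+ 20) ee)) (*-congˡ (+ 16) e)) (≈-refl {+ 8})
      where
      ee = *-cong e e
      eee = *-cong ee e
    id₂ : ∀ s h y →
      (s * y * (s * y) * (s * y) * (s * y * (s * y) * (s * y))
        + + 4 * (s * y * (s * y) * (s * y * (s * y) * (s * y)))
        + + 10 * (s * y * (s * y) * (s * y * (s * y))) - + 20 * (s * y * (s * y)) - + 16 * (s * y) - + 8)
      - + 2 * + 2 * (- (+ 2) * ((y * y + + 1)
          * (+ 1 * (y * y * (y * y) - + 6 * (y * y) + + 1) - h * (+ 4 * (y * y * y) - + 4 * y))))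
      ≡ ((s * s * (s * s) - + 2 * (s * s) + + 4) * (y * y * y * (y * y * y))
          + + 4 * s * (s * s - + 2) * (y * y * (y * y * y))
          + + 10 * (s * s - + 2) * (y * y * (y * y)) - + 20 * (y * y)) * (s * s - - (+ 2))
        + - (+ 16) * ((y * y + + 1) * (y * y * y - y)) * (+ 2 * h - s)
    id₂ = solve-∀
    cofactor : ℤ → ℤ
    cofactor y = (s * s * (s * s) - + 2 * (s * s) + + 4) * (y * y * y * (y * y * y))
      + + 4 * s * (s * s - + 2) * (y * y * (y * y * y)) + + 10 * (s * s - + 2) * (y * y * (y * y)) - + 20 * (y * y)
    ∑-sextic : ∑ 𝔽 (λ x → χ (sextic x)) ≡ ∑ 𝔽 (λ y → χ ((y * y + + 1) * (+ 1 * quartic-re y - h * quartic-im y)))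
    ∑-sextic = trans (sym (∑-scale s s≉0 (λ x → χ (sextic x)) (λ e → χ-resp (sextic-cong e))))
      (∑-cong 𝔽 (λ y → trans
        (χ-resp (from-≈₂ (cofactor y) (- (+ 16) * ((y * y + + 1) * (y * y * y - y))) ss≈-2 2h≈s (id₂ s h y)))
        (χ-xx*-2* ((y * y + + 1) * (+ 1 * quartic-re y - h * quartic-im y)) 2≉0)))

  quintic : ℤ → ℤ → ℤ
  quintic n x = x * (x * x * (x * x) + n)

  -- With i² = -1, the substitution (x , y) ↦ (x + i y , x - i y) turns x y into x² + y².
  quintic-identity : χ (- (+ 1)) ≡ + 1 → ∀ n → χ n ≡ - (+ 1) → let T = ∑ 𝔽 (λ x → χ (quintic n x)) in
                     + 2 * S * (+ 2 * S) + + 2 * (T * T) ≡ + 16 * + p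
  quintic-identity χ-1≡1 n χn with χ≡1⇒square χ-1≡1
  ... | i , ii≈-1 = norm-identity d χNd (+ 2 * S) _ Ψ-1ᴳ (trans Ψ-d ∑-g₂)
    where
    -- Chosen such that Re (d w⁴) = (x + i y)⁴ + n (x - i y)⁴ for w = (x , y), with i the root of -1
    -- in the prime field. Its norm is (1 + n)² - (1 - n)² = 4 n, a nonsquare like n.
    d : ℤ × ℤ
    d = + 1 + n , - (i * (+ 1 - n))
    id₁ : ∀ i n → ((+ 1 + n) * (+ 1 + n) + - (i * (+ 1 - n)) * - (i * (+ 1 - n))) - + 2 * + 2 * n
                ≡ (+ 1 - n) * (+ 1 - n) * (i * i - - (+ 1))
    id₁ = solve-∀
    χNd : χ (N d) ≡ - (+ 1)
    χNd = trans (cong χ (N-def (+ 1 + n) (- (i * (+ 1 - n)))))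
      (trans (χ-resp (from-≈ ((+ 1 - n) * (+ 1 - n)) ii≈-1 (id₁ i n))) (trans (χ-xx* n 2≉0) χn))
    g₂ : ℤ × ℤ → ℤ
    g₂ (x , y) = χ (x * y) * χ (x * x * (x * x) + n * (y * y * (y * y)))
    g₂-resp : Respects² g₂
    g₂-resp (e ∥ f) = cong₂ _*_ (χ-resp (*-cong e f)) (χ-resp (+-cong (*-cong (*-cong e e) (*-cong e e))
      (*-congˡ n (*-cong (*-cong f f) (*-cong f f)))))
    g₂-0 : g₂ (+ 0 , + 0) ≡ + 0
    g₂-0 = cong (_* χ (+ 0 * + 0 * (+ 0 * + 0) + n * (+ 0 * + 0 * (+ 0 * + 0)))) (χ-zero ≈-refl)
    g₂-· : ∀ k z → k ≉ + 0 → g₂ (k · z) ≡ g₂ z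
    g₂-· k (x , y) k≉0 = trans (cong g₂ (·-def k x y)) (cong₂ _*_
      (trans (cong χ (id₂ k x y)) (χ-xx* (x * y) k≉0))
      (trans (cong χ (id₃ k x y n)) (χ-xx* (x * x * (x * x) + n * (y * y * (y * y))) (*-≉0 k≉0 k≉0))))
      where
      id₂ : ∀ k x y → k * x * (k * y) ≡ k * k * (x * y)
      id₂ = solve-∀
      id₃ : ∀ k x y n → k * x * (k * x) * (k * x * (k * x)) + n * (k * y * (k * y) * (k * y * (k * y)))
                      ≡ k * k * (k * k) * (x * x * (x * x) + n * (y * y * (y * y)))
      id₃ = solve-∀
    -- The point at infinity (1 , 0) contributes nothing, because x y vanishes there. In the sextic
    -- case it contributes χ 1, which is the summand 1 in the definition of B.
    ∑-g₂ : ∑ ℙ g₂ ≡ p-1 * ∑ 𝔽 (λ x → χ (quintic n x))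
    ∑-g₂ = trans (∑-homogeneous g₂ g₂-resp g₂-0 g₂-·) (cong (p-1 *_) (trans
      (cong₂ _+_
        (cong (_* χ (+ 1 * + 1 * (+ 1 * + 1) + n * (+ 0 * + 0 * (+ 0 * + 0)))) (χ-zero {+ 1 * + 0} ≈-refl))
        (∑-cong 𝔽 (λ x → trans (sym (χ-* (x * + 1) (x * x * (x * x) + n * (+ 1 * + 1 * (+ 1 * + 1)))))
          (cong χ (id₂ x n)))))
      (ℤₚ.+-identityˡ (∑ 𝔽 (λ x → χ (quintic n x))))))
      where
      id₂ : ∀ x n → x * + 1 * (x * x * (x * x) + n * (+ 1 * + 1 * (+ 1 * + 1))) ≡ x * (x * x * (x * x) + n)
      id₂ = solve-∀
    σ τ : ℤ × ℤ → ℤ × ℤ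
    σ (x , y) = x + i * y , x - i * y
    τ (u , v) = inv (+ 2) * (u + v) , - (i * inv (+ 2)) * (u - v)
    σ-cong : ∀ {z w} → z ≋ w → σ z ≋ σ w
    σ-cong (e ∥ f) = +-cong e (*-congˡ i f) ∥ minus-cong e (*-congˡ i f)
    τ-cong : ∀ {z w} → z ≋ w → τ z ≋ τ w
    τ-cong (e ∥ f) = *-congˡ (inv (+ 2)) (+-cong e f) ∥ *-congˡ (- (i * inv (+ 2))) (minus-cong e f)
    στ : ∀ z → σ (τ z) ≋ z
    στ (u , v) = from-≈₂ u (- h * (u - v)) (*-inv 2≉0) ii≈-1 (id₂ i h u v)
               ∥ from-≈₂ v (h * (u - v)) (*-inv 2≉0) ii≈-1 (id₃ i h u v)
      where
      h = inv (+ 2)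
      id₂ : ∀ i h u v → h * (u + v) + i * (- (i * h) * (u - v)) - u
                      ≡ u * (+ 2 * h - + 1) + - h * (u - v) * (i * i - - (+ 1))
      id₂ = solve-∀
      id₃ : ∀ i h u v → h * (u + v) - i * (- (i * h) * (u - v)) - v
                      ≡ v * (+ 2 * h - + 1) + h * (u - v) * (i * i - - (+ 1))
      id₃ = solve-∀
    τσ : ∀ z → τ (σ z) ≋ z
    τσ (x , y) = from-≈ x (*-inv 2≉0) (id₂ i h x y)
               ∥ from-≈₂ y (- (+ 2 * h * y)) (*-inv 2≉0) ii≈-1 (id₃ i h x y)
      where
      h = inv (+ 2)
      id₂ : ∀ i h x y → h * ((x + i * y) + (x - i * y)) - x ≡ x * (+ 2 * h - + 1)
      id₂ = solve-∀
      id₃ : ∀ i h x y → - (i * h) * ((x + i * y) - (x - i * y)) - y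
                      ≡ y * (+ 2 * h - + 1) + - (+ 2 * h * y) * (i * i - - (+ 1))
      id₃ = solve-∀
    Ψ-d : Ψ d ≡ ∑ ℙ g₂
    Ψ-d = trans (Ψ-∑ d) (trans (∑-cong ℙ pointwise) (∑-bijection σ τ σ-cong τ-cong στ τσ g₂ g₂-resp))
      where
      pointwise : ∀ z → ψ d z ≡ g₂ (σ z)
      pointwise (x , y) = cong₂ _*_
        (trans (cong χ (N-def x y)) (χ-resp (from-≈ (y * y) ii≈-1 (id₂ i x y))))
        (trans (cong χ (Re-⊗-fourth d x y)) (χ-resp
          (from-≈ (- (+ 1) * (plus i x y + n * plus (- i) x y)) ii≈-1 (id₃ i x y n))))
        where
        plus : ℤ → ℤ → ℤ → ℤ
        plus i x y = + 6 * (x * x * (y * y)) + + 4 * i * (x * (y * y * y)) + (i * i - + 1) * (y * y * (y * y))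
        id₂ : ∀ i x y → x * x + y * y - (x + i * y) * (x - i * y) ≡ y * y * (i * i - - (+ 1))
        id₂ = solve-∀
        id₃ : ∀ i x y n →
          ((+ 1 + n) * (x * x * (x * x) - + 6 * (x * x * (y * y)) + y * y * (y * y))
            - - (i * (+ 1 - n)) * (+ 4 * (x * x * x * y) - + 4 * (x * (y * y * y))))
          - ((x + i * y) * (x + i * y) * ((x + i * y) * (x + i * y))
              + n * ((x - i * y) * (x - i * y) * ((x - i * y) * (x - i * y))))
          ≡ - (+ 1) * ((+ 6 * (x * x * (y * y)) + + 4 * i * (x * (y * y * y)) + (i * i - + 1) * (y * y * (y * y)))
                        + n * (+ 6 * (x * x * (y * y)) + + 4 * - i * (x * (y * y * y))
                                + (- i * - i - + 1) * (y * y * (y * y))))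
            * (i * i - - (+ 1))
        id₃ = solve-∀

prime≢2⇒2≉0 : ∀ p .{{_ : NonZero p}} → Prime p → ¬ (p ≡ 2) → Congruence._≉_ p (+ 2) (+ 0)
prime≢2⇒2≉0 p p-prime p≢2 (Congruence.congr k e)
  with irreducible[2] (∣.divides ℤ.∣ k ∣ (trans (cong ℤ.∣_∣ e) (ℤₚ.abs-* k (+ p))))
... | inj₁ refl = ¬prime[1] p-prime
... | inj₂ p≡2  = p≢2 p≡2

-- Return to the Legendre sums of the statement.

module LegendreSums (p : ℕ) .{{_ : NonZero p}} (p-prime : Prime p)
                    (2≉0 : Congruence._≉_ p (+ 2) (+ 0))
                    (χ-2 : PrimeField.χ p p-prime 2≉0 (- (+ 2)) ≡ + 1) where
  open Congruence p
  open PrimeField p p-prime 2≉0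
  open CharacterSums p p-prime 2≉0 χ-2

  legendreSum-χ : ∀ (f g : ℤ → ℤ) → (∀ x → f x ≡ g x) → ∑ 𝔽 (λ x → χ (g x)) ≡ legendreSum p f
  legendreSum-χ f g f≗g = trans
    (∑-cong 𝔽 (λ x → trans (cong χ (sym (f≗g x))) (χ≡legendre (f x)))) (sym (∑-legendre f))

  cubic-sum : S ≡ legendreSum p (λ x → x ^ 3 + + 4 * x ^ 2 + + 2 * x)
  cubic-sum = legendreSum-χ _ cubic id′
    where
    id′ : ∀ x → x * (x * (x * + 1)) + + 4 * (x * (x * + 1)) + + 2 * x ≡ x * x * x + + 4 * (x * x) + + 2 * x
    id′ = solve-∀

  quintic-sum : ∀ n → ∑ 𝔽 (λ x → χ (quintic n x)) ≡ legendreSum p (λ x → x ^ 5 + n * x)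
  quintic-sum n = legendreSum-χ _ (quintic n) (λ x → id′ x n)
    where
    id′ : ∀ x n → x * (x * (x * (x * (x * + 1)))) + n * x ≡ x * (x * x * (x * x) + n)
    id′ = solve-∀

  sextic-sum : ∑ 𝔽 (λ x → χ (sextic x)) ≡
    legendreSum p (λ x → x ^ 6 + + 4 * x ^ 5 + + 10 * x ^ 4 - + 20 * x ^ 2 - + 16 * x - + 8)
  sextic-sum = legendreSum-χ _ sextic id′
    where
    id′ : ∀ x → x * (x * (x * (x * (x * (x * + 1))))) + + 4 * (x * (x * (x * (x * (x * + 1)))))
                  + + 10 * (x * (x * (x * (x * + 1)))) - + 20 * (x * (x * + 1)) - + 16 * x - + 8
              ≡ x * x * x * (x * x * x) + + 4 * (x * x * (x * x * x)) + + 10 * (x * x * (x * x))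
                  - + 20 * (x * x) - + 16 * x - + 8
    id′ = solve-∀

  quintic-case : χ (- (+ 1)) ≡ + 1 → ∀ n → χ n ≡ - (+ 1) → ∃ λ A → ∃ λ B →
    (+ 2 * A ≡ legendreSum p (λ x → x ^ 3 + + 4 * x ^ 2 + + 2 * x))
    × (+ 4 * B ≡ legendreSum p (λ x → x ^ 5 + n * x))
    × (A * A + + 2 * (B * B) ≡ + p)
  quintic-case χ-1≡1 n χn = integrality _ _
    (subst₂ (λ s t → + 2 * s * (+ 2 * s) + + 2 * (t * t) ≡ + 16 * + p)
      cubic-sum (quintic-sum n) (quintic-identity χ-1≡1 n χn))

  sextic-case : χ (+ 2) ≡ - (+ 1) → ∃ λ A → ∃ λ B →
    (+ 2 * A ≡ legendreSum p (λ x → x ^ 3 + + 4 * x ^ 2 + + 2 * x))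
    × (+ 4 * B ≡ + 1 + legendreSum p (λ x → x ^ 6 + + 4 * x ^ 5 + + 10 * x ^ 4 - + 20 * x ^ 2 - + 16 * x - + 8))
    × (A * A + + 2 * (B * B) ≡ + p)
  sextic-case χ2 = integrality _ _
    (subst₂ (λ s t → + 2 * s * (+ 2 * s) + + 2 * (t * t) ≡ + 16 * + p)
      cubic-sum (cong (ℤ._+_ (+ 1)) sextic-sum) (sextic-identity χ2))

theorem1p3 : (p : ℕ) .{{_ : NonZero p}} → Prime p →
    (p ℕ.% 8 ≡ 1 → (n : ℤ) → legendre p n ≡ - (+ 1) →
    Σ ℤ (λ A → Σ ℤ (λ B →
    (+ 2 * A ≡ legendreSum p (λ x → x ^ 3 + + 4 * x ^ 2 + + 2 * x))
    × (+ 4 * B ≡ legendreSum p (λ x → x ^ 5 + n * x))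
    × (A * A + + 2 * (B * B) ≡ + p))))
    × (p ℕ.% 8 ≡ 3 →
    Σ ℤ (λ A → Σ ℤ (λ B →
    (+ 2 * A ≡ legendreSum p (λ x → x ^ 3 + + 4 * x ^ 2 + + 2 * x))
    × (+ 4 * B ≡ + 1 + legendreSum p (λ x → x ^ 6 + + 4 * x ^ 5 + + 10 * x ^ 4 - + 20 * x ^ 2 - + 16 * x - + 8))
    × (A * A + + 2 * (B * B) ≡ + p))))
theorem1p3 p p-prime =
  (λ p≡1 n legendre-n →
    let 2≉0        = prime≢2⇒2≉0 p p-prime (λ p≡2 → contradiction (trans (sym (cong (ℕ._% 8) p≡2)) p≡1) (λ ()))
        open PrimeField p p-prime 2≉0
        (χ-1 , χ2) = SupplementaryLaws.p≡1[8]⇒χ p p-prime 2≉0 p≡1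
        χ-2        = trans (χ-* (- (+ 1)) (+ 2)) (cong₂ _*_ χ-1 χ2)
    in LegendreSums.quintic-case p p-prime 2≉0 χ-2 χ-1 n (trans (χ≡legendre n) legendre-n)) ,
  (λ p≡3 →
    let 2≉0        = prime≢2⇒2≉0 p p-prime (λ p≡2 → contradiction (trans (sym (cong (ℕ._% 8) p≡2)) p≡3) (λ ()))
        open PrimeField p p-prime 2≉0
        (χ-1 , χ2) = SupplementaryLaws.p≡3[8]⇒χ p p-prime 2≉0 p≡3
        χ-2        = trans (χ-* (- (+ 1)) (+ 2)) (cong₂ _*_ χ-1 χ2)
    in LegendreSums.sextic-case p p-prime 2≉0 χ-2 χ2)
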